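{- There exists a constant $c$ such that for all positive integers $n$, \[\operatorname{herdisc}(\mathcal A_n)\le c\,\phi(n)^{1/2}\left(\log\frac{en}{\phi(n)}\right)^{3/2}.\]
   Context: $\mathbb{Z}_n$ denotes the integers modulo $n$. An arithmetic progression in $\mathbb{Z}_n$ is a set $\{a+kd: 0\le k<l\}$ with $a,d\in\mathbb{Z}_n$ and $l$ an integer with $0\le l\le n/\gcd(n,d)$; $\mathcal A_n$ is the family of all arithmetic progressions in $\mathbb{Z}_n$. For $X\subseteq\mathbb{Z}_n$, $\operatorname{disc}(\mathcal A_n|_X)=\min_{\chi:X\to\{1,-1\}}\max_{A\in\mathcal A_n}|\sum_{x\in A\cap X}\chi(x)|$, and the hereditary discrepancy is $\operatorname{herdisc}(\mathcal A_n)=\max_{X\subseteq\mathbb{Z}_n}\operatorname{disc}(\mathcal A_n|_X)$. $\phi$ is Euler's totient function; logarithms are natural. -}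

module Defs where

open import Data.Nat using (ℕ; zero; suc; _+_; _*_; _≤_; _%_)
open import Data.Nat.GCD using (gcd)
open import Data.Bool using (Bool; true; false; if_then_else_)
open import Data.Fin using (Fin; toℕ; fromℕ<)
open import Data.Nat.DivMod using (m%n<n)
open import Data.Integer using (ℤ; +_; -_)
import Data.Integer as ℤ
open import Data.List using (List; length; filter; upTo)
open import Relation.Nullary.Decidable using (⌊_⌋)
open import Data.Nat using (_≟_)

φ : ℕ → ℕ
φ n = length (filter (λ k → gcd (suc k) n ≟ 1) (upTo n))

apElem : (m : ℕ) → Fin (suc m) → Fin (suc m) → ℕ → Fin (suc m)
apElem m a d k = fromℕ< (m%n<n (toℕ a + k * toℕ d) (suc m))

-- A colouring χ : X → {1,-1}, given as a Boolean (true ↦ +1, false ↦ -1);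
-- its values outside X are irrelevant.
sign : Bool → ℤ
sign true  = + 1
sign false = - (+ 1)

-- Σ_{x ∈ A ∩ X} χ(x) for the progression A = {a + k d : 0 ≤ k < l}
-- (X ⊆ ℤ_n given by its indicator function).  When l ≤ n / gcd(n,d) the
-- terms a + k d (k < l) are pairwise distinct, so this is the sum over A ∩ X.
apSum : (m : ℕ) → (Fin (suc m) → Bool) → (Fin (suc m) → Bool) →
        Fin (suc m) → Fin (suc m) → ℕ → ℤ
apSum m X χ a d zero    = + 0
apSum m X χ a d (suc l) =
  (if X (apElem m a d l) then sign (χ (apElem m a d l)) else + 0) ℤ.+ apSum m X χ a d l

{-# OPTIONS --safe #-}
module Submission where

-- Beck's partial colouring method.  For every difference d list ℤ_n coset by coset of ⟨d⟩ in
-- steps of d; a progression is then at most two intervals, of length at most n / gcd(n, d).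
-- Restrict the lists to the r points still to be coloured and cut them into aligned blocks of
-- 2 ^ 16i points; an interval is a union of boundedly many blocks of each size.  Blocks of
-- size s occur only for differences with gcd(n, d) ≤ n / s, and there are
-- O(φ(n) (1 + log (n / s))) of these: if F(g) = #{y < n : gcd(n, y) = g} then
-- g F(g) ≤ Σ_{e ∣ g} F(e), and a dyadic summation of this inequality gives the count.
-- Let D ≈ φ(n) (1 + k).  Round all block sums to buckets, of width ≈ √D at block size s ≈ D and
-- decaying geometrically in log s away from it.  By second and fourth moments the bucket
-- vector of a random colouring has an average code length below a small multiple of r, so by
-- Kraft's inequality some class of colourings with equal buckets is too large for a Hamming
-- ball of radius r / 16; half the difference of two far members colours r / 16 points with all
-- interval sums O(√D).  The k or so doublings of r above D cost O(√D) each, and below D the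
-- costs decrease geometrically, hence the total O(k √D) = O(√φ(n) (1 + k) ^ (3/2)).

open import Defs
open import Data.Nat
open import Data.Nat.Properties
open import Data.Nat.Divisibility
open import Data.Nat.DivMod
open import Data.Nat.GCD using (gcd; gcd[m,n]∣m; gcd[m,n]∣n; gcd[m,n]≢0; gcd-comm; gcd-identityʳ; gcd-greatest; c*gcd[m,n]≡gcd[cm,cn])
open import Data.Nat.Coprimality using (Coprime; coprime-divisor; gcd≡1⇒coprime)
open import Data.Nat.Induction using (<-rec)
open import Data.Nat.Tactic.RingSolver using (solve-∀)
open import Data.Bool using (Bool; true; false; _∧_; not; if_then_else_)
open import Data.Fin using (Fin; zero; suc; toℕ; fromℕ<)
open import Data.Fin.Properties using (toℕ-fromℕ<; fromℕ<-cong)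
open import Data.Vec using (Vec; []; _∷_; lookup)
open import Data.List using (List; []; _∷_; _++_; map; length; filter; filterᵇ; upTo; applyUpTo; concatMap; take; drop)
open import Data.List.Properties using (filter-++; length-++; length-map; length-take; length-drop; length-applyUpTo; applyUpTo-∷ʳ; upTo-∷ʳ)
open import Data.List.Membership.Propositional using (_∈_)
open import Data.List.Membership.Propositional.Properties using (∈-++⁺ˡ; ∈-++⁺ʳ; ∈-++⁻; ∈-map⁺; ∈-map⁻)
open import Data.List.Relation.Unary.Any using (here; there)
open import Data.List.Relation.Unary.All as All using (All; []; _∷_; all?)
open import Data.Product using (∃; ∃-syntax; _×_; _,_; proj₁; proj₂)
open import Data.Sum using (_⊎_; inj₁; inj₂)
open import Function using (_∘_)
open import Relation.Nullary using (¬_; Dec; yes; no; contradiction)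
open import Relation.Nullary.Decidable using (map′; _×-dec_; _⊎-dec_)
open import Relation.Binary.PropositionalEquality

-- Entropies would need logarithms of probabilities; explicit codes with integer lengths keep the
-- argument within ℕ, at the price of Kraft sums slightly above 1. The delicate balance is at the
-- small blocks. At scale i = j - e put b = 2 ^ e. Blocks there have s j / b ^ 16 points, so there
-- are about b ^ 16 times as many as at scale j, up to a factor linear in e. The allowed deviation,
-- √(s j) / b, is b ^ 7 standard deviations. A second moment would gain only b ^ 14 per block, less
-- than the number of blocks. The fourth moment gains b ^ 28, which pays for b ^ 16, for b ^ 5 and b
-- ^ 6 in place of two factors linear in e, and leaves 1 / b for a geometric series; the wide ratio
-- 2 ^ 16 between scales makes room for such crude estimates. Above scale j the blocks are so few
-- that a first moment is enough.

private variable A B : Set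

-- Finite sums over lists and over initial segments of ℕ

Σ : List A → (A → ℕ) → ℕ
Σ []       f = 0
Σ (x ∷ xs) f = f x + Σ xs f

Σ-cong : ∀ (xs : List A) {f g : A → ℕ} → (∀ x → f x ≡ g x) → Σ xs f ≡ Σ xs g
Σ-cong []       e = refl
Σ-cong (x ∷ xs) e = cong₂ _+_ (e x) (Σ-cong xs e)

Σ-mono : ∀ (xs : List A) {f g : A → ℕ} → (∀ x → f x ≤ g x) → Σ xs f ≤ Σ xs g
Σ-mono []       e = z≤n
Σ-mono (x ∷ xs) e = +-mono-≤ (e x) (Σ-mono xs e)

interchange : ∀ a b c d → (a + b) + (c + d) ≡ (a + c) + (b + d)
interchange = solve-∀

Σ-+ : ∀ (xs : List A) (f g : A → ℕ) → Σ xs (λ x → f x + g x) ≡ Σ xs f + Σ xs g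
Σ-+ []       f g = refl
Σ-+ (x ∷ xs) f g = trans (cong (f x + g x +_) (Σ-+ xs f g)) (interchange (f x) (g x) _ _)

Σ-*ˡ : ∀ (xs : List A) c (f : A → ℕ) → Σ xs (λ x → c * f x) ≡ c * Σ xs f
Σ-*ˡ []       c f = sym (*-zeroʳ c)
Σ-*ˡ (x ∷ xs) c f = trans (cong (c * f x +_) (Σ-*ˡ xs c f)) (sym (*-distribˡ-+ c (f x) _))

Σ-*ʳ : ∀ (xs : List A) c (f : A → ℕ) → Σ xs (λ x → f x * c) ≡ Σ xs f * c
Σ-*ʳ xs c f = trans (Σ-cong xs (λ x → *-comm (f x) c)) (trans (Σ-*ˡ xs c f) (*-comm c _))

Σ-const : ∀ (xs : List A) c → Σ xs (λ _ → c) ≡ length xs * c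
Σ-const []       c = refl
Σ-const (x ∷ xs) c = cong (c +_) (Σ-const xs c)

Σ-swap : ∀ (xs : List A) (ys : List B) (f : A → B → ℕ) →
  Σ xs (λ x → Σ ys (f x)) ≡ Σ ys (λ y → Σ xs (λ x → f x y))
Σ-swap []       ys f = sym (trans (Σ-const ys 0) (*-zeroʳ (length ys)))
Σ-swap (x ∷ xs) ys f = trans (cong (Σ ys (f x) +_) (Σ-swap xs ys f)) (sym (Σ-+ ys (f x) _))

Σ-++ : ∀ (xs ys : List A) (f : A → ℕ) → Σ (xs ++ ys) f ≡ Σ xs f + Σ ys f
Σ-++ []       ys f = refl
Σ-++ (x ∷ xs) ys f = trans (cong (f x +_) (Σ-++ xs ys f)) (sym (+-assoc (f x) _ _))

Σ-map : ∀ (h : A → B) (xs : List A) (f : B → ℕ) → Σ (map h xs) f ≡ Σ xs (f ∘ h)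
Σ-map h []       f = refl
Σ-map h (x ∷ xs) f = cong (f (h x) +_) (Σ-map h xs f)

Σ-concatMap : ∀ (h : A → List B) (xs : List A) (f : B → ℕ) → Σ (concatMap h xs) f ≡ Σ xs (λ x → Σ (h x) f)
Σ-concatMap h []       f = refl
Σ-concatMap h (x ∷ xs) f = trans (Σ-++ (h x) _ f) (cong (Σ (h x) f +_) (Σ-concatMap h xs f))

-- rng n = n-1, …, 1, 0, so that Σ (rng (suc n)) f unfolds to f n + Σ (rng n) f
rng : ℕ → List ℕ
rng zero    = []
rng (suc n) = n ∷ rng n

length-rng : ∀ n → length (rng n) ≡ n
length-rng zero    = refl
length-rng (suc n) = cong suc (length-rng n)

Σ-rng-mono : ∀ n {f g : ℕ → ℕ} → (∀ x → x < n → f x ≤ g x) → Σ (rng n) f ≤ Σ (rng n) g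
Σ-rng-mono zero    e = z≤n
Σ-rng-mono (suc n) e = +-mono-≤ (e n ≤-refl) (Σ-rng-mono n (λ x l → e x (m<n⇒m<1+n l)))

Σ-rng-≤ : ∀ n c {f : ℕ → ℕ} → (∀ x → x < n → f x ≤ c) → Σ (rng n) f ≤ n * c
Σ-rng-≤ n c e = ≤-trans (Σ-rng-mono n e) (≤-reflexive (trans (Σ-const (rng n) c) (cong (_* c) (length-rng n))))

Σ-rng-split : ∀ a b (f : ℕ → ℕ) → Σ (rng (a + b)) f ≡ Σ (rng a) (λ x → f (x + b)) + Σ (rng b) f
Σ-rng-split zero    b f = refl
Σ-rng-split (suc a) b f = trans (cong (f (a + b) +_) (Σ-rng-split a b f)) (sym (+-assoc (f (a + b)) _ _))

Σ-rng-shift : ∀ n (f : ℕ → ℕ) → f n + Σ (rng n) f ≡ Σ (rng n) (f ∘ suc) + f 0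
Σ-rng-shift n f = begin
  f n + Σ (rng n) f                 ≡⟨⟩
  Σ (rng (suc n)) f                 ≡⟨ cong (λ k → Σ (rng k) f) (sym (+-comm n 1)) ⟩
  Σ (rng (n + 1)) f                 ≡⟨ Σ-rng-split n 1 f ⟩
  Σ (rng n) (λ x → f (x + 1)) + (f 0 + 0) ≡⟨ cong₂ _+_ (Σ-cong (rng n) (λ x → cong f (+-comm x 1))) (+-identityʳ (f 0)) ⟩
  Σ (rng n) (f ∘ suc) + f 0         ∎
  where open ≡-Reasoning

Σ-rng-term : ∀ n (f : ℕ → ℕ) x → x < n → f x ≤ Σ (rng n) f
Σ-rng-term (suc n) f x x<n with x ≟ n
... | yes refl = m≤m+n (f n) _
... | no  x≢n  = ≤-trans (Σ-rng-term n f x (≤∧≢⇒< (≤-pred x<n) x≢n)) (m≤n+m _ (f n))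

Σ-rng-≤-mono : ∀ {a b} (f : ℕ → ℕ) → a ≤ b → Σ (rng a) f ≤ Σ (rng b) f
Σ-rng-≤-mono {a} {b} f a≤b = ≤-trans (m≤n+m _ _)
  (≤-reflexive (trans (sym (Σ-rng-split (b ∸ a) a f)) (cong (λ k → Σ (rng k) f) (m∸n+n≡m a≤b))))

-- Indicators of decidable propositions

⟦_⟧ : ∀ {P : Set} → Dec P → ℕ
⟦ yes _ ⟧ = 1
⟦ no  _ ⟧ = 0

⟦⟧≤1 : ∀ {P : Set} (p : Dec P) → ⟦ p ⟧ ≤ 1
⟦⟧≤1 (yes _) = ≤-refl
⟦⟧≤1 (no _)  = z≤n

⟦⟧-mono : ∀ {P Q : Set} (p : Dec P) (q : Dec Q) → (P → Q) → ⟦ p ⟧ ≤ ⟦ q ⟧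
⟦⟧-mono (no _)  q       imp = z≤n
⟦⟧-mono (yes h) (yes _) imp = ≤-refl
⟦⟧-mono (yes h) (no ¬q) imp = contradiction (imp h) ¬q

⟦⟧-yes : ∀ {P : Set} (p : Dec P) → P → ⟦ p ⟧ ≡ 1
⟦⟧-yes (yes _) h = refl
⟦⟧-yes (no ¬p) h = contradiction h ¬p

⟦⟧-no : ∀ {P : Set} (p : Dec P) → ¬ P → ⟦ p ⟧ ≡ 0
⟦⟧-no (yes p) h = contradiction p h
⟦⟧-no (no _)  h = refl

⟦⟧-≤ : ∀ {P : Set} (p : Dec P) {k} → (P → 1 ≤ k) → ⟦ p ⟧ ≤ k
⟦⟧-≤ (yes h) f = f h
⟦⟧-≤ (no _)  f = z≤n

-- Counting residues by their gcd with n

Σ-rng-head : ∀ k (q : ℕ → ℕ) → (∀ x → 0 < x → x < suc k → q x ≡ 0) → Σ (rng (suc k)) q ≤ q 0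
Σ-rng-head zero    q h = ≤-reflexive (+-identityʳ (q 0))
Σ-rng-head (suc k) q h rewrite h (suc k) (s≤s z≤n) ≤-refl = Σ-rng-head k q (λ x p l → h x p (m<n⇒m<1+n l))

-- Cut the range into `ν` windows of length `g` that start at multiples of `g`; only the first point
-- of a window can contribute.
Σ-multiples : ∀ ν g .{{_ : NonZero g}} (p : ℕ → ℕ) → (∀ y → ¬ (g ∣ y) → p y ≡ 0) →
  Σ (rng (ν * g)) p ≤ Σ (rng ν) (λ u → p (u * g))
Σ-multiples zero    g p h = z≤n
Σ-multiples (suc ν) g@(suc g′) p h = begin
  Σ (rng (g + ν * g)) p                                   ≡⟨ Σ-rng-split g (ν * g) p ⟩
  Σ (rng g) (λ x → p (x + ν * g)) + Σ (rng (ν * g)) p     ≤⟨ +-mono-≤ (Σ-rng-head g′ (λ x → p (x + ν * g)) off) (Σ-multiples ν g p h) ⟩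
  p (ν * g) + Σ (rng ν) (λ u → p (u * g))                 ∎
  where
  open ≤-Reasoning
  off : ∀ x → 0 < x → x < g → p (x + ν * g) ≡ 0
  off x@(suc _) 0<x x<g = h _ λ d → <⇒≱ x<g (∣⇒≤ (∣m+n∣m⇒∣n (subst (g ∣_) (+-comm x (ν * g)) d) (n∣m*n ν)))

Σ-periodic : ∀ g ν (p : ℕ → ℕ) → (∀ x c → p (x + c * ν) ≡ p x) → Σ (rng (g * ν)) p ≡ g * Σ (rng ν) p
Σ-periodic zero    ν p h = refl
Σ-periodic (suc g) ν p h = trans (Σ-rng-split ν (g * ν) p)
  (cong₂ _+_ (Σ-cong (rng ν) (λ x → h x g)) (Σ-periodic g ν p h))

length-filter-upTo : ∀ {P : ℕ → Set} (P? : ∀ k → Dec (P k)) l →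
  length (filter P? (upTo l)) ≡ Σ (rng l) (λ k → ⟦ P? k ⟧)
length-filter-upTo P? zero    = refl
length-filter-upTo P? (suc l) = begin
  length (filter P? (upTo (suc l)))                          ≡⟨ cong (length ∘ filter P?) (upTo-∷ʳ l) ⟨
  length (filter P? (upTo l ++ l ∷ []))                      ≡⟨ cong length (filter-++ P? (upTo l) (l ∷ [])) ⟩
  length (filter P? (upTo l) ++ filter P? (l ∷ []))          ≡⟨ length-++ (filter P? (upTo l)) ⟩
  length (filter P? (upTo l)) + length (filter P? (l ∷ []))  ≡⟨ cong₂ _+_ (length-filter-upTo P? l) last ⟩
  Σ (rng l) (λ k → ⟦ P? k ⟧) + ⟦ P? l ⟧                      ≡⟨ +-comm _ ⟦ P? l ⟧ ⟩
  Σ (rng (suc l)) (λ k → ⟦ P? k ⟧)                           ∎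
  where
  open ≡-Reasoning
  last : length (filter P? (l ∷ [])) ≡ ⟦ P? l ⟧
  last with P? l
  ... | yes _ = refl
  ... | no  _ = refl

module GcdCounts (m : ℕ) where

  n : ℕ
  n = suc m

  γ : ℕ → ℕ
  γ y = gcd n y

  1≤γ : ∀ y → 1 ≤ γ y
  1≤γ y = n≢0⇒n>0 (gcd[m,n]≢0 n y (inj₁ λ ()))

  F : ℕ → ℕ
  F g = Σ (rng n) (λ y → ⟦ γ y ≟ g ⟧)

  H : ℕ → ℕ
  H g = Σ (rng n) (λ y → ⟦ γ y ∣? g ⟧)

  gcd-periodic : ∀ ν x c → gcd ν (x + c * ν) ≡ gcd ν x
  gcd-periodic ν x c = ∣-antisym
    (gcd-greatest (gcd[m,n]∣m ν _)
      (∣m+n∣m⇒∣n (subst (gcd ν (x + c * ν) ∣_) (+-comm x (c * ν)) (gcd[m,n]∣n ν _))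
                 (∣n⇒∣m*n c (gcd[m,n]∣m ν _))))
    (gcd-greatest (gcd[m,n]∣m ν x) (∣m∣n⇒∣m+n (gcd[m,n]∣n ν x) (∣n⇒∣m*n c (gcd[m,n]∣m ν x))))

  -- With n = ν g, both sides are compared with #{y < n : gcd ν y = 1}: the residues of gcd g
  -- are g u with u < ν prime to ν, while gcd ν y = 1 forces gcd n y to divide g.
  g*F≤H : ∀ g .{{_ : NonZero g}} → g * F g ≤ H g
  g*F≤H g with g ∣? n
  ... | no g∤n = ≤-trans (≤-reflexive (trans (cong (g *_) F≡0) (*-zeroʳ g))) z≤n
    where
    F≡0 : F g ≡ 0
    F≡0 = trans (Σ-cong (rng n) (λ y → ⟦⟧-no (γ y ≟ g) λ e → g∤n (subst (_∣ n) e (gcd[m,n]∣m n y))))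
                (trans (Σ-const (rng n) 0) (*-zeroʳ (length (rng n))))
  ... | yes (divides ν n≡νg) = begin
    g * F g                                              ≤⟨ *-monoʳ-≤ g F≤F′ ⟩
    g * Σ (rng ν) (λ u → ⟦ gcd ν u ≟ 1 ⟧)         ≡⟨ Σ-periodic g ν _ (λ x c → cong (λ k → ⟦ k ≟ 1 ⟧) (gcd-periodic ν x c)) ⟨
    Σ (rng (g * ν)) (λ y → ⟦ gcd ν y ≟ 1 ⟧)       ≡⟨ cong (λ k → Σ (rng k) (λ y → ⟦ gcd ν y ≟ 1 ⟧)) (trans (*-comm g ν) (sym n≡νg)) ⟩
    Σ (rng n) (λ y → ⟦ gcd ν y ≟ 1 ⟧)             ≤⟨ Σ-mono (rng n) (λ y → ⟦⟧-mono (gcd ν y ≟ 1) (γ y ∣? g) (div y)) ⟩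
    H g                                                  ∎
    where
    open ≤-Reasoning
    F≤F′ : F g ≤ Σ (rng ν) (λ u → ⟦ gcd ν u ≟ 1 ⟧)
    F≤F′ = begin
      Σ (rng n) (λ y → ⟦ γ y ≟ g ⟧)               ≡⟨ cong (λ k → Σ (rng k) (λ y → ⟦ γ y ≟ g ⟧)) n≡νg ⟩
      Σ (rng (ν * g)) (λ y → ⟦ γ y ≟ g ⟧)         ≤⟨ Σ-multiples ν g _ (λ y g∤y → ⟦⟧-no (γ y ≟ g) λ e → g∤y (subst (_∣ y) e (gcd[m,n]∣n n y))) ⟩
      Σ (rng ν) (λ u → ⟦ γ (u * g) ≟ g ⟧)         ≤⟨ Σ-mono (rng ν) (λ u → ⟦⟧-mono (γ (u * g) ≟ g) (gcd ν u ≟ 1) (cop u)) ⟩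
      Σ (rng ν) (λ u → ⟦ gcd ν u ≟ 1 ⟧)           ∎
      where
      cop : ∀ u → γ (u * g) ≡ g → gcd ν u ≡ 1
      cop u e = *-cancelˡ-≡ (gcd ν u) 1 g (trans (c*gcd[m,n]≡gcd[cm,cn] g ν u)
        (trans (cong₂ gcd (trans (*-comm g ν) (sym n≡νg)) (*-comm g u)) (trans e (sym (*-identityʳ g)))))
    div : ∀ y → gcd ν y ≡ 1 → γ y ∣ g
    div y e = coprime-divisor {n = ν}
      (λ { (d∣γ , d∣ν) → gcd≡1⇒coprime {ν} {y} e (d∣ν , ∣-trans d∣γ (gcd[m,n]∣n n y)) })
      (subst (γ y ∣_) n≡νg (gcd[m,n]∣m n y))

  F0≡0 : F 0 ≡ 0
  F0≡0 = trans (Σ-cong (rng n) (λ y → ⟦⟧-no (γ y ≟ 0) λ e → contradiction (1≤γ y) (<⇒≱ (s≤s (≤-reflexive e)))))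
               (trans (Σ-const (rng n) 0) (*-zeroʳ (length (rng n))))

  H≤ΣF : ∀ e → H (suc e) ≤ Σ (rng (suc e)) (λ x → F (suc x))
  H≤ΣF e = begin
    H (suc e)                                                         ≤⟨ Σ-mono (rng n) pt ⟩
    Σ (rng n) (λ y → Σ (rng (suc e)) (λ x → ⟦ γ y ≟ suc x ⟧))  ≡⟨ Σ-swap (rng n) (rng (suc e)) _ ⟩
    Σ (rng (suc e)) (λ x → F (suc x))                                 ∎
    where
    open ≤-Reasoning
    pt : ∀ y → ⟦ γ y ∣? suc e ⟧ ≤ Σ (rng (suc e)) (λ x → ⟦ γ y ≟ suc x ⟧)
    pt y = ⟦⟧-≤ (γ y ∣? suc e) λ d → ≤-trans
      (≤-reflexive (sym (⟦⟧-yes (γ y ≟ suc (pred (γ y))) (sym (suc-pred (γ y) {{>-nonZero (1≤γ y)}})))))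
      (Σ-rng-term (suc e) (λ x → ⟦ γ y ≟ suc x ⟧) (pred (γ y))
        (≤-trans (≤-reflexive (suc-pred (γ y) {{>-nonZero (1≤γ y)}})) (∣⇒≤ d)))

  -- In e F(e) ≤ H(e) ≤ F(e) + F(e - 1) + ... + F(1) one copy of F(e) cancels, so F(e) is at most
  -- the average of the earlier values.
  F≤F1 : ∀ e → F e ≤ F 1
  F≤F1 = <-rec _ step
    where
    step : ∀ e → (∀ {a} → a < e → F a ≤ F 1) → F e ≤ F 1
    step zero          ih = ≤-trans (≤-reflexive F0≡0) z≤n
    step (suc zero)    ih = ≤-refl
    step (suc (suc e)) ih = *-cancelˡ-≤ (suc e) (+-cancelˡ-≤ (F (2 + e)) _ _ (begin
      F (2 + e) + suc e * F (2 + e)                            ≤⟨ g*F≤H (2 + e) ⟩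
      H (2 + e)                                                ≤⟨ H≤ΣF (suc e) ⟩
      F (2 + e) + Σ (rng (suc e)) (λ x → F (suc x))            ≤⟨ +-monoʳ-≤ (F (2 + e)) (Σ-rng-≤ (suc e) (F 1) (λ x l → ih (s≤s l))) ⟩
      F (2 + e) + suc e * F 1                                  ∎))
      where open ≤-Reasoning

  dyadic : ℕ → ℕ → ℕ
  dyadic v c = ⟦ 2 ^ v ≤? c ⟧ * ⟦ c <? 2 ^ suc v ⟧

  s : ℕ → ℕ
  s v = Σ (rng n) (λ y → dyadic v (γ y))

  -- q v c = 2 ^ (v - u) when 2 ^ u ≤ c < 2 ^ (u + 1) ≤ 2 ^ (v + 1)
  q : ℕ → ℕ → ℕ
  q zero    c = dyadic zero c
  q (suc v) c = 2 * q v c + dyadic (suc v) c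

  -- This is the sum of 2 ^ (v - u) s u over u ≤ v; the weight estimates how many multiples of a
  -- number near 2 ^ u lie below 2 ^ v.
  τ : ℕ → ℕ
  τ v = Σ (rng n) (λ y → q v (γ y))

  τ-suc : ∀ v → τ (suc v) ≡ 2 * τ v + s (suc v)
  τ-suc v = trans (Σ-+ (rng n) (λ y → 2 * q v (γ y)) _) (cong (_+ s (suc v)) (Σ-*ˡ (rng n) 2 (λ y → q v (γ y))))

  dyadic-yes : ∀ v c → 2 ^ v ≤ c → c < 2 ^ suc v → dyadic v c ≡ 1
  dyadic-yes v c p r = cong₂ _*_ (⟦⟧-yes (2 ^ v ≤? c) p) (⟦⟧-yes (c <? 2 ^ suc v) r)

  dyadic-≤ : ∀ v c {k} → (2 ^ v ≤ c → c < 2 ^ suc v → 1 ≤ k) → dyadic v c ≤ k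
  dyadic-≤ v c f with 2 ^ v ≤? c
  ... | no  _ = z≤n
  ... | yes p with c <? 2 ^ suc v
  ...   | no  _ = z≤n
  ...   | yes r = f p r

  2^v≤q*c : ∀ v c → 1 ≤ c → c < 2 ^ suc v → 2 ^ v ≤ q v c * c
  2^v≤q*c zero    c 1≤c c<2 rewrite dyadic-yes zero c 1≤c c<2 = ≤-trans 1≤c (≤-reflexive (sym (+-identityʳ c)))
  2^v≤q*c (suc v) c 1≤c c<  with c <? 2 ^ suc v
  ... | yes r = begin
    2 * 2 ^ v                            ≤⟨ *-monoʳ-≤ 2 (2^v≤q*c v c 1≤c r) ⟩
    2 * (q v c * c)                      ≡⟨ *-assoc 2 (q v c) c ⟨
    2 * q v c * c                        ≤⟨ *-monoˡ-≤ c (m≤m+n (2 * q v c) _) ⟩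
    (2 * q v c + dyadic (suc v) c) * c   ∎
    where open ≤-Reasoning
  ... | no r = begin
    2 ^ suc v                            ≤⟨ ≮⇒≥ r ⟩
    c                                    ≡⟨ *-identityˡ c ⟨
    1 * c                                ≡⟨ cong (_* c) (dyadic-yes (suc v) c (≮⇒≥ r) c<) ⟨
    dyadic (suc v) c * c                 ≤⟨ *-monoˡ-≤ c (m≤n+m (dyadic (suc v) c) (2 * q v c)) ⟩
    (2 * q v c + dyadic (suc v) c) * c   ∎
    where open ≤-Reasoning

  -- For c < 2 ^ (v + 1) the range is contained in the first 2 q c integers, of which 2 q are
  -- multiples of c. A larger c has no positive multiple in the range; this case is why 0 is left
  -- out.
  multiples≤2q : ∀ v c → 1 ≤ c → Σ (rng (2 ^ suc v)) (λ x → ⟦ 1 ≤? x ⟧ * ⟦ c ∣? x ⟧) ≤ 2 * q v c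
  multiples≤2q v c 1≤c with c <? 2 ^ suc v
  ... | yes r = begin
    Σ (rng (2 ^ suc v)) p                       ≤⟨ Σ-rng-≤-mono p big ⟩
    Σ (rng (2 * q v c * c)) p                   ≤⟨ Σ-multiples (2 * q v c) c {{>-nonZero 1≤c}} p (λ y h → trans (cong (⟦ 1 ≤? y ⟧ *_) (⟦⟧-no (c ∣? y) h)) (*-zeroʳ (⟦ 1 ≤? y ⟧))) ⟩
    Σ (rng (2 * q v c)) (λ u → p (u * c))       ≤⟨ Σ-rng-≤ (2 * q v c) 1 (λ x _ → *-mono-≤ (⟦⟧≤1 (1 ≤? x * c)) (⟦⟧≤1 (c ∣? x * c))) ⟩
    2 * q v c * 1                               ≡⟨ *-identityʳ _ ⟩
    2 * q v c                                   ∎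
    where
    open ≤-Reasoning
    p : ℕ → ℕ
    p x = ⟦ 1 ≤? x ⟧ * ⟦ c ∣? x ⟧
    big : 2 ^ suc v ≤ 2 * q v c * c
    big = ≤-trans (*-monoʳ-≤ 2 (2^v≤q*c v c 1≤c r)) (≤-reflexive (sym (*-assoc 2 (q v c) c)))
  ... | no r = ≤-trans (Σ-rng-≤ (2 ^ suc v) 0 zer) (≤-trans (≤-reflexive (*-zeroʳ (2 ^ suc v))) z≤n)
    where
    zer : ∀ x → x < 2 ^ suc v → ⟦ 1 ≤? x ⟧ * ⟦ c ∣? x ⟧ ≤ 0
    zer zero    _ = z≤n
    zer (suc x) l = ≤-reflexive (trans (+-identityʳ _) (⟦⟧-no (c ∣? suc x) λ d → r (≤-<-trans (∣⇒≤ d) l)))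

  -- Sum x F(x) ≤ H(x) over 1 ≤ x < 2 ^ (v + 1). On the left, the residues counted by `s v` alone
  -- give 2 ^ v each; on the right, y is counted once for every multiple of its gcd in the range.
  2^v*s≤2τ : ∀ v → 2 ^ v * s v ≤ 2 * τ v
  2^v*s≤2τ v = begin
    2 ^ v * s v                                                       ≡⟨ Σ-*ˡ (rng n) (2 ^ v) _ ⟨
    Σ (rng n) (λ y → 2 ^ v * dyadic v (γ y))                          ≤⟨ Σ-mono (rng n) low ⟩
    Σ (rng n) (λ y → Σ (rng N) (λ x → x * ⟦ γ y ≟ x ⟧))        ≡⟨ Σ-swap (rng n) (rng N) _ ⟩
    Σ (rng N) (λ x → Σ (rng n) (λ y → x * ⟦ γ y ≟ x ⟧))        ≡⟨ Σ-cong (rng N) (λ x → Σ-*ˡ (rng n) x _) ⟩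
    Σ (rng N) (λ x → x * F x)                                         ≤⟨ Σ-mono (rng N) mid ⟩
    Σ (rng N) (λ x → ⟦ 1 ≤? x ⟧ * H x)                         ≡⟨ Σ-cong (rng N) (λ x → sym (Σ-*ˡ (rng n) (⟦ 1 ≤? x ⟧) _)) ⟩
    Σ (rng N) (λ x → Σ (rng n) (λ y → ⟦ 1 ≤? x ⟧ * ⟦ γ y ∣? x ⟧)) ≡⟨ Σ-swap (rng N) (rng n) _ ⟩
    Σ (rng n) (λ y → Σ (rng N) (λ x → ⟦ 1 ≤? x ⟧ * ⟦ γ y ∣? x ⟧)) ≤⟨ Σ-mono (rng n) (λ y → multiples≤2q v (γ y) (1≤γ y)) ⟩
    Σ (rng n) (λ y → 2 * q v (γ y))                                   ≡⟨ Σ-*ˡ (rng n) 2 (λ y → q v (γ y)) ⟩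
    2 * τ v                                                           ∎
    where
    open ≤-Reasoning
    N : ℕ
    N = 2 ^ suc v
    low : ∀ y → 2 ^ v * dyadic v (γ y) ≤ Σ (rng N) (λ x → x * ⟦ γ y ≟ x ⟧)
    low y with 2 ^ v ≤? γ y
    ... | no  _ = ≤-trans (≤-reflexive (*-zeroʳ (2 ^ v))) z≤n
    ... | yes p with γ y <? 2 ^ suc v
    ...   | no  _ = ≤-trans (≤-reflexive (*-zeroʳ (2 ^ v))) z≤n
    ...   | yes r = begin
      2 ^ v * 1                                       ≡⟨ *-identityʳ _ ⟩
      2 ^ v                                           ≤⟨ p ⟩
      γ y                                             ≡⟨ *-identityʳ _ ⟨
      γ y * 1                                         ≡⟨ cong (γ y *_) (sym (⟦⟧-yes (γ y ≟ γ y) refl)) ⟩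
      γ y * ⟦ γ y ≟ γ y ⟧                      ≤⟨ Σ-rng-term N (λ x → x * ⟦ γ y ≟ x ⟧) (γ y) r ⟩
      Σ (rng N) (λ x → x * ⟦ γ y ≟ x ⟧)        ∎
    mid : ∀ x → x * F x ≤ ⟦ 1 ≤? x ⟧ * H x
    mid zero    = z≤n
    mid (suc x) = ≤-trans (g*F≤H (suc x)) (≤-reflexive (sym (+-identityʳ _)))

  s≤2^*F1 : ∀ v → s v ≤ 2 ^ suc v * F 1
  s≤2^*F1 v = begin
    s v                                                              ≤⟨ Σ-mono (rng n) pt ⟩
    Σ (rng n) (λ y → Σ (rng (2 ^ suc v)) (λ x → ⟦ γ y ≟ x ⟧)) ≡⟨ Σ-swap (rng n) (rng (2 ^ suc v)) _ ⟩
    Σ (rng (2 ^ suc v)) F                                            ≤⟨ Σ-rng-≤ (2 ^ suc v) (F 1) (λ x _ → F≤F1 x) ⟩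
    2 ^ suc v * F 1                                                  ∎
    where
    open ≤-Reasoning
    pt : ∀ y → dyadic v (γ y) ≤ Σ (rng (2 ^ suc v)) (λ x → ⟦ γ y ≟ x ⟧)
    pt y = dyadic-≤ v (γ y) λ _ r → ≤-trans (≤-reflexive (sym (⟦⟧-yes (γ y ≟ γ y) refl)))
      (Σ-rng-term (2 ^ suc v) (λ x → ⟦ γ y ≟ x ⟧) (γ y) r)

  -- `φ` looks at 1, ..., n and `F 1` at 0, ..., n - 1; the end points 0 and n have the same gcd
  -- with n.
  F1≤φ : F 1 ≤ φ n
  F1≤φ = ≤-reflexive (begin
    Σ (rng n) h                                                  ≡⟨ +-cancelˡ-≡ (h n) _ _ shifted ⟩
    Σ (rng n) (h ∘ suc)                                          ≡⟨ Σ-cong (rng n) (λ k → cong (λ c → ⟦ c ≟ 1 ⟧) (gcd-comm n (suc k))) ⟩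
    Σ (rng n) (λ k → ⟦ gcd (suc k) n ≟ 1 ⟧)                      ≡⟨ length-filter-upTo (λ k → gcd (suc k) n ≟ 1) n ⟨
    φ n                                                          ∎)
    where
    open ≡-Reasoning
    h : ℕ → ℕ
    h y = ⟦ γ y ≟ 1 ⟧
    shifted : h n + Σ (rng n) h ≡ h n + Σ (rng n) (h ∘ suc)
    shifted = trans (Σ-rng-shift n h) (trans (+-comm _ (h 0)) (cong (λ c → ⟦ c ≟ 1 ⟧ + Σ (rng n) (h ∘ suc))
      (trans (gcd-identityʳ n) (sym (∣-antisym (gcd[m,n]∣m n n) (gcd-greatest ∣-refl ∣-refl))))))

  -- The bound τ v ≤ 16 f (2 ^ v - 4) is preserved by τ (v + 1) = 2 τ v + s (v + 1) because
  -- 2 ^ v s v ≤ 2 τ v makes the increment a 2 ^ - v fraction of τ v.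
  τ-bound : ∀ w → τ (3 + w) + 64 * F 1 ≤ 16 * F 1 * 2 ^ (3 + w)
  -- The crude bounds s v ≤ 2 ^ (v + 1) f give exactly 64 f = 16 f (2 ^ 3 - 4), so the induction can
  -- start at 3.
  τ-bound zero = begin
    τ 3 + 64 * f                                            ≡⟨ cong (_+ 64 * f) τ3 ⟩
    8 * s 0 + 4 * s 1 + 2 * s 2 + s 3 + 64 * f              ≤⟨ +-monoˡ-≤ (64 * f) (+-mono-≤ (+-mono-≤ (+-mono-≤ (*-monoʳ-≤ 8 (s≤2^*F1 0)) (*-monoʳ-≤ 4 (s≤2^*F1 1))) (*-monoʳ-≤ 2 (s≤2^*F1 2))) (s≤2^*F1 3)) ⟩
    8 * (2 * f) + 4 * (4 * f) + 2 * (8 * f) + 16 * f + 64 * f ≡⟨ arith f ⟩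
    16 * f * 8                                              ∎
    where
    open ≤-Reasoning
    f = F 1
    expand : ∀ a b c d → 2 * (2 * (2 * a + b) + c) + d ≡ 8 * a + 4 * b + 2 * c + d
    expand = solve-∀
    τ3 : τ 3 ≡ 8 * s 0 + 4 * s 1 + 2 * s 2 + s 3
    τ3 = trans (τ-suc 2) (trans (cong (λ k → 2 * k + s 3) (trans (τ-suc 1) (cong (λ k → 2 * k + s 2) (τ-suc 0))))
      (expand (s 0) (s 1) (s 2) (s 3)))
    arith : ∀ x → 8 * (2 * x) + 4 * (4 * x) + 2 * (8 * x) + 16 * x + 64 * x ≡ 16 * x * 8
    arith = solve-∀
  -- Since P s ≤ 2 T, the recursion P T = 2 P T₀ + P s becomes (P - 2) T ≤ 2 P T₀; hence the
  -- multiplication by P - 2 and the term 2 T on both sides.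
  τ-bound (suc w) = *-cancelˡ-≤ (2 ^ (4 + w) ∸ 2) {{>-nonZero (≤-trans (s≤s z≤n) 2≤P-2)}}
    (+-cancelʳ-≤ (2 * τ (4 + w)) _ _ (begin
    (P ∸ 2) * (T + 64 * f) + 2 * T                 ≡⟨ e₁ (P ∸ 2) T f ⟩
    ((P ∸ 2) + 2) * T + (P ∸ 2) * (64 * f)         ≡⟨ cong (λ k → k * T + (P ∸ 2) * (64 * f)) (m∸n+n≡m 2≤P) ⟩
    P * T + (P ∸ 2) * (64 * f)                     ≡⟨ cong (λ k → P * k + (P ∸ 2) * (64 * f)) (τ-suc (3 + w)) ⟩
    P * (2 * T₀ + s (4 + w)) + (P ∸ 2) * (64 * f)  ≡⟨ e₂ P T₀ (s (4 + w)) (P ∸ 2) f ⟩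
    2 * P * T₀ + (P ∸ 2) * (64 * f) + P * s (4 + w) ≤⟨ +-mono-≤ core (2^v*s≤2τ (4 + w)) ⟩
    (P ∸ 2) * (16 * f * P) + 2 * T                 ∎))
    where
    open ≤-Reasoning
    f = F 1
    P = 2 ^ (4 + w)
    T = τ (4 + w)
    T₀ = τ (3 + w)
    4≤P : 4 ≤ P
    4≤P = ^-monoʳ-≤ 2 {2} {4 + w} (s≤s (s≤s z≤n))
    2≤P : 2 ≤ P
    2≤P = ≤-trans (s≤s (s≤s z≤n)) 4≤P
    2≤P-2 : 2 ≤ P ∸ 2
    2≤P-2 = ∸-monoˡ-≤ 2 4≤P
    e₁ : ∀ a t f → a * (t + 64 * f) + 2 * t ≡ (a + 2) * t + a * (64 * f)
    e₁ = solve-∀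
    e₂ : ∀ p t s a f → p * (2 * t + s) + a * (64 * f) ≡ 2 * p * t + a * (64 * f) + p * s
    e₂ = solve-∀
    core : 2 * P * T₀ + (P ∸ 2) * (64 * f) ≤ (P ∸ 2) * (16 * f * P)
    core = +-cancelʳ-≤ (2 * P * (64 * f)) _ _ (begin
      2 * P * T₀ + (P ∸ 2) * (64 * f) + 2 * P * (64 * f)   ≡⟨ e₅ P T₀ (P ∸ 2) f ⟩
      2 * P * (T₀ + 64 * f) + (P ∸ 2) * (64 * f)           ≤⟨ +-monoˡ-≤ _ (*-monoʳ-≤ (2 * P) (τ-bound w)) ⟩
      2 * P * (16 * f * 2 ^ (3 + w)) + (P ∸ 2) * (64 * f)  ≡⟨ cong (_+ (P ∸ 2) * (64 * f)) (e₆ P f (2 ^ (3 + w))) ⟩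
      P * (16 * f * P) + (P ∸ 2) * (64 * f)                ≡⟨ cong (λ k → k * (16 * f * P) + (P ∸ 2) * (64 * f)) (m∸n+n≡m 2≤P) ⟨
      (P ∸ 2 + 2) * (16 * f * P) + (P ∸ 2) * (64 * f)      ≤⟨ +-monoʳ-≤ ((P ∸ 2 + 2) * (16 * f * P)) (*-monoˡ-≤ (64 * f) (m∸n≤m P 2)) ⟩
      (P ∸ 2 + 2) * (16 * f * P) + P * (64 * f)            ≡⟨ e₇ (P ∸ 2) f P ⟩
      (P ∸ 2) * (16 * f * P) + (P * (32 * f) + P * (64 * f)) ≤⟨ +-monoʳ-≤ ((P ∸ 2) * (16 * f * P)) (≤-trans (≤-reflexive (e₈ P f)) (*-monoˡ-≤ f (*-monoʳ-≤ P (s≤s96)))) ⟩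
      (P ∸ 2) * (16 * f * P) + P * 128 * f                 ≡⟨ cong ((P ∸ 2) * (16 * f * P) +_) (e₉ P f) ⟩
      (P ∸ 2) * (16 * f * P) + 2 * P * (64 * f)            ∎)
      where
      s≤s96 : 96 ≤ 128
      s≤s96 = m≤m+n 96 32
      e₅ : ∀ p t a f → 2 * p * t + a * (64 * f) + 2 * p * (64 * f) ≡ 2 * p * (t + 64 * f) + a * (64 * f)
      e₅ = solve-∀
      e₆ : ∀ p f h → 2 * p * (16 * f * h) ≡ p * (16 * f * (2 * h))
      e₆ = solve-∀
      e₇ : ∀ a f p → (a + 2) * (16 * f * p) + p * (64 * f) ≡ a * (16 * f * p) + (p * (32 * f) + p * (64 * f))
      e₇ = solve-∀
      e₈ : ∀ p f → p * (32 * f) + p * (64 * f) ≡ p * 96 * f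
      e₈ = solve-∀
      e₉ : ∀ p f → p * 128 * f ≡ 2 * p * (64 * f)
      e₉ = solve-∀

  s≤32F1 : ∀ v → s v ≤ 32 * F 1
  s≤32F1 0 = ≤-trans (s≤2^*F1 0) (*-monoˡ-≤ (F 1) (m≤m+n 2 30))
  s≤32F1 1 = ≤-trans (s≤2^*F1 1) (*-monoˡ-≤ (F 1) (m≤m+n 4 28))
  s≤32F1 2 = ≤-trans (s≤2^*F1 2) (*-monoˡ-≤ (F 1) (m≤m+n 8 24))
  s≤32F1 (suc (suc (suc w))) = *-cancelˡ-≤ (2 ^ (3 + w)) {{m^n≢0 2 (3 + w)}} (begin
    P * s (3 + w)          ≤⟨ 2^v*s≤2τ (3 + w) ⟩
    2 * τ (3 + w)          ≤⟨ *-monoʳ-≤ 2 (≤-trans (m≤m+n (τ (3 + w)) (64 * F 1)) (τ-bound w)) ⟩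
    2 * (16 * F 1 * P)     ≡⟨ e (F 1) P ⟩
    P * (32 * F 1)         ∎)
    where
    open ≤-Reasoning
    P = 2 ^ (3 + w)
    e : ∀ f p → 2 * (16 * f * p) ≡ p * (32 * f)
    e = solve-∀

  count-gcd< : ∀ a → Σ (rng n) (λ y → ⟦ γ y <? 2 ^ a ⟧) ≤ 32 * φ n * a
  count-gcd< a = begin
    Σ (rng n) (λ y → ⟦ γ y <? 2 ^ a ⟧)                     ≤⟨ Σ-mono (rng n) (λ y → ⟦⟧-≤ (γ y <? 2 ^ a) (cover (γ y) (1≤γ y) a)) ⟩
    Σ (rng n) (λ y → Σ (rng a) (λ v → dyadic v (γ y)))     ≡⟨ Σ-swap (rng n) (rng a) _ ⟩
    Σ (rng a) s                                            ≤⟨ Σ-rng-≤ a (32 * F 1) (λ v _ → s≤32F1 v) ⟩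
    a * (32 * F 1)                                         ≤⟨ *-monoʳ-≤ a (*-monoʳ-≤ 32 F1≤φ) ⟩
    a * (32 * φ n)                                         ≡⟨ *-comm a _ ⟩
    32 * φ n * a                                           ∎
    where
    open ≤-Reasoning
    cover : ∀ c → 1 ≤ c → ∀ a → c < 2 ^ a → 1 ≤ Σ (rng a) (λ v → dyadic v c)
    cover c 1≤c zero    c<1 = contradiction 1≤c (<⇒≱ c<1)
    cover c 1≤c (suc a) c<  with c <? 2 ^ a
    ... | yes r = ≤-trans (cover c 1≤c a r) (m≤n+m _ (dyadic a c))
    ... | no  r = ≤-trans (≤-reflexive (sym (dyadic-yes a c (≮⇒≥ r) c<))) (m≤m+n (dyadic a c) _)

Σ-mono-∈ : ∀ (xs : List A) {f g : A → ℕ} → (∀ x → x ∈ xs → f x ≤ g x) → Σ xs f ≤ Σ xs g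
Σ-mono-∈ []       e = z≤n
Σ-mono-∈ (x ∷ xs) e = +-mono-≤ (e x (here refl)) (Σ-mono-∈ xs (λ y y∈ → e y (there y∈)))

Σ-term : ∀ (xs : List A) (f : A → ℕ) {x} → x ∈ xs → f x ≤ Σ xs f
Σ-term (x ∷ xs) f (here refl) = m≤m+n (f x) _
Σ-term (x ∷ xs) f (there x∈)  = ≤-trans (Σ-term xs f x∈) (m≤n+m _ (f x))

-- Partial colourings by counting

-- Buckets are encoded with cost 0 for the value 0 and cost t + b for a value b > 0; over the
-- values 0, …, R the weights wt are 2 ^ (t + R - cost) and satisfy a Kraft inequality.
cost : ℕ → ℕ → ℕ
cost t zero    = 0
cost t (suc b) = t + suc b

wt : ℕ → ℕ → ℕ → ℕ
wt R t zero    = 2 ^ (t + R)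
wt R t (suc b) = 2 ^ (R ∸ suc b)

wt*2^cost : ∀ R t b → b ≤ R → wt R t b * 2 ^ cost t b ≡ 2 ^ (R + t)
wt*2^cost R t zero    b≤R = trans (*-identityʳ _) (cong (2 ^_) (+-comm t R))
wt*2^cost R t (suc b) b≤R = trans (sym (^-distribˡ-+-* 2 (R ∸ suc b) (t + suc b))) (cong (2 ^_) (begin
  (R ∸ suc b) + (t + suc b)  ≡⟨ cong ((R ∸ suc b) +_) (+-comm t (suc b)) ⟩
  (R ∸ suc b) + (suc b + t)  ≡⟨ +-assoc (R ∸ suc b) (suc b) t ⟨
  (R ∸ suc b) + suc b + t    ≡⟨ cong (_+ t) (m∸n+n≡m b≤R) ⟩
  R + t                      ∎))
  where open ≡-Reasoning

2*2^ : ∀ k → 2 ^ k + 2 ^ k ≡ 2 ^ suc k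
2*2^ k = cong (2 ^ k +_) (sym (+-identityʳ (2 ^ k)))

Σ-2^∸ : ∀ R k → k ≤ R → Σ (rng k) (λ b → 2 ^ (R ∸ suc b)) + 2 ^ (R ∸ k) ≡ 2 ^ R
Σ-2^∸ R zero    k≤R = refl
Σ-2^∸ R (suc k) k<R = begin
  2 ^ (R ∸ suc k) + S + 2 ^ (R ∸ suc k)     ≡⟨ cong (_+ 2 ^ (R ∸ suc k)) (+-comm (2 ^ (R ∸ suc k)) S) ⟩
  S + 2 ^ (R ∸ suc k) + 2 ^ (R ∸ suc k)     ≡⟨ +-assoc S _ _ ⟩
  S + (2 ^ (R ∸ suc k) + 2 ^ (R ∸ suc k))   ≡⟨ cong (S +_) (2*2^ (R ∸ suc k)) ⟩
  S + 2 ^ suc (R ∸ suc k)                   ≡⟨ cong (λ e → S + 2 ^ e) (+-∸-assoc 1 k<R) ⟨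
  S + 2 ^ (R ∸ k)                           ≡⟨ Σ-2^∸ R k (<⇒≤ k<R) ⟩
  2 ^ R                                     ∎
  where
  open ≡-Reasoning
  S = Σ (rng k) (λ b → 2 ^ (R ∸ suc b))

-- Divided by 2 ^ (t + R) this is a Kraft sum of at most 1 + 2 ^ (-t): a larger `t` brings it closer
-- to 1 and makes non-zero values dearer.
Σ-wt : ∀ R t → Σ (rng (suc R)) (wt R t) ≤ 2 ^ R * (2 ^ t + 1)
Σ-wt R t = begin
  wt R t R + Σ (rng R) (wt R t)                       ≡⟨ Σ-rng-shift R (wt R t) ⟩
  Σ (rng R) (λ b → 2 ^ (R ∸ suc b)) + 2 ^ (t + R)     ≤⟨ +-monoˡ-≤ (2 ^ (t + R)) (≤-trans (m≤m+n _ (2 ^ (R ∸ R))) (≤-reflexive (Σ-2^∸ R R ≤-refl))) ⟩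
  2 ^ R + 2 ^ (t + R)                                 ≡⟨ cong (2 ^ R +_) (^-distribˡ-+-* 2 t R) ⟩
  2 ^ R + 2 ^ t * 2 ^ R                               ≡⟨ e (2 ^ R) (2 ^ t) ⟩
  2 ^ R * (2 ^ t + 1)                                 ∎
  where
  open ≤-Reasoning
  e : ∀ a b → a + b * a ≡ a * (b + 1)
  e = solve-∀

1+n≤2^n : ∀ k → 1 + k ≤ 2 ^ k
1+n≤2^n zero    = ≤-refl
1+n≤2^n (suc k) = ≤-trans (+-mono-≤ (m^n>0 2 k) (1+n≤2^n k)) (≤-reflexive (2*2^ k))

2^-cancel-≤ : ∀ {a b} → 2 ^ a ≤ 2 ^ b → a ≤ b
2^-cancel-≤ {a} {b} h with a ≤? b
... | yes p = p
... | no  p = contradiction h (<⇒≱ (^-monoʳ-< 2 (s≤s (s≤s z≤n)) (≰⇒> p)))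

-- A quantity of a colouring together with the parameter `t` of the code for its values.
Feature : Set → Set
Feature C = (C → ℕ) × ℕ

Agree : {C : Set} → List (Feature C) → C → C → Set
Agree fs χ χ′ = All (λ ft → proj₁ ft χ ≡ proj₁ ft χ′) fs

costs : {C : Set} → List (Feature C) → C → ℕ
costs fs χ = Σ fs (λ ft → cost (proj₂ ft) (proj₁ ft χ))

kraftProd : {C : Set} → List (Feature C) → ℕ
kraftProd []             = 1
kraftProd ((f , t) ∷ fs) = (2 ^ t + 1) * kraftProd fs

module Kraft {C : Set} (Cs : List C) where

  -- Only an upper bound for the values on `Cs` is wanted; the sum of all values is one that needs
  -- no maximum.
  R : (C → ℕ) → ℕ
  R f = Σ Cs f

  U : List (Feature C) → ℕ
  U fs = Σ fs (λ ft → R (proj₁ ft) + proj₂ ft)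

  -- On `Cs` this is 2 ^ (U fs - costs fs χ), an integral multiple of 2 to the minus total code
  -- length.
  wprod : List (Feature C) → C → ℕ
  wprod []             χ = 1
  wprod ((f , t) ∷ fs) χ = wt (R f) t (f χ) * wprod fs χ

  tprod : List (Feature C) → ℕ
  tprod []             = 1
  tprod ((f , t) ∷ fs) = 2 ^ R f * (2 ^ t + 1) * tprod fs

  -- every class of the common refinement of the features has p-mass at most V / E
  Small : ℕ → ℕ → List (Feature C) → (C → ℕ) → Set
  Small E V []             p = Σ Cs p * E ≤ V
  Small E V ((f , t) ∷ fs) p = ∀ b → Small E V fs (λ χ → ⟦ f χ ≟ b ⟧ * p χ)

  -- Split by the value b of the first feature. The class of b contributes its weight times the
  -- bound for the other features, and these weights add up to one Kraft sum.
  kraft : ∀ {E V} fs p → Small E V fs p → Σ Cs (λ χ → p χ * wprod fs χ) * E ≤ V * tprod fs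
  kraft {E} {V} [] p sm = begin
    Σ Cs (λ χ → p χ * 1) * E   ≡⟨ cong (_* E) (Σ-cong Cs (λ χ → *-identityʳ (p χ))) ⟩
    Σ Cs p * E                 ≤⟨ sm ⟩
    V                          ≡⟨ *-identityʳ V ⟨
    V * 1                      ∎
    where open ≤-Reasoning
  kraft {E} {V} ((f , t) ∷ fs) p sm = begin
    Σ Cs (λ χ → p χ * (wt r t (f χ) * wprod fs χ)) * E
      ≤⟨ *-monoˡ-≤ E (Σ-mono-∈ Cs pick) ⟩
    Σ Cs (λ χ → Σ (rng (suc r)) (λ b → wt r t b * (⟦ f χ ≟ b ⟧ * p χ * wprod fs χ))) * E
      ≡⟨ cong (_* E) (Σ-swap Cs (rng (suc r)) _) ⟩
    Σ (rng (suc r)) (λ b → Σ Cs (λ χ → wt r t b * (⟦ f χ ≟ b ⟧ * p χ * wprod fs χ))) * E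
      ≡⟨ cong (_* E) (Σ-cong (rng (suc r)) (λ b → Σ-*ˡ Cs (wt r t b) _)) ⟩
    Σ (rng (suc r)) (λ b → wt r t b * Σ Cs (λ χ → ⟦ f χ ≟ b ⟧ * p χ * wprod fs χ)) * E
      ≡⟨ Σ-*ʳ (rng (suc r)) E (λ b → wt r t b * Σ Cs (λ χ → ⟦ f χ ≟ b ⟧ * p χ * wprod fs χ)) ⟨
    Σ (rng (suc r)) (λ b → wt r t b * Σ Cs (λ χ → ⟦ f χ ≟ b ⟧ * p χ * wprod fs χ) * E)
      ≤⟨ Σ-mono (rng (suc r)) (λ b → ≤-trans (≤-reflexive (*-assoc (wt r t b) _ E)) (*-monoʳ-≤ (wt r t b) (kraft fs _ (sm b)))) ⟩
    Σ (rng (suc r)) (λ b → wt r t b * (V * tprod fs))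
      ≡⟨ Σ-*ʳ (rng (suc r)) (V * tprod fs) (wt r t) ⟩
    Σ (rng (suc r)) (wt r t) * (V * tprod fs)
      ≤⟨ *-monoˡ-≤ (V * tprod fs) (Σ-wt r t) ⟩
    2 ^ r * (2 ^ t + 1) * (V * tprod fs)
      ≡⟨ e (2 ^ r * (2 ^ t + 1)) V (tprod fs) ⟩
    V * (2 ^ r * (2 ^ t + 1) * tprod fs) ∎
    where
    open ≤-Reasoning
    r = R f
    e : ∀ a b c → a * (b * c) ≡ b * (a * c)
    e = solve-∀
    e′ : ∀ a b c → a * (b * c) ≡ b * (1 * a * c)
    e′ = solve-∀
    pick : ∀ χ → χ ∈ Cs → p χ * (wt r t (f χ) * wprod fs χ) ≤ Σ (rng (suc r)) (λ b → wt r t b * (⟦ f χ ≟ b ⟧ * p χ * wprod fs χ))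
    pick χ χ∈ = begin
      p χ * (wt r t (f χ) * wprod fs χ)                              ≡⟨ e′ (p χ) (wt r t (f χ)) (wprod fs χ) ⟩
      wt r t (f χ) * (1 * p χ * wprod fs χ)                          ≡⟨ cong (λ k → wt r t (f χ) * (k * p χ * wprod fs χ)) (⟦⟧-yes (f χ ≟ f χ) refl) ⟨
      wt r t (f χ) * (⟦ f χ ≟ f χ ⟧ * p χ * wprod fs χ)              ≤⟨ Σ-rng-term (suc r) (λ b → wt r t b * (⟦ f χ ≟ b ⟧ * p χ * wprod fs χ)) (f χ) (s≤s (Σ-term Cs f χ∈)) ⟩
      Σ (rng (suc r)) (λ b → wt r t b * (⟦ f χ ≟ b ⟧ * p χ * wprod fs χ)) ∎

  wprod*2^costs : ∀ fs χ → χ ∈ Cs → wprod fs χ * 2 ^ costs fs χ ≡ 2 ^ U fs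
  wprod*2^costs []             χ χ∈ = refl
  wprod*2^costs ((f , t) ∷ fs) χ χ∈ = begin
    w * wp * 2 ^ (c + costs fs χ)           ≡⟨ cong (w * wp *_) (^-distribˡ-+-* 2 c (costs fs χ)) ⟩
    w * wp * (2 ^ c * 2 ^ costs fs χ)       ≡⟨ e w wp (2 ^ c) (2 ^ costs fs χ) ⟩
    (w * 2 ^ c) * (wp * 2 ^ costs fs χ)     ≡⟨ cong₂ _*_ (wt*2^cost (R f) t (f χ) (Σ-term Cs f χ∈)) (wprod*2^costs fs χ χ∈) ⟩
    2 ^ (R f + t) * 2 ^ U fs                ≡⟨ ^-distribˡ-+-* 2 (R f + t) (U fs) ⟨
    2 ^ (R f + t + U fs)                    ∎
    where
    open ≡-Reasoning
    w = wt (R f) t (f χ)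
    wp = wprod fs χ
    c = cost t (f χ)
    e : ∀ a b c d → a * b * (c * d) ≡ (a * c) * (b * d)
    e = solve-∀

  -- Jensen's inequality in tangent-line form: 2 ^ x ≥ 1 + x at x = B - costs fs χ.
  Σ-wprod : ∀ fs B → Σ Cs (costs fs) ≤ length Cs * B → 2 ^ U fs * length Cs ≤ 2 ^ B * Σ Cs (wprod fs)
  Σ-wprod fs B h = +-cancelʳ-≤ (P * (length Cs * B)) _ _ (begin
    P * L + P * (L * B)                                   ≡⟨ e P L B ⟩
    L * (P * (1 + B))                                     ≡⟨ Σ-const Cs _ ⟨
    Σ Cs (λ _ → P * (1 + B))                              ≤⟨ Σ-mono-∈ Cs pt ⟩
    Σ Cs (λ χ → 2 ^ B * wprod fs χ + P * costs fs χ)      ≡⟨ Σ-+ Cs _ _ ⟩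
    Σ Cs (λ χ → 2 ^ B * wprod fs χ) + Σ Cs (λ χ → P * costs fs χ) ≡⟨ cong₂ _+_ (Σ-*ˡ Cs (2 ^ B) (wprod fs)) (Σ-*ˡ Cs P (costs fs)) ⟩
    2 ^ B * Σ Cs (wprod fs) + P * Σ Cs (costs fs)         ≤⟨ +-monoʳ-≤ (2 ^ B * Σ Cs (wprod fs)) (*-monoʳ-≤ P h) ⟩
    2 ^ B * Σ Cs (wprod fs) + P * (L * B)                 ∎)
    where
    open ≤-Reasoning
    P = 2 ^ U fs
    L = length Cs
    e : ∀ p l b → p * l + p * (l * b) ≡ l * (p * (1 + b))
    e = solve-∀
    pt : ∀ χ → χ ∈ Cs → P * (1 + B) ≤ 2 ^ B * wprod fs χ + P * costs fs χ
    pt χ χ∈ with costs fs χ ≤? B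
    ... | no  c≰B = ≤-trans (*-monoʳ-≤ P (≰⇒> c≰B)) (m≤n+m _ _)
    ... | yes c≤B = begin
      P * (1 + B)                                ≡⟨ cong (λ k → P * (1 + k)) (m∸n+n≡m c≤B) ⟨
      P * (1 + (B ∸ c + c))                      ≡⟨ *-distribˡ-+ P (1 + (B ∸ c)) c ⟩
      P * (1 + (B ∸ c)) + P * c                  ≤⟨ +-monoˡ-≤ (P * c) (*-monoʳ-≤ P (1+n≤2^n (B ∸ c))) ⟩
      P * 2 ^ (B ∸ c) + P * c                    ≡⟨ cong (λ k → k * 2 ^ (B ∸ c) + P * c) (wprod*2^costs fs χ χ∈) ⟨
      wprod fs χ * 2 ^ c * 2 ^ (B ∸ c) + P * c   ≡⟨ cong (_+ P * c) (trans (*-assoc (wprod fs χ) _ _) (trans (*-comm (wprod fs χ) _) (cong (_* wprod fs χ) (trans (sym (^-distribˡ-+-* 2 c (B ∸ c))) (cong (2 ^_) (m+[n∸m]≡n c≤B)))))) ⟩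
      2 ^ B * wprod fs χ + P * c                 ∎
      where c = costs fs χ

  tprod≡ : ∀ fs → tprod fs ≡ 2 ^ Σ fs (λ ft → R (proj₁ ft)) * kraftProd fs
  tprod≡ []             = refl
  tprod≡ ((f , t) ∷ fs) = begin
    2 ^ R f * (2 ^ t + 1) * tprod fs                               ≡⟨ cong (2 ^ R f * (2 ^ t + 1) *_) (tprod≡ fs) ⟩
    2 ^ R f * (2 ^ t + 1) * (2 ^ S * kraftProd fs)                 ≡⟨ e (2 ^ R f) (2 ^ t + 1) (2 ^ S) (kraftProd fs) ⟩
    2 ^ R f * 2 ^ S * ((2 ^ t + 1) * kraftProd fs)                 ≡⟨ cong (_* ((2 ^ t + 1) * kraftProd fs)) (sym (^-distribˡ-+-* 2 (R f) S)) ⟩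
    2 ^ (R f + S) * ((2 ^ t + 1) * kraftProd fs)                   ∎
    where
    open ≡-Reasoning
    S = Σ fs (λ ft → R (proj₁ ft))
    e : ∀ a b c d → a * b * (c * d) ≡ a * c * (b * d)
    e = solve-∀

  -- If all classes are small, `kraft` bounds the sum of `wprod` from above; if codes are short on
  -- average, `Σ-wprod` bounds it from below. `B₂` pays for the excess of the Kraft sums over 1.
  pigeonhole : ∀ {E V} fs B B₂ → Small E V fs (λ _ → 1) → Σ Cs (costs fs) ≤ length Cs * B →
    kraftProd fs ≤ 2 ^ (Σ fs proj₂ + B₂) → length Cs * E ≤ 2 ^ (B + B₂) * V
  pigeonhole {E} {V} fs B B₂ sm hB hB₂ = *-cancelˡ-≤ (2 ^ U fs) {{m^n≢0 2 (U fs)}} (begin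
    2 ^ U fs * (length Cs * E)                             ≡⟨ *-assoc (2 ^ U fs) _ E ⟨
    2 ^ U fs * length Cs * E                               ≤⟨ *-monoˡ-≤ E (Σ-wprod fs B hB) ⟩
    2 ^ B * Σ Cs (wprod fs) * E                            ≡⟨ *-assoc (2 ^ B) _ E ⟩
    2 ^ B * (Σ Cs (wprod fs) * E)                          ≡⟨ cong (λ k → 2 ^ B * (k * E)) (Σ-cong Cs (λ χ → sym (+-identityʳ (wprod fs χ)))) ⟩
    2 ^ B * (Σ Cs (λ χ → 1 * wprod fs χ) * E)              ≤⟨ *-monoʳ-≤ (2 ^ B) (kraft fs (λ _ → 1) sm) ⟩
    2 ^ B * (V * tprod fs)                                 ≡⟨ cong (λ k → 2 ^ B * (V * k)) (tprod≡ fs) ⟩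
    2 ^ B * (V * (2 ^ SR * kraftProd fs))                  ≤⟨ *-monoʳ-≤ (2 ^ B) (*-monoʳ-≤ V (*-monoʳ-≤ (2 ^ SR) hB₂)) ⟩
    2 ^ B * (V * (2 ^ SR * 2 ^ (St + B₂)))                 ≡⟨ cong (λ k → 2 ^ B * (V * k)) (trans (sym (^-distribˡ-+-* 2 SR (St + B₂))) (cong (2 ^_) (sym (+-assoc SR St B₂)))) ⟩
    2 ^ B * (V * 2 ^ (SR + St + B₂))                       ≡⟨ cong (λ k → 2 ^ B * (V * 2 ^ (k + B₂))) (sym (Σ-+ fs (λ ft → R (proj₁ ft)) proj₂)) ⟩
    2 ^ B * (V * 2 ^ (U fs + B₂))                          ≡⟨ cong (λ k → 2 ^ B * (V * k)) (^-distribˡ-+-* 2 (U fs) B₂) ⟩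
    2 ^ B * (V * (2 ^ U fs * 2 ^ B₂))                      ≡⟨ e (2 ^ B) V (2 ^ U fs) (2 ^ B₂) ⟩
    2 ^ U fs * (2 ^ B * 2 ^ B₂ * V)                        ≡⟨ cong (λ k → 2 ^ U fs * (k * V)) (sym (^-distribˡ-+-* 2 B B₂)) ⟩
    2 ^ U fs * (2 ^ (B + B₂) * V)                          ∎)
    where
    open ≤-Reasoning
    SR = Σ fs (λ ft → R (proj₁ ft))
    St = Σ fs proj₂
    e : ∀ a b c d → a * (b * (c * d)) ≡ c * (a * d * b)
    e = solve-∀

-- The Boolean cube and Hamming balls on a subset of the points

allVec : ∀ n → List (Vec Bool n)
allVec zero    = [] ∷ []
allVec (suc n) = map (true ∷_) (allVec n) ++ map (false ∷_) (allVec n)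

∈-allVec : ∀ {n} (χ : Vec Bool n) → χ ∈ allVec n
∈-allVec []          = here refl
∈-allVec (true ∷ χ)  = ∈-++⁺ˡ (∈-map⁺ (true ∷_) (∈-allVec χ))
∈-allVec (false ∷ χ) = ∈-++⁺ʳ (map (true ∷_) (allVec _)) (∈-map⁺ (false ∷_) (∈-allVec χ))

Σ-allVec : ∀ n (f : Vec Bool (suc n) → ℕ) →
  Σ (allVec (suc n)) f ≡ Σ (allVec n) (λ χ → f (true ∷ χ) + f (false ∷ χ))
Σ-allVec n f = trans (Σ-++ (map (true ∷_) (allVec n)) _ f) (trans
  (cong₂ _+_ (Σ-map (true ∷_) (allVec n) f) (Σ-map (false ∷_) (allVec n) f))
  (sym (Σ-+ (allVec n) _ _)))

length-allVec : ∀ n → length (allVec n) ≡ 2 ^ n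
length-allVec zero    = refl
length-allVec (suc n) = trans (length-++ (map (true ∷_) (allVec n))) (trans
  (cong₂ _+_ (trans (length-map (true ∷_) (allVec n)) (length-allVec n)) (trans (length-map (false ∷_) (allVec n)) (length-allVec n)))
  (2*2^ n))

anyVec? : ∀ {n} {P : Vec Bool n → Set} → (∀ χ → Dec (P χ)) → Dec (∃ P)
anyVec? {zero}  P? = map′ (λ p → [] , p) (λ { ([] , p) → p }) (P? [])
anyVec? {suc n} P? = map′
  (λ { (inj₁ (χ , p)) → true ∷ χ , p ; (inj₂ (χ , p)) → false ∷ χ , p })
  (λ { (true ∷ χ , p) → inj₁ (χ , p) ; (false ∷ χ , p) → inj₂ (χ , p) })
  (anyVec? (λ χ → P? (true ∷ χ)) ⊎-dec anyVec? (λ χ → P? (false ∷ χ)))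

𝟙 : Bool → ℕ
𝟙 true  = 1
𝟙 false = 0

card : ∀ {n} → (Fin n → Bool) → ℕ
card {zero}  X = 0
card {suc n} X = 𝟙 (X zero) + card (X ∘ suc)

same : Bool → Bool → Bool
same true  b     = b
same false true  = false
same false false = true

agreeOn : ∀ {n} → (Fin n → Bool) → Vec Bool n → Vec Bool n → Fin n → Bool
agreeOn X χ χ′ y = X y ∧ same (lookup χ y) (lookup χ′ y)

sim : ∀ {n} → (Fin n → Bool) → Vec Bool n → Vec Bool n → ℕ
sim X χ χ′ = card (agreeOn X χ χ′)

-- The generating function of agreement counts from any centre, evaluated at 8: a point of `X`
-- contributes 1 + 8, any other point 1 + 1. It serves in an exponential Markov bound instead of the
-- volume of a ball.
vol : ∀ {n} → (Fin n → Bool) → ℕ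
vol {zero}  X = 1
vol {suc n} X = (1 + 8 ^ 𝟙 (X zero)) * vol (X ∘ suc)

Σ-8^sim : ∀ {n} (X : Fin n → Bool) χ → Σ (allVec n) (λ χ′ → 8 ^ sim X χ χ′) ≡ vol X
Σ-8^sim {zero}  X []      = refl
Σ-8^sim {suc n} X (a ∷ χ) = begin
  Σ (allVec (suc n)) (λ χ′ → 8 ^ sim X (a ∷ χ) χ′)     ≡⟨ Σ-allVec n (λ χ′ → 8 ^ sim X (a ∷ χ) χ′) ⟩
  Σ (allVec n) (λ χ′ → 8 ^ (𝟙 (X zero ∧ same a true) + sim (X ∘ suc) χ χ′) + 8 ^ (𝟙 (X zero ∧ same a false) + sim (X ∘ suc) χ χ′))
                                                       ≡⟨ Σ-cong (allVec n) (λ χ′ → pt a (X zero) (sim (X ∘ suc) χ χ′)) ⟩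
  Σ (allVec n) (λ χ′ → (1 + 8 ^ 𝟙 (X zero)) * 8 ^ sim (X ∘ suc) χ χ′)
                                                       ≡⟨ Σ-*ˡ (allVec n) (1 + 8 ^ 𝟙 (X zero)) _ ⟩
  (1 + 8 ^ 𝟙 (X zero)) * Σ (allVec n) (λ χ′ → 8 ^ sim (X ∘ suc) χ χ′) ≡⟨ cong ((1 + 8 ^ 𝟙 (X zero)) *_) (Σ-8^sim (X ∘ suc) χ) ⟩
  (1 + 8 ^ 𝟙 (X zero)) * vol (X ∘ suc)                 ∎
  where
  open ≡-Reasoning
  e : ∀ y → 8 * y + y ≡ 9 * y
  e = solve-∀
  e′ : ∀ y → y + 8 * y ≡ 9 * y
  e′ = solve-∀
  e″ : ∀ y → y + y ≡ 2 * y
  e″ = solve-∀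
  pt : ∀ a b k → 8 ^ (𝟙 (b ∧ same a true) + k) + 8 ^ (𝟙 (b ∧ same a false) + k) ≡ (1 + 8 ^ 𝟙 b) * 8 ^ k
  pt true  true  k = e (8 ^ k)
  pt false true  k = e′ (8 ^ k)
  pt _     false k = e″ (8 ^ k)

vol*2^card : ∀ {n} (X : Fin n → Bool) → vol X * 2 ^ card X ≡ 9 ^ card X * 2 ^ n
vol*2^card {zero}  X = refl
vol*2^card {suc n} X with X zero
... | true  = trans (e (vol (X ∘ suc)) (2 ^ card (X ∘ suc))) (trans (cong (λ k → 9 * 2 * k) (vol*2^card (X ∘ suc))) (e′ (9 ^ card (X ∘ suc)) (2 ^ n)))
  where
  e : ∀ v c → 9 * v * (2 * c) ≡ 9 * 2 * (v * c)
  e = solve-∀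
  e′ : ∀ v c → 9 * 2 * (v * c) ≡ 9 * v * (2 * c)
  e′ = solve-∀
... | false = trans (*-assoc 2 (vol (X ∘ suc)) _) (trans (cong (2 *_) (vol*2^card (X ∘ suc))) (e (9 ^ card (X ∘ suc)) (2 ^ n)))
  where
  e : ∀ v c → 2 * (v * c) ≡ v * (2 * c)
  e = solve-∀

module _ {n : ℕ} (X : Fin n → Bool) where

  open Kraft (allVec n)

  -- Take any member as centre: every member then has weight at least 8 ^ e₀ in the sum `vol X`.
  ball : ∀ e₀ (p : Vec Bool n → ℕ) → (∀ χ → p χ ≤ 1) →
    (∀ χ χ′ → p χ ≢ 0 → p χ′ ≢ 0 → e₀ ≤ sim X χ χ′) → Σ (allVec n) p * 8 ^ e₀ ≤ vol X
  ball e₀ p p≤1 h with anyVec? (λ χ → 1 ≤? p χ)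
  ... | no none = ≤-trans (≤-reflexive (cong (_* 8 ^ e₀) (trans (Σ-cong (allVec n) (λ χ → n<1⇒n≡0 (≰⇒> λ q → none (χ , q)))) (trans (Σ-const (allVec n) 0) (*-zeroʳ (length (allVec n))))))) z≤n
  ... | yes (χ₀ , q) = begin
    Σ (allVec n) p * 8 ^ e₀                 ≡⟨ Σ-*ʳ (allVec n) (8 ^ e₀) p ⟨
    Σ (allVec n) (λ χ → p χ * 8 ^ e₀)       ≤⟨ Σ-mono (allVec n) pt ⟩
    Σ (allVec n) (λ χ → 8 ^ sim X χ₀ χ)     ≡⟨ Σ-8^sim X χ₀ ⟩
    vol X                                   ∎
    where
    open ≤-Reasoning
    pt : ∀ χ → p χ * 8 ^ e₀ ≤ 8 ^ sim X χ₀ χ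
    pt χ with p χ ≟ 0
    ... | yes z rewrite z = z≤n
    ... | no  z = ≤-trans (*-mono-≤ (p≤1 χ) (^-monoʳ-≤ 8 (h χ₀ χ (λ e → contradiction q (<⇒≱ (s≤s (≤-reflexive e)))) z))) (≤-reflexive (+-identityʳ _))

  -- Conditioning on one feature after another ends in a class whose members agree on all of them,
  -- where `ball` applies.
  small : ∀ e₀ fs (p : Vec Bool n → ℕ) → (∀ χ → p χ ≤ 1) →
    (∀ χ χ′ → p χ ≢ 0 → p χ′ ≢ 0 → Agree fs χ χ′ → e₀ ≤ sim X χ χ′) → Small (8 ^ e₀) (vol X) fs p
  small e₀ []             p p≤1 h = ball e₀ p p≤1 (λ χ χ′ a b → h χ χ′ a b [])
  small e₀ ((f , t) ∷ fs) p p≤1 h b = small e₀ fs _ (λ χ → *-mono-≤ (⟦⟧≤1 (f χ ≟ b)) (p≤1 χ))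
    (λ χ χ′ u u′ ag → h χ χ′ (λ e → u (trans (cong (⟦ f χ ≟ b ⟧ *_) e) (*-zeroʳ ⟦ f χ ≟ b ⟧)))
                             (λ e → u′ (trans (cong (⟦ f χ′ ≟ b ⟧ *_) e) (*-zeroʳ ⟦ f χ′ ≟ b ⟧)))
                             (trans (in-class χ u) (sym (in-class χ′ u′)) ∷ ag))
    where
    in-class : ∀ χ → ⟦ f χ ≟ b ⟧ * p χ ≢ 0 → f χ ≡ b
    in-class χ u with f χ ≟ b
    ... | yes e = e
    ... | no  _ = contradiction refl u

  -- Otherwise any two colourings with equal features agree on `card X ∸ u` points, and all classes
  -- are small. In bits per point of `X`, the agreement is worth at least 3 · 15/16 and the ball
  -- costs log₂ (9/2) < 9/4; the difference exceeds the 1/2 granted to `B + B₂`.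
  partial-colouring : ∀ fs B B₂ u → 1 ≤ card X → 16 * u ≤ card X → 2 * (B + B₂) ≤ card X →
    Σ (allVec n) (costs fs) ≤ 2 ^ n * B → kraftProd fs ≤ 2 ^ (Σ fs proj₂ + B₂) →
    ∃[ χ ] ∃[ χ′ ] Agree fs χ χ′ × sim X χ χ′ < card X ∸ u
  partial-colouring fs B B₂ u 1≤r u≤r B≤r hB hB₂
    with anyVec? (λ χ → anyVec? (λ χ′ → all? (λ ft → proj₁ ft χ ≟ proj₁ ft χ′) fs ×-dec (sim X χ χ′ <? card X ∸ u)))
  ... | yes (χ , χ′ , w) = χ , χ′ , w
  ... | no none = contradiction bad (<⇒≱ (*-monoˡ-< r {{>-nonZero 1≤r}} {63} {64} ≤-refl))
    where
    open ≤-Reasoning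
    r = card X
    e₀ = r ∸ u
    sm : Small (8 ^ e₀) (vol X) fs (λ _ → 1)
    sm = small e₀ fs (λ _ → 1) (λ _ → ≤-refl) (λ χ χ′ _ _ ag → ≮⇒≥ λ l → none (χ , χ′ , ag , l))
    main : 2 ^ n * 8 ^ e₀ ≤ 2 ^ (B + B₂) * vol X
    main = subst (λ L → L * 8 ^ e₀ ≤ 2 ^ (B + B₂) * vol X) (length-allVec n)
      (pigeonhole fs B B₂ sm (≤-trans hB (≤-reflexive (cong (_* B) (sym (length-allVec n))))) hB₂)
    main₂ : 8 ^ e₀ * 2 ^ r ≤ 2 ^ (B + B₂) * 9 ^ r
    main₂ = *-cancelˡ-≤ (2 ^ n) {{m^n≢0 2 n}} (begin
      2 ^ n * (8 ^ e₀ * 2 ^ r)              ≡⟨ *-assoc (2 ^ n) _ _ ⟨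
      2 ^ n * 8 ^ e₀ * 2 ^ r                ≤⟨ *-monoˡ-≤ (2 ^ r) main ⟩
      2 ^ (B + B₂) * vol X * 2 ^ r          ≡⟨ *-assoc (2 ^ (B + B₂)) _ _ ⟩
      2 ^ (B + B₂) * (vol X * 2 ^ r)        ≡⟨ cong (2 ^ (B + B₂) *_) (vol*2^card X) ⟩
      2 ^ (B + B₂) * (9 ^ r * 2 ^ n)        ≡⟨ e (2 ^ (B + B₂)) (9 ^ r) (2 ^ n) ⟩
      2 ^ n * (2 ^ (B + B₂) * 9 ^ r)        ∎)
      where
      e : ∀ a b c → a * (b * c) ≡ c * (a * b)
      e = solve-∀
    -- 9 ^ 4 ≤ 2 ^ 13, so we compare fourth powers
    main₃ : 2 ^ (12 * e₀ + 4 * r) ≤ 2 ^ (4 * (B + B₂) + 13 * r)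
    main₃ = begin
      2 ^ (12 * e₀ + 4 * r)                  ≡⟨ cong (2 ^_) (e e₀ r) ⟩
      2 ^ ((3 * e₀ + r) * 4)                 ≡⟨ ^-*-assoc 2 (3 * e₀ + r) 4 ⟨
      (2 ^ (3 * e₀ + r)) ^ 4                 ≡⟨ cong (_^ 4) (trans (^-distribˡ-+-* 2 (3 * e₀) r) (cong (_* 2 ^ r) (sym (^-*-assoc 2 3 e₀)))) ⟩
      (8 ^ e₀ * 2 ^ r) ^ 4                   ≤⟨ ^-monoˡ-≤ 4 main₂ ⟩
      (2 ^ (B + B₂) * 9 ^ r) ^ 4             ≡⟨ pow4 (2 ^ (B + B₂)) (9 ^ r) ⟩
      (2 ^ (B + B₂)) ^ 4 * (9 ^ r) ^ 4       ≡⟨ cong₂ _*_ (trans (^-*-assoc 2 (B + B₂) 4) (cong (2 ^_) (*-comm (B + B₂) 4))) (trans (^-*-assoc 9 r 4) (trans (cong (9 ^_) (*-comm r 4)) (sym (^-*-assoc 9 4 r)))) ⟩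
      2 ^ (4 * (B + B₂)) * (9 ^ 4) ^ r       ≤⟨ *-monoʳ-≤ (2 ^ (4 * (B + B₂))) (^-monoˡ-≤ r (m≤m+n (9 ^ 4) (2 ^ 13 ∸ 9 ^ 4))) ⟩
      2 ^ (4 * (B + B₂)) * (2 ^ 13) ^ r      ≡⟨ cong (2 ^ (4 * (B + B₂)) *_) (^-*-assoc 2 13 r) ⟩
      2 ^ (4 * (B + B₂)) * 2 ^ (13 * r)      ≡⟨ ^-distribˡ-+-* 2 (4 * (B + B₂)) (13 * r) ⟨
      2 ^ (4 * (B + B₂) + 13 * r)            ∎
      where
      pow4 : ∀ a b → (a * b) * ((a * b) * ((a * b) * ((a * b) * 1))) ≡ a * (a * (a * (a * 1))) * (b * (b * (b * (b * 1))))
      pow4 = solve-∀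
      e : ∀ a b → 12 * a + 4 * b ≡ (3 * a + b) * 4
      e = solve-∀
    bad : 64 * r ≤ 63 * r
    bad = begin
      64 * r                                            ≤⟨ *-monoʳ-≤ 64 (m≤n+m∸n r u) ⟩
      64 * (u + e₀)                                     ≡⟨ e₁ u e₀ ⟩
      48 * e₀ + (16 * e₀ + 64 * u)                      ≡⟨ cong (48 * e₀ +_) (e₂ e₀ u) ⟩
      48 * e₀ + (16 * (e₀ + u) + 48 * u)                ≡⟨ cong (λ k → 48 * e₀ + (16 * k + 48 * u)) (m∸n+n≡m u≤r′) ⟩
      48 * e₀ + (16 * r + 48 * u)                       ≡⟨ e₃ e₀ r u ⟩
      4 * (12 * e₀ + 4 * r) + 48 * u                    ≤⟨ +-monoˡ-≤ (48 * u) (*-monoʳ-≤ 4 (2^-cancel-≤ {12 * e₀ + 4 * r} {4 * (B + B₂) + 13 * r} main₃)) ⟩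
      4 * (4 * (B + B₂) + 13 * r) + 48 * u              ≡⟨ e₄ (B + B₂) r u ⟩
      8 * (2 * (B + B₂)) + 52 * r + 3 * (16 * u)        ≤⟨ +-mono-≤ (+-monoˡ-≤ (52 * r) (*-monoʳ-≤ 8 B≤r)) (*-monoʳ-≤ 3 u≤r) ⟩
      8 * r + 52 * r + 3 * r                            ≡⟨ e₅ r ⟩
      63 * r                                            ∎
      where
      u≤r′ : u ≤ r
      u≤r′ = ≤-trans (m≤m+n u _) u≤r
      e₁ : ∀ u e → 64 * (u + e) ≡ 48 * e + (16 * e + 64 * u)
      e₁ = solve-∀
      e₂ : ∀ e u → 16 * e + 64 * u ≡ 16 * (e + u) + 48 * u
      e₂ = solve-∀
      e₃ : ∀ e r u → 48 * e + (16 * r + 48 * u) ≡ 4 * (12 * e + 4 * r) + 48 * u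
      e₃ = solve-∀
      e₄ : ∀ b r u → 4 * (4 * b + 13 * r) + 48 * u ≡ 8 * (2 * b) + 52 * r + 3 * (16 * u)
      e₄ = solve-∀
      e₅ : ∀ r → 8 * r + 52 * r + 3 * r ≡ 63 * r
      e₅ = solve-∀

-- Scales

abstract
  Q : ℕ
  Q = 2 ^ 16

  -- Lets a sixteenth of `s (suc K)`, the progress of one partial colouring, be written as
  -- `Q₁₆ * s K`.
  Q₁₆ : ℕ
  Q₁₆ = 2 ^ 12

  Q≡16Q₁₆ : Q ≡ 16 * Q₁₆
  Q≡16Q₁₆ = refl

  root : ℕ → ℕ
  root i = 2 ^ (i * 8)

  s : ℕ → ℕ
  s i = 2 ^ (i * 16)

  s≡ : ∀ i → s i ≡ 2 ^ (i * 16)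
  s≡ i = refl

  1≤Q : 1 ≤ Q
  1≤Q = m^n>0 2 16

  s-zero : s 0 ≡ 1
  s-zero = refl

  s-suc : ∀ i → s (suc i) ≡ Q * s i
  s-suc i = ^-distribˡ-+-* 2 16 (i * 16)

  1≤s : ∀ i → 1 ≤ s i
  1≤s i = m^n>0 2 (i * 16)

  1≤root : ∀ i → 1 ≤ root i
  1≤root i = m^n>0 2 (i * 8)

  root² : ∀ i → root i * root i ≡ s i
  root² i = trans (sym (^-distribˡ-+-* 2 (i * 8) (i * 8))) (cong (2 ^_) (e i))
    where
    e : ∀ i → i * 8 + i * 8 ≡ i * 16
    e = solve-∀

  root-+ : ∀ i e → root (i + e) ≡ root i * (2 ^ e) ^ 8
  root-+ i e = trans (cong (2 ^_) (*-distribʳ-+ 8 i e)) (trans (^-distribˡ-+-* 2 (i * 8) (e * 8)) (cong (2 ^ (i * 8) *_) (sym (^-*-assoc 2 e 8))))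

  -- Allowed deviation of blocks of s i points: of the order of root j ≈ √ s j at the critical
  -- scale j, where the number of relevant differences is about s j, and decaying away from it.
  Δ : ℕ → ℕ → ℕ
  Δ j i = 2 ^ (j * 8 ∸ ∣ i - j ∣)

  1≤Δ : ∀ j i → 1 ≤ Δ j i
  1≤Δ j i = m^n>0 2 (j * 8 ∸ ∣ i - j ∣)

  -- Integers in one bucket of width Δ differ by at most Δ - 1. The predecessor matters where the
  -- truncated exponent makes Δ equal to 1: such block sums are controlled exactly and add nothing,
  -- so the decay never stalls at 1.
  predΔ≤ : ∀ j i → pred (Δ j i) * 2 ^ ∣ i - j ∣ ≤ root j
  predΔ≤ j i with ∣ i - j ∣ ≤? j * 8
  ... | yes d≤ = ≤-trans (*-monoˡ-≤ (2 ^ ∣ i - j ∣) (pred[n]≤n {Δ j i}))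
    (≤-reflexive (trans (sym (^-distribˡ-+-* 2 (j * 8 ∸ ∣ i - j ∣) ∣ i - j ∣)) (cong (2 ^_) (m∸n+n≡m d≤))))
  ... | no  d≰ = ≤-trans (≤-reflexive (cong (λ k → pred (2 ^ k) * 2 ^ ∣ i - j ∣) (m≤n⇒m∸n≡0 (<⇒≤ (≰⇒> d≰))))) z≤n

  -- Every scale loses a bit to rounding in its Kraft bound; a set of at least `s (suc i)` points
  -- can absorb these losses.
  s-large : ∀ i → 64 + 32 * suc i ≤ s (suc i)
  s-large i = begin
    64 + 32 * suc i          ≡⟨ e₁ i ⟩
    96 + 32 * i              ≤⟨ +-mono-≤ (m≤m+n 96 0) (*-monoˡ-≤ i (m≤m+n 32 64)) ⟩
    96 + 96 * i              ≡⟨ *-suc 96 i ⟨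
    96 * suc i               ≤⟨ *-mono-≤ {96} {2 ^ 16} (m≤m+n 96 (2 ^ 16 ∸ 96)) (1+n≤2^n i) ⟩
    2 ^ 16 * 2 ^ i           ≤⟨ *-monoʳ-≤ (2 ^ 16) (^-monoʳ-≤ 2 (m≤m*n i 16)) ⟩
    2 ^ 16 * 2 ^ (i * 16)    ≡⟨ ^-distribˡ-+-* 2 16 (i * 16) ⟨
    2 ^ (suc i * 16)         ∎
    where
    open ≤-Reasoning
    e₁ : ∀ i → 64 + 32 * (1 + i) ≡ 96 + 32 * i
    e₁ = solve-∀

  -- Of the factor b ^ 8 between `root i` and `root (i + e)`, with b = 2 ^ e, one b is given up for
  -- the decay.
  Δ-low : ∀ i e → Δ (i + e) i ≡ root i * (2 ^ e) ^ 7
  Δ-low i e = begin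
    2 ^ ((i + e) * 8 ∸ ∣ i - i + e ∣)      ≡⟨ cong (λ d → 2 ^ ((i + e) * 8 ∸ d)) (∣m-m+n∣≡n i e) ⟩
    2 ^ ((i + e) * 8 ∸ e)                  ≡⟨ cong (λ k → 2 ^ (k ∸ e)) (p i e) ⟩
    2 ^ (i * 8 + e * 7 + e ∸ e)            ≡⟨ cong (2 ^_) (m+n∸n≡m (i * 8 + e * 7) e) ⟩
    2 ^ (i * 8 + e * 7)                    ≡⟨ ^-distribˡ-+-* 2 (i * 8) (e * 7) ⟩
    2 ^ (i * 8) * 2 ^ (e * 7)              ≡⟨ cong (2 ^ (i * 8) *_) (sym (^-*-assoc 2 e 7)) ⟩
    2 ^ (i * 8) * (2 ^ e) ^ 7              ∎
    where
    open ≡-Reasoning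
    p : ∀ i e → (i + e) * 8 ≡ i * 8 + e * 7 + e
    p = solve-∀

  -- Only an inequality, because the exponent of `Δ` stops at 0.
  Δ-high : ∀ j e → root j ≤ Δ j (j + e) * 2 ^ e
  Δ-high j e = begin
    2 ^ (j * 8)                                       ≤⟨ ^-monoʳ-≤ 2 (≤-trans (m≤n+m∸n (j * 8) e) (≤-reflexive (+-comm e (j * 8 ∸ e)))) ⟩
    2 ^ (j * 8 ∸ e + e)                               ≡⟨ ^-distribˡ-+-* 2 (j * 8 ∸ e) e ⟩
    2 ^ (j * 8 ∸ e) * 2 ^ e                           ≡⟨ cong (λ d → 2 ^ (j * 8 ∸ d) * 2 ^ e) (trans (∣-∣-comm (j + e) j) (∣m-m+n∣≡n j e)) ⟨
    2 ^ (j * 8 ∸ ∣ j + e - j ∣) * 2 ^ e               ∎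
    where open ≤-Reasoning

-- The factor 1 + 16 e comes from the number of differences; the next lemma treats 1 + 32 e, which
-- comes from the code parameter t = 32 e. The exponents 5 and 6 are those of the balance 28 = 1 +
-- 16 + 5 + 6.
1+16e≤ : ∀ e → 1 + 16 * e ≤ (2 ^ e) ^ 5
1+16e≤ zero    = s≤s z≤n
1+16e≤ (suc e) = begin
  1 + 16 * suc e                    ≡⟨ p e ⟩
  1 + 16 * e + 16                   ≤⟨ +-mono-≤ (1+16e≤ e) (*-mono-≤ {16} {31} (m≤m+n 16 15) (m^n>0 (2 ^ e) {{m^n≢0 2 e}} 5)) ⟩
  x ^ 5 + 31 * x ^ 5                ≡⟨ q x ⟩
  (2 * x) ^ 5                       ∎
  where
  open ≤-Reasoning
  x = 2 ^ e
  p : ∀ e → 1 + 16 * (1 + e) ≡ 1 + 16 * e + 16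
  p = solve-∀
  q : ∀ x → x * (x * (x * (x * (x * 1)))) + 31 * (x * (x * (x * (x * (x * 1))))) ≡ (2 * x) * ((2 * x) * ((2 * x) * ((2 * x) * ((2 * x) * 1))))
  q = solve-∀

1+32e≤ : ∀ e → 1 + 32 * e ≤ (2 ^ e) ^ 6
1+32e≤ zero    = s≤s z≤n
1+32e≤ (suc e) = begin
  1 + 32 * suc e                    ≡⟨ p e ⟩
  1 + 32 * e + 32                   ≤⟨ +-mono-≤ (1+32e≤ e) (*-mono-≤ {32} {63} (m≤m+n 32 31) (m^n>0 (2 ^ e) {{m^n≢0 2 e}} 6)) ⟩
  x ^ 6 + 63 * x ^ 6                ≡⟨ q x ⟩
  (2 * x) ^ 6                       ∎
  where
  open ≤-Reasoning
  x = 2 ^ e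
  p : ∀ e → 1 + 32 * (1 + e) ≡ 1 + 32 * e + 32
  p = solve-∀
  q : ∀ x → x * (x * (x * (x * (x * (x * 1))))) + 63 * (x * (x * (x * (x * (x * (x * 1)))))) ≡ (2 * x) * ((2 * x) * ((2 * x) * ((2 * x) * ((2 * x) * ((2 * x) * 1)))))
  q = solve-∀

-- Geometric sums

-- The sum of the terms before `k` obeys the same bound as the term `a k`; adding the two only
-- doubles it, which is the step from k to k + 1.
Σ-ascending : ∀ {j A} (a : ℕ → ℕ) → (∀ i → i < j → a i * 2 ^ (j ∸ i) ≤ A) → ∀ k → k ≤ j → Σ (rng k) a * 2 ^ (j ∸ k) ≤ A
Σ-ascending a h zero    k≤j = z≤n
Σ-ascending {j} {A} a h (suc k) k<j = *-cancelˡ-≤ 2 (begin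
  2 * ((a k + S) * 2 ^ (j ∸ suc k))                  ≡⟨ e (a k) S (2 ^ (j ∸ suc k)) ⟩
  a k * (2 * 2 ^ (j ∸ suc k)) + S * (2 * 2 ^ (j ∸ suc k)) ≡⟨ cong (λ p → a k * p + S * p) (cong (2 ^_) (sym (+-∸-assoc 1 k<j))) ⟩
  a k * 2 ^ (j ∸ k) + S * 2 ^ (j ∸ k)                ≤⟨ +-mono-≤ (h k k<j) (Σ-ascending a h k (<⇒≤ k<j)) ⟩
  A + A                                              ≡⟨ cong (A +_) (sym (+-identityʳ A)) ⟩
  2 * A                                              ∎)
  where
  open ≤-Reasoning
  S = Σ (rng k) a
  e : ∀ a s p → 2 * ((a + s) * p) ≡ a * (2 * p) + s * (2 * p)
  e = solve-∀

Σ-descending : ∀ {A} (a : ℕ → ℕ) → (∀ x → a x * 2 ^ x ≤ A) → ∀ k → Σ (rng k) a ≤ 2 * A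
Σ-descending {A} a h k = *-cancelʳ-≤ _ _ (2 ^ k) {{m^n≢0 2 k}} (≤-trans (m≤m+n _ (2 * A)) (go k))
  where
  open ≤-Reasoning
  e : ∀ a s p A → (a + s) * (2 * p) + 2 * A ≡ 2 * (s * p + 2 * A) + (2 * (a * p)) ∸ 2 * A
  e a s p A = sym (trans (cong (_∸ 2 * A) (f a s p A)) (m+n∸n≡m _ (2 * A)))
    where
    f : ∀ a s p A → 2 * (s * p + 2 * A) + (2 * (a * p)) ≡ (a + s) * (2 * p) + 2 * A + 2 * A
    f = solve-∀
  -- The added `2 * A` is the remaining tail of the geometric series, scaled by 2 ^ k; it makes the
  -- induction close.
  go : ∀ k → Σ (rng k) a * 2 ^ k + 2 * A ≤ 2 * A * 2 ^ k
  go zero    = ≤-reflexive (sym (*-identityʳ (2 * A)))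
  go (suc k) = begin
    (a k + S) * (2 * 2 ^ k) + 2 * A              ≡⟨ e (a k) S (2 ^ k) A ⟩
    2 * (S * 2 ^ k + 2 * A) + 2 * (a k * 2 ^ k) ∸ 2 * A ≤⟨ ∸-monoˡ-≤ (2 * A) (+-mono-≤ (*-monoʳ-≤ 2 (go k)) (*-monoʳ-≤ 2 (h k))) ⟩
    2 * (2 * A * 2 ^ k) + 2 * A ∸ 2 * A          ≡⟨ m+n∸n≡m _ (2 * A) ⟩
    2 * (2 * A * 2 ^ k)                          ≡⟨ f A (2 ^ k) ⟩
    2 * A * (2 * 2 ^ k)                          ∎
    where
    S = Σ (rng k) a
    f : ∀ A p → 2 * (2 * A * p) ≡ 2 * A * (2 * p)
    f = solve-∀

Σ-two-sided : ∀ j {A} (a : ℕ → ℕ) → (∀ i → a i * 2 ^ ∣ i - j ∣ ≤ A) → ∀ k → Σ (rng k) a ≤ 3 * A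
Σ-two-sided j {A} a h k = begin
  Σ (rng k) a                                          ≤⟨ Σ-rng-≤-mono a (m≤m+n k j) ⟩
  Σ (rng (k + j)) a                                    ≡⟨ Σ-rng-split k j a ⟩
  Σ (rng k) (λ x → a (x + j)) + Σ (rng j) a            ≤⟨ +-mono-≤ (Σ-descending (λ x → a (x + j)) high k) low ⟩
  2 * A + A                                            ≡⟨ +-comm (2 * A) A ⟩
  3 * A                                                ∎
  where
  open ≤-Reasoning
  high : ∀ x → a (x + j) * 2 ^ x ≤ A
  high x = subst (λ d → a (x + j) * 2 ^ d ≤ A) (trans (cong (λ k → ∣ k - j ∣) (+-comm x j)) (trans (∣-∣-comm (j + x) j) (∣m-m+n∣≡n j x))) (h (x + j))
  low : Σ (rng j) a ≤ A
  low = ≤-trans (≤-reflexive (sym (*-identityʳ _))) (subst (λ d → Σ (rng j) a * 2 ^ d ≤ A) (n∸n≡0 j)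
    (Σ-ascending a (λ i i<j → subst (λ d → a i * 2 ^ d ≤ A) (m≤n⇒∣m-n∣≡n∸m (<⇒≤ i<j)) (h i)) j ≤-refl))

-- Products of Kraft sums

-- Bernoulli's inequality (1 - 1/(1 + T)) ^ k ≥ 1 - k/(1 + T) with denominators cleared.
[1+T]^k : ∀ T k → suc T ^ k * suc T ≤ T ^ k * suc T + k * suc T ^ k
[1+T]^k T zero    = ≤-reflexive (sym (+-identityʳ _))
[1+T]^k T (suc k) = begin
  P * p * P                                   ≡⟨ e₁ P p ⟩
  T * (p * P) + p * P                         ≤⟨ +-monoˡ-≤ (p * P) (*-monoʳ-≤ T ([1+T]^k T k)) ⟩
  T * (q * P + k * p) + p * P                 ≡⟨ e₂ T q P k p ⟩
  T * q * P + (k * (T * p) + P * p)           ≤⟨ +-monoʳ-≤ (T * q * P) (≤-trans (+-monoˡ-≤ (P * p) (*-monoʳ-≤ k (*-monoˡ-≤ p (n≤1+n T)))) (≤-reflexive (+-comm (k * (P * p)) (P * p)))) ⟩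
  T * q * P + (P * p + k * (P * p))           ∎
  where
  open ≤-Reasoning
  P = suc T
  p = P ^ k
  q = T ^ k
  e₁ : ∀ P p → P * p * P ≡ (P ∸ 1) * (p * P) + p * P
  e₁ zero    p = sym (*-zeroʳ p)
  e₁ (suc T) p = f T p
    where
    f : ∀ T p → (1 + T) * p * (1 + T) ≡ T * (p * (1 + T)) + p * (1 + T)
    f = solve-∀
  e₂ : ∀ T q P k p → T * (q * P + k * p) + p * P ≡ T * q * P + (k * (T * p) + P * p)
  e₂ = solve-∀

[1+T]^h≤2T^h : ∀ T h → 2 * h ≤ suc T → suc T ^ h ≤ 2 * T ^ h
[1+T]^h≤2T^h T h 2h≤ = *-cancelʳ-≤ _ _ (suc T) (+-cancelʳ-≤ (p * suc T) _ _ (begin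
  p * suc T + p * suc T                    ≡⟨ e₁ (p * suc T) ⟩
  2 * (p * suc T)                          ≤⟨ *-monoʳ-≤ 2 ([1+T]^k T h) ⟩
  2 * (q * suc T + h * p)                  ≡⟨ e₂ q (suc T) h p ⟩
  2 * q * suc T + p * (2 * h)              ≤⟨ +-monoʳ-≤ (2 * q * suc T) (*-monoʳ-≤ p 2h≤) ⟩
  2 * q * suc T + p * suc T                ∎))
  where
  open ≤-Reasoning
  p = suc T ^ h
  q = T ^ h
  e₁ : ∀ x → x + x ≡ 2 * x
  e₁ = solve-∀
  e₂ : ∀ q P h p → 2 * (q * P + h * p) ≡ 2 * q * P + p * (2 * h)
  e₂ = solve-∀

-- The powers of 1 + 1/T double at most once for every `h` factors, and once more for the remainder
-- `ρ`.
[1+T]^mh≤ : ∀ T h m → 2 * h ≤ suc T → ∀ ρ → ρ ≤ h → suc T ^ (ρ + m * h) ≤ T ^ (ρ + m * h) * 2 ^ suc m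
[1+T]^mh≤ T h zero    2h≤ ρ ρ≤h rewrite +-identityʳ ρ = ≤-trans ([1+T]^h≤2T^h T ρ (≤-trans (*-monoʳ-≤ 2 ρ≤h) 2h≤)) (≤-reflexive (*-comm 2 (T ^ ρ)))
[1+T]^mh≤ T h (suc m) 2h≤ ρ ρ≤h = begin
  suc T ^ (ρ + (h + m * h))                      ≡⟨ cong (suc T ^_) (e ρ h (m * h)) ⟩
  suc T ^ (h + (ρ + m * h))                      ≡⟨ ^-distribˡ-+-* (suc T) h (ρ + m * h) ⟩
  suc T ^ h * suc T ^ (ρ + m * h)                ≤⟨ *-mono-≤ ([1+T]^h≤2T^h T h 2h≤) ([1+T]^mh≤ T h m 2h≤ ρ ρ≤h) ⟩
  2 * T ^ h * (T ^ (ρ + m * h) * 2 ^ suc m)      ≡⟨ f (T ^ h) (T ^ (ρ + m * h)) (2 ^ suc m) ⟩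
  T ^ h * T ^ (ρ + m * h) * (2 * 2 ^ suc m)      ≡⟨ cong (_* (2 * 2 ^ suc m)) (trans (sym (^-distribˡ-+-* T h (ρ + m * h))) (cong (T ^_) (sym (e ρ h (m * h))))) ⟩
  T ^ (ρ + (h + m * h)) * 2 ^ suc (suc m)        ∎
  where
  open ≤-Reasoning
  e : ∀ a b c → a + (b + c) ≡ b + (a + c)
  e = solve-∀
  f : ∀ a b c → 2 * a * (b * c) ≡ a * b * (2 * c)
  f = solve-∀

open import Data.Integer as ℤ using (ℤ; +_; -[1+_]; ∣_∣)
import Data.Integer.Properties as ℤ
import Data.Integer.Tactic.RingSolver as ℤR

-- Moments of random signed sums

sgn : Bool → ℕ → ℤ
sgn true  k = + k
sgn false k = ℤ.- + k

dot : ∀ {n} → (Fin n → ℕ) → Vec Bool n → ℤ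
dot w []      = + 0
dot w (b ∷ χ) = sgn b (w zero) ℤ.+ dot (w ∘ suc) χ

-- The variance of `dot w` under uniform random signs.
energy : ∀ {n} → (Fin n → ℕ) → ℕ
energy {zero}  w = 0
energy {suc n} w = w zero * w zero + energy (w ∘ suc)

+∣∣² : ∀ z → + (∣ z ∣ * ∣ z ∣) ≡ z ℤ.* z
+∣∣² (+ k)    = ℤ.pos-* k k
+∣∣² -[1+ k ] = refl

+∣∣⁴ : ∀ z → + (∣ z ∣ * ∣ z ∣ * (∣ z ∣ * ∣ z ∣)) ≡ z ℤ.* z ℤ.* (z ℤ.* z)
+∣∣⁴ z = trans (ℤ.pos-* (∣ z ∣ * ∣ z ∣) _) (cong₂ ℤ._*_ (+∣∣² z) (+∣∣² z))

sq-± : ∀ k x → ∣ + k ℤ.+ x ∣ * ∣ + k ℤ.+ x ∣ + ∣ ℤ.- + k ℤ.+ x ∣ * ∣ ℤ.- + k ℤ.+ x ∣ ≡ 2 * (k * k + ∣ x ∣ * ∣ x ∣)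
sq-± k x = ℤ.+-injective (begin
  + (∣ u ∣ * ∣ u ∣ + ∣ v ∣ * ∣ v ∣)            ≡⟨ cong₂ ℤ._+_ (+∣∣² u) (+∣∣² v) ⟩
  u ℤ.* u ℤ.+ v ℤ.* v                         ≡⟨ ident (+ k) x ⟩
  + 2 ℤ.* (+ k ℤ.* + k ℤ.+ x ℤ.* x)           ≡⟨ cong (+ 2 ℤ.*_) (cong₂ ℤ._+_ (sym (ℤ.pos-* k k)) (sym (+∣∣² x))) ⟩
  + 2 ℤ.* + (k * k + ∣ x ∣ * ∣ x ∣)           ≡⟨ ℤ.pos-* 2 (k * k + ∣ x ∣ * ∣ x ∣) ⟨
  + (2 * (k * k + ∣ x ∣ * ∣ x ∣))             ∎)
  where
  open ≡-Reasoning
  u = + k ℤ.+ x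
  v = ℤ.- + k ℤ.+ x
  ident : ∀ K x → (K ℤ.+ x) ℤ.* (K ℤ.+ x) ℤ.+ (ℤ.- K ℤ.+ x) ℤ.* (ℤ.- K ℤ.+ x) ≡ + 2 ℤ.* (K ℤ.* K ℤ.+ x ℤ.* x)
  ident = ℤR.solve-∀

fourth : ℕ → ℕ
fourth a = a * a * (a * a)

fourth-± : ∀ k x → fourth (∣ + k ℤ.+ x ∣) + fourth (∣ ℤ.- + k ℤ.+ x ∣) ≡ 2 * (fourth k + 6 * (k * k * (∣ x ∣ * ∣ x ∣)) + fourth (∣ x ∣))
fourth-± k x = ℤ.+-injective (begin
  + (fourth (∣ u ∣) + fourth (∣ v ∣))                                        ≡⟨ cong₂ ℤ._+_ (+∣∣⁴ u) (+∣∣⁴ v) ⟩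
  u ℤ.* u ℤ.* (u ℤ.* u) ℤ.+ v ℤ.* v ℤ.* (v ℤ.* v)                        ≡⟨ ident (+ k) x ⟩
  + 2 ℤ.* (+ k ℤ.* + k ℤ.* (+ k ℤ.* + k) ℤ.+ + 6 ℤ.* (+ k ℤ.* + k ℤ.* (x ℤ.* x)) ℤ.+ x ℤ.* x ℤ.* (x ℤ.* x))
    ≡⟨ cong (+ 2 ℤ.*_) (cong₂ ℤ._+_ (cong₂ ℤ._+_ (sym (+∣∣⁴ (+ k))) mid) (sym (+∣∣⁴ x))) ⟩
  + 2 ℤ.* + (fourth k + 6 * (k * k * (∣ x ∣ * ∣ x ∣)) + fourth (∣ x ∣))    ≡⟨ ℤ.pos-* 2 (fourth k + 6 * (k * k * (∣ x ∣ * ∣ x ∣)) + fourth (∣ x ∣)) ⟨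
  + (2 * (fourth k + 6 * (k * k * (∣ x ∣ * ∣ x ∣)) + fourth (∣ x ∣)))      ∎)
  where
  open ≡-Reasoning
  u = + k ℤ.+ x
  v = ℤ.- + k ℤ.+ x
  ident : ∀ K x → (K ℤ.+ x) ℤ.* (K ℤ.+ x) ℤ.* ((K ℤ.+ x) ℤ.* (K ℤ.+ x)) ℤ.+ (ℤ.- K ℤ.+ x) ℤ.* (ℤ.- K ℤ.+ x) ℤ.* ((ℤ.- K ℤ.+ x) ℤ.* (ℤ.- K ℤ.+ x))
    ≡ + 2 ℤ.* (K ℤ.* K ℤ.* (K ℤ.* K) ℤ.+ + 6 ℤ.* (K ℤ.* K ℤ.* (x ℤ.* x)) ℤ.+ x ℤ.* x ℤ.* (x ℤ.* x))
  ident = ℤR.solve-∀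
  mid : + 6 ℤ.* (+ k ℤ.* + k ℤ.* (x ℤ.* x)) ≡ + (6 * (k * k * (∣ x ∣ * ∣ x ∣)))
  mid = sym (trans (ℤ.pos-* 6 (k * k * (∣ x ∣ * ∣ x ∣))) (cong (+ 6 ℤ.*_) (trans (ℤ.pos-* (k * k) _) (cong₂ ℤ._*_ (ℤ.pos-* k k) (+∣∣² x)))))

second-moment : ∀ {n} (w : Fin n → ℕ) → Σ (allVec n) (λ χ → ∣ dot w χ ∣ * ∣ dot w χ ∣) ≡ 2 ^ n * energy w
second-moment {zero}  w = refl
second-moment {suc n} w = begin
  Σ (allVec (suc n)) (λ χ → ∣ dot w χ ∣ * ∣ dot w χ ∣)                    ≡⟨ Σ-allVec n (λ χ → ∣ dot w χ ∣ * ∣ dot w χ ∣) ⟩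
  Σ (allVec n) _                                                         ≡⟨ Σ-cong (allVec n) (λ χ → sq-± k (x χ)) ⟩
  Σ (allVec n) (λ χ → 2 * (k * k + ∣ x χ ∣ * ∣ x χ ∣))                    ≡⟨ Σ-*ˡ (allVec n) 2 _ ⟩
  2 * Σ (allVec n) (λ χ → k * k + ∣ x χ ∣ * ∣ x χ ∣)                      ≡⟨ cong (2 *_) (Σ-+ (allVec n) (λ _ → k * k) _) ⟩
  2 * (Σ (allVec n) (λ _ → k * k) + Σ (allVec n) (λ χ → ∣ x χ ∣ * ∣ x χ ∣)) ≡⟨ cong (2 *_) (cong₂ _+_ (trans (Σ-const (allVec n) (k * k)) (cong (_* (k * k)) (length-allVec n))) (second-moment (w ∘ suc))) ⟩
  2 * (2 ^ n * (k * k) + 2 ^ n * energy (w ∘ suc))                       ≡⟨ e (2 ^ n) (k * k) (energy (w ∘ suc)) ⟩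
  2 * 2 ^ n * (k * k + energy (w ∘ suc))                                 ∎
  where
  open ≡-Reasoning
  k = w zero
  x = λ χ → dot (w ∘ suc) χ
  e : ∀ p a b → 2 * (p * a + p * b) ≡ 2 * p * (a + b)
  e = solve-∀

-- Averaging over the sign of a coordinate k kills the odd powers, and k ^ 4 + 6 k ^ 2 E + 3 E ^ 2
-- is 3 (k ^ 2 + E) ^ 2 less 2 k ^ 4.
fourth-moment : ∀ {n} (w : Fin n → ℕ) → Σ (allVec n) (λ χ → fourth (∣ dot w χ ∣)) ≤ 2 ^ n * (3 * (energy w * energy w))
fourth-moment {zero}  w = z≤n
fourth-moment {suc n} w = begin
  Σ (allVec (suc n)) (λ χ → fourth (∣ dot w χ ∣))                           ≡⟨ Σ-allVec n (λ χ → fourth (∣ dot w χ ∣)) ⟩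
  Σ (allVec n) _                                                         ≡⟨ Σ-cong (allVec n) (λ χ → fourth-± k (x χ)) ⟩
  Σ (allVec n) (λ χ → 2 * (fourth k + 6 * (k * k * (∣ x χ ∣ * ∣ x χ ∣)) + fourth (∣ x χ ∣))) ≡⟨ Σ-*ˡ (allVec n) 2 _ ⟩
  2 * Σ (allVec n) (λ χ → fourth k + 6 * (k * k * (∣ x χ ∣ * ∣ x χ ∣)) + fourth (∣ x χ ∣)) ≡⟨ cong (2 *_) split ⟩
  2 * (2 ^ n * fourth k + 6 * (k * k * (2 ^ n * E)) + Σ (allVec n) (λ χ → fourth (∣ x χ ∣))) ≤⟨ *-monoʳ-≤ 2 (+-monoʳ-≤ (2 ^ n * fourth k + 6 * (k * k * (2 ^ n * E))) (fourth-moment (w ∘ suc))) ⟩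
  2 * (2 ^ n * fourth k + 6 * (k * k * (2 ^ n * E)) + 2 ^ n * (3 * (E * E))) ≤⟨ m≤m+n _ (2 ^ n * (4 * fourth k)) ⟩
  2 * (2 ^ n * fourth k + 6 * (k * k * (2 ^ n * E)) + 2 ^ n * (3 * (E * E))) + 2 ^ n * (4 * fourth k) ≡⟨ e (2 ^ n) k E ⟩
  2 * 2 ^ n * (3 * ((k * k + E) * (k * k + E)))                          ∎
  where
  open ≤-Reasoning
  k = w zero
  E = energy (w ∘ suc)
  x = λ χ → dot (w ∘ suc) χ
  split : Σ (allVec n) (λ χ → fourth k + 6 * (k * k * (∣ x χ ∣ * ∣ x χ ∣)) + fourth (∣ x χ ∣))
    ≡ 2 ^ n * fourth k + 6 * (k * k * (2 ^ n * E)) + Σ (allVec n) (λ χ → fourth (∣ x χ ∣))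
  split = trans (Σ-+ (allVec n) (λ χ → fourth k + 6 * (k * k * (∣ x χ ∣ * ∣ x χ ∣))) (λ χ → fourth (∣ x χ ∣)))
    (cong (_+ Σ (allVec n) (λ χ → fourth (∣ x χ ∣)))
      (trans (Σ-+ (allVec n) (λ _ → fourth k) (λ χ → 6 * (k * k * (∣ x χ ∣ * ∣ x χ ∣))))
        (cong₂ _+_ (trans (Σ-const (allVec n) (fourth k)) (cong (_* fourth k) (length-allVec n)))
          (trans (Σ-*ˡ (allVec n) 6 (λ χ → k * k * (∣ x χ ∣ * ∣ x χ ∣))) (cong (6 *_)
            (trans (Σ-*ˡ (allVec n) (k * k) (λ χ → ∣ x χ ∣ * ∣ x χ ∣)) (cong (k * k *_) (second-moment (w ∘ suc)))))))))
  e : ∀ p k E → 2 * (p * (k * k * (k * k)) + 6 * (k * k * (p * E)) + p * (3 * (E * E))) + p * (4 * (k * k * (k * k)))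
    ≡ 2 * p * (3 * ((k * k + E) * (k * k + E)))
  e = solve-∀

-- Lists of points and their signed sums

fsum : ∀ {n} → (Fin n → ℕ) → ℕ
fsum {zero}  f = 0
fsum {suc n} f = f zero + fsum (f ∘ suc)

fsum-mono : ∀ {n} {f g : Fin n → ℕ} → (∀ y → f y ≤ g y) → fsum f ≤ fsum g
fsum-mono {zero}  h = z≤n
fsum-mono {suc n} h = +-mono-≤ (h zero) (fsum-mono (h ∘ suc))

fsum-+ : ∀ {n} (f g : Fin n → ℕ) → fsum (λ y → f y + g y) ≡ fsum f + fsum g
fsum-+ {zero}  f g = refl
fsum-+ {suc n} f g = trans (cong₂ _+_ (refl {x = f zero + g zero}) (fsum-+ (f ∘ suc) (g ∘ suc))) (interchange (f zero) (g zero) _ _)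

fsum-cong : ∀ {n} {f g : Fin n → ℕ} → (∀ y → f y ≡ g y) → fsum f ≡ fsum g
fsum-cong {zero}  h = refl
fsum-cong {suc n} h = cong₂ _+_ (h zero) (fsum-cong (h ∘ suc))

fsum-0 : ∀ n → fsum {n} (λ _ → 0) ≡ 0
fsum-0 zero    = refl
fsum-0 (suc n) = fsum-0 n

card≡fsum : ∀ {n} (X : Fin n → Bool) → card X ≡ fsum (𝟙 ∘ X)
card≡fsum {zero}  X = refl
card≡fsum {suc n} X = cong (λ k → 𝟙 (X zero) + k) (card≡fsum (X ∘ suc))

eqF : ∀ {n} → Fin n → Fin n → ℕ
eqF zero    zero    = 1
eqF zero    (suc y) = 0
eqF (suc z) zero    = 0
eqF (suc z) (suc y) = eqF z y

fsum-eqF : ∀ {n} (z : Fin n) (h : Fin n → ℕ) → fsum (λ y → eqF z y * h y) ≡ h z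
fsum-eqF {suc n} zero    h = trans (cong₂ _+_ (+-identityʳ (h zero)) (fsum-0 n)) (+-identityʳ (h zero))
fsum-eqF {suc n} (suc z) h = fsum-eqF z (h ∘ suc)

occ : ∀ {n} → List (Fin n) → Fin n → ℕ
occ S y = Σ S (λ z → eqF z y)

fsum-occ : ∀ {n} (S : List (Fin n)) (h : Fin n → ℕ) → fsum (λ y → occ S y * h y) ≡ Σ S h
fsum-occ {n} []      h = fsum-0 n
fsum-occ {n} (z ∷ S) h = trans (fsum-cong (λ y → *-distribʳ-+ (h y) (eqF z y) (occ S y)))
  (trans (fsum-+ (λ y → eqF z y * h y) _) (cong₂ _+_ (fsum-eqF z h) (fsum-occ S h)))

occ-drop : ∀ {n} (k : ℕ) (S : List (Fin n)) y → occ (drop k S) y ≤ occ S y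
occ-drop zero    S       y = ≤-refl
occ-drop (suc k) []      y = ≤-refl
occ-drop (suc k) (z ∷ S) y = ≤-trans (occ-drop k S y) (m≤n+m _ (eqF z y))

occ-take : ∀ {n} (k : ℕ) (S : List (Fin n)) y → occ (take k S) y ≤ occ S y
occ-take zero    S       y = z≤n
occ-take (suc k) []      y = ≤-refl
occ-take (suc k) (z ∷ S) y = +-monoʳ-≤ (eqF z y) (occ-take k S y)

occ-filter : ∀ {n} X (S : List (Fin n)) y → occ (filterᵇ X S) y ≤ occ S y
occ-filter X []      y = ≤-refl
occ-filter X (z ∷ S) y with X z
... | true  = +-monoʳ-≤ (eqF z y) (occ-filter X S y)
... | false = ≤-trans (occ-filter X S y) (m≤n+m _ (eqF z y))

length-filter : ∀ {n} X (S : List (Fin n)) → length (filterᵇ X S) ≡ Σ S (𝟙 ∘ X)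
length-filter X []      = refl
length-filter X (z ∷ S) with X z
... | true  = cong suc (length-filter X S)
... | false = length-filter X S

Simple : ∀ {n} → List (Fin n) → Set
Simple S = ∀ y → occ S y ≤ 1

length-filter≤card : ∀ {n} X (S : List (Fin n)) → Simple S → length (filterᵇ X S) ≤ card X
length-filter≤card X S simple = begin
  length (filterᵇ X S)               ≡⟨ length-filter X S ⟩
  Σ S (𝟙 ∘ X)                        ≡⟨ fsum-occ S (𝟙 ∘ X) ⟨
  fsum (λ y → occ S y * 𝟙 (X y))     ≤⟨ fsum-mono (λ y → ≤-trans (*-monoˡ-≤ (𝟙 (X y)) (simple y)) (≤-reflexive (+-identityʳ _))) ⟩
  fsum (𝟙 ∘ X)                       ≡⟨ card≡fsum X ⟨
  card X                             ∎
  where open ≤-Reasoning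

sumℤ : ∀ {A : Set} → List A → (A → ℤ) → ℤ
sumℤ []      f = + 0
sumℤ (z ∷ S) f = f z ℤ.+ sumℤ S f

val : ∀ {n} → (Fin n → Bool) → (Fin n → Bool) → Fin n → ℤ
val X χ y = if X y then sign (χ y) else + 0

weight : ∀ {n} → (Fin n → Bool) → List (Fin n) → Fin n → ℕ
weight X S y = occ S y * 𝟙 (X y)

sgn-+ : ∀ b k l → sgn b (k + l) ≡ sgn b k ℤ.+ sgn b l
sgn-+ true  k l = refl
sgn-+ false k l = ℤ.neg-distrib-+ (+ k) (+ l)

dot-+ : ∀ {n} (w w′ : Fin n → ℕ) χ → dot (λ y → w y + w′ y) χ ≡ dot w χ ℤ.+ dot w′ χ
dot-+ w w′ []      = refl
dot-+ w w′ (b ∷ χ) = trans (cong₂ ℤ._+_ (sgn-+ b (w zero) (w′ zero)) (dot-+ (w ∘ suc) (w′ ∘ suc) χ)) (e (sgn b (w zero)) (sgn b (w′ zero)) _ _)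
  where
  e : ∀ a b c d → (a ℤ.+ b) ℤ.+ (c ℤ.+ d) ≡ (a ℤ.+ c) ℤ.+ (b ℤ.+ d)
  e = ℤR.solve-∀

dot-cong : ∀ {n} {w w′ : Fin n → ℕ} → (∀ y → w y ≡ w′ y) → ∀ χ → dot w χ ≡ dot w′ χ
dot-cong h []      = refl
dot-cong h (b ∷ χ) = cong₂ ℤ._+_ (cong (sgn b) (h zero)) (dot-cong (h ∘ suc) χ)

dot-0 : ∀ {n} (χ : Vec Bool n) → dot (λ _ → 0) χ ≡ + 0
dot-0 []          = refl
dot-0 (true ∷ χ)  = trans (ℤ.+-identityˡ _) (dot-0 χ)
dot-0 (false ∷ χ) = trans (ℤ.+-identityˡ _) (dot-0 χ)

dot-eqF : ∀ {n} X (z : Fin n) χ → dot (λ y → eqF z y * 𝟙 (X y)) χ ≡ val X (lookup χ) z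
dot-eqF X zero    (b ∷ χ) = trans (cong₂ ℤ._+_ (pt b (X zero)) (dot-0 χ)) (ℤ.+-identityʳ _)
  where
  pt : ∀ b x → sgn b (𝟙 x + 0) ≡ (if x then sign b else + 0)
  pt true  true  = refl
  pt false true  = refl
  pt true  false = refl
  pt false false = refl
dot-eqF X (suc z) (true ∷ χ)  = trans (ℤ.+-identityˡ _) (dot-eqF (X ∘ suc) z χ)
dot-eqF X (suc z) (false ∷ χ) = trans (ℤ.+-identityˡ _) (dot-eqF (X ∘ suc) z χ)

-- Turns a sum along a list into a signed sum over independent coordinates, the form in which
-- moments are known.
sumℤ-dot : ∀ {n} X (S : List (Fin n)) χ → sumℤ S (val X (lookup χ)) ≡ dot (weight X S) χ
sumℤ-dot X []      χ = sym (dot-0 χ)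
sumℤ-dot X (z ∷ S) χ = sym (trans (dot-cong (λ y → *-distribʳ-+ (𝟙 (X y)) (eqF z y) (occ S y)) χ)
  (trans (dot-+ (λ y → eqF z y * 𝟙 (X y)) (weight X S) χ) (cong₂ ℤ._+_ (dot-eqF X z χ) (sym (sumℤ-dot X S χ)))))

energy-weight : ∀ {n} X (S : List (Fin n)) → Simple S → energy (weight X S) ≤ length S
energy-weight X S simple = begin
  energy (weight X S)      ≤⟨ energy≤ (weight X S) (occ S) (λ y → sq≤ (occ S y) (𝟙 (X y)) (simple y) (𝟙≤1 (X y))) ⟩
  fsum (occ S)             ≡⟨ fsum-cong (λ y → *-identityʳ (occ S y)) ⟨
  fsum (λ y → occ S y * 1) ≡⟨ fsum-occ S (λ _ → 1) ⟩
  Σ S (λ _ → 1)            ≡⟨ Σ-const S 1 ⟩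
  length S * 1             ≡⟨ *-identityʳ _ ⟩
  length S                 ∎
  where
  open ≤-Reasoning
  𝟙≤1 : ∀ b → 𝟙 b ≤ 1
  𝟙≤1 true  = ≤-refl
  𝟙≤1 false = z≤n
  sq≤ : ∀ a b → a ≤ 1 → b ≤ 1 → (a * b) * (a * b) ≤ a
  sq≤ zero    b _ _ = z≤n
  sq≤ (suc zero) b _ b≤1 = *-mono-≤ b′ b′
    where b′ = ≤-trans (≤-reflexive (+-identityʳ b)) b≤1
  sq≤ (suc (suc a)) b (s≤s ()) _
  energy≤ : ∀ {n} (w v : Fin n → ℕ) → (∀ y → w y * w y ≤ v y) → energy w ≤ fsum v
  energy≤ {zero}  w v h = z≤n
  energy≤ {suc n} w v h = +-mono-≤ (h zero) (energy≤ (w ∘ suc) (v ∘ suc) (h ∘ suc))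

-- Buckets

pos : ℤ → ℕ
pos (+ k)    = k
pos -[1+ k ] = 0

blockSum : ∀ {n} → (Fin n → Bool) → List (Fin n) → Vec Bool n → ℤ
blockSum X S χ = sumℤ S (val X (lookup χ))

-- Features have values in ℕ, so an integer is recorded by its positive and its negative part. One
-- of them is 0 and free of cost, but both enter the Kraft product.
bucketFeatures : ∀ {n} → (Fin n → Bool) → (δ t : ℕ) → List (Fin n) → List (Feature (Vec Bool n))
bucketFeatures X δ t S = ((λ χ → pos (blockSum X S χ) / suc δ) , t) ∷ ((λ χ → pos (ℤ.- blockSum X S χ) / suc δ) , t) ∷ []

cost-± : ∀ δ t x → cost t (pos x / suc δ) + (cost t (pos (ℤ.- x) / suc δ) + 0) ≡ cost t (∣ x ∣ / suc δ)
cost-± δ t (+ zero)  = trans (cong (λ k → cost t k + (cost t k + 0)) (0/n≡0 (suc δ))) (cong (cost t) (sym (0/n≡0 (suc δ))))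
cost-± δ t (+ suc k) = trans (cong (λ q → cost t (suc k / suc δ) + (cost t q + 0)) (0/n≡0 (suc δ))) (+-identityʳ _)
cost-± δ t -[1+ k ]  = trans (cong (λ q → cost t q + (cost t (suc k / suc δ) + 0)) (0/n≡0 (suc δ))) (+-identityʳ _)

cost≤ : ∀ t b → cost t b ≤ (1 + t) * b
cost≤ t zero    = z≤n
cost≤ t (suc b) = ≤-trans (m≤m+n (t + suc b) (t * b)) (≤-reflexive (e t b))
  where
  e : ∀ t b → t + suc b + t * b ≡ (1 + t) * suc b
  e = solve-∀

cost0 : ∀ b → cost 0 b ≡ b
cost0 zero    = refl
cost0 (suc b) = refl

b≤fourth : ∀ b → b ≤ fourth b
b≤fourth zero      = z≤n
b≤fourth (suc b-1) = ≤-trans (m≤m*n b b) (m≤m*n (b * b) (b * b))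
  where b = suc b-1

fourth-mono : ∀ {a b} → a ≤ b → fourth a ≤ fourth b
fourth-mono h = *-mono-≤ (*-mono-≤ h h) (*-mono-≤ h h)

fourth-* : ∀ a b → fourth a * fourth b ≡ fourth (a * b)
fourth-* = e
  where
  e : ∀ a b → a * a * (a * a) * (b * b * (b * b)) ≡ a * b * (a * b) * (a * b * (a * b))
  e = solve-∀

blockCost : ∀ {n} → (Fin n → Bool) → (δ t : ℕ) → List (Fin n) → ℕ
blockCost {n} X δ t S = Σ (allVec n) (λ χ → cost t (∣ blockSum X S χ ∣ / suc δ))

module _ {n} (X : Fin n → Bool) (S : List (Fin n)) (simple : Simple S) where

  private
    x : Vec Bool n → ℤ
    x = blockSum X S

  -- A bucket b costs at most (1 + t) b ≤ (1 + t) b ^ 4, a crude estimate that brings in the fourth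
  -- moment; the variance is at most `length S`.
  blockCost-fourth : ∀ δ t → blockCost X δ t S * fourth (suc δ) ≤ 2 ^ n * ((1 + t) * (3 * (length S * length S)))
  blockCost-fourth δ t = begin
    blockCost X δ t S * fourth (suc δ)                                            ≡⟨ Σ-*ʳ (allVec n) (fourth (suc δ)) (λ χ → cost t (∣ x χ ∣ / suc δ)) ⟨
    Σ (allVec n) (λ χ → cost t (∣ x χ ∣ / suc δ) * fourth (suc δ))            ≤⟨ Σ-mono (allVec n) (λ χ → pt ∣ x χ ∣) ⟩
    Σ (allVec n) (λ χ → (1 + t) * fourth (∣ x χ ∣))                             ≡⟨ Σ-*ˡ (allVec n) (1 + t) (λ χ → fourth (∣ x χ ∣)) ⟩
    (1 + t) * Σ (allVec n) (λ χ → fourth (∣ x χ ∣))                             ≡⟨ cong ((1 + t) *_) (Σ-cong (allVec n) (λ χ → cong (λ z → fourth (∣ z ∣)) (sumℤ-dot X S χ))) ⟩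
    (1 + t) * Σ (allVec n) (λ χ → fourth (∣ dot (weight X S) χ ∣))              ≤⟨ *-monoʳ-≤ (1 + t) (fourth-moment (weight X S)) ⟩
    (1 + t) * (2 ^ n * (3 * (energy (weight X S) * energy (weight X S))))     ≤⟨ *-monoʳ-≤ (1 + t) (*-monoʳ-≤ (2 ^ n) (*-monoʳ-≤ 3 (*-mono-≤ (energy-weight X S simple) (energy-weight X S simple)))) ⟩
    (1 + t) * (2 ^ n * (3 * (length S * length S)))                           ≡⟨ e (1 + t) (2 ^ n) (3 * (length S * length S)) ⟩
    2 ^ n * ((1 + t) * (3 * (length S * length S)))                           ∎
    where
    open ≤-Reasoning
    e : ∀ a b c → a * (b * c) ≡ b * (a * c)
    e = solve-∀
    pt : ∀ a → cost t (a / suc δ) * fourth (suc δ) ≤ (1 + t) * fourth a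
    pt a = begin
      cost t (a / suc δ) * fourth (suc δ)              ≤⟨ *-monoˡ-≤ (fourth (suc δ)) (≤-trans (cost≤ t (a / suc δ)) (*-monoʳ-≤ (1 + t) (b≤fourth (a / suc δ)))) ⟩
      (1 + t) * fourth (a / suc δ) * fourth (suc δ)    ≡⟨ *-assoc (1 + t) (fourth (a / suc δ)) (fourth (suc δ)) ⟩
      (1 + t) * (fourth (a / suc δ) * fourth (suc δ))  ≡⟨ cong ((1 + t) *_) (fourth-* (a / suc δ) (suc δ)) ⟩
      (1 + t) * fourth (a / suc δ * suc δ)             ≤⟨ *-monoʳ-≤ (1 + t) (fourth-mono (m/n*n≤m a (suc δ))) ⟩
      (1 + t) * fourth a                               ∎

  -- With t = 0 the cost is the bucket itself. Its mean is obtained from the second moment through a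
  -- σ ≤ a ^ 2 + σ ^ 2, with σ the square root of the block size.
  blockCost-first : ∀ δ σ .{{_ : NonZero σ}} → length S ≡ σ * σ → blockCost X δ 0 S * suc δ ≤ 2 ^ n * (2 * σ)
  blockCost-first δ σ len = *-cancelʳ-≤ _ _ σ (begin
    blockCost X δ 0 S * suc δ * σ                                                 ≡⟨ *-assoc (blockCost X δ 0 S) (suc δ) σ ⟩
    blockCost X δ 0 S * (suc δ * σ)                                               ≡⟨ Σ-*ʳ (allVec n) (suc δ * σ) (λ χ → cost 0 (∣ x χ ∣ / suc δ)) ⟨
    Σ (allVec n) (λ χ → cost 0 (∣ x χ ∣ / suc δ) * (suc δ * σ))               ≤⟨ Σ-mono (allVec n) (λ χ → pt ∣ x χ ∣) ⟩
    Σ (allVec n) (λ χ → ∣ x χ ∣ * ∣ x χ ∣ + σ * σ)                            ≡⟨ Σ-+ (allVec n) (λ χ → ∣ x χ ∣ * ∣ x χ ∣) (λ _ → σ * σ) ⟩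
    Σ (allVec n) (λ χ → ∣ x χ ∣ * ∣ x χ ∣) + Σ (allVec n) (λ _ → σ * σ)       ≡⟨ cong₂ _+_ (trans (Σ-cong (allVec n) (λ χ → cong (λ z → ∣ z ∣ * ∣ z ∣) (sumℤ-dot X S χ))) (second-moment (weight X S))) (trans (Σ-const (allVec n) (σ * σ)) (cong (_* (σ * σ)) (length-allVec n))) ⟩
    2 ^ n * energy (weight X S) + 2 ^ n * (σ * σ)                             ≤⟨ +-monoˡ-≤ (2 ^ n * (σ * σ)) (*-monoʳ-≤ (2 ^ n) (≤-trans (energy-weight X S simple) (≤-reflexive len))) ⟩
    2 ^ n * (σ * σ) + 2 ^ n * (σ * σ)                                         ≡⟨ e (2 ^ n) σ ⟩
    2 ^ n * (2 * σ) * σ                                                       ∎)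
    where
    open ≤-Reasoning
    e : ∀ p s → p * (s * s) + p * (s * s) ≡ p * (2 * s) * s
    e = solve-∀
    am-gm : ∀ a b → a * b ≤ a * a + b * b
    am-gm a b with ≤-total a b
    ... | inj₁ h = ≤-trans (*-monoˡ-≤ b h) (m≤n+m (b * b) (a * a))
    ... | inj₂ h = ≤-trans (*-monoʳ-≤ a h) (m≤m+n (a * a) (b * b))
    pt : ∀ a → cost 0 (a / suc δ) * (suc δ * σ) ≤ a * a + σ * σ
    pt a = begin
      cost 0 (a / suc δ) * (suc δ * σ)   ≡⟨ cong (_* (suc δ * σ)) (cost0 (a / suc δ)) ⟩
      a / suc δ * (suc δ * σ)            ≡⟨ *-assoc (a / suc δ) (suc δ) σ ⟨
      a / suc δ * suc δ * σ              ≤⟨ *-monoˡ-≤ σ (m/n*n≤m a (suc δ)) ⟩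
      a * σ                              ≤⟨ am-gm a σ ⟩
      a * a + σ * σ                      ∎

/-close : ∀ δ a b → a / suc δ ≡ b / suc δ → a ≤ b + δ
/-close δ a b e = begin
  a                                      ≡⟨ m≡m%n+[m/n]*n a (suc δ) ⟩
  a % suc δ + (a / suc δ) * suc δ        ≤⟨ +-monoˡ-≤ _ (≤-pred (m%n<n a (suc δ))) ⟩
  δ + (a / suc δ) * suc δ                ≡⟨ cong (λ k → δ + k * suc δ) e ⟩
  δ + (b / suc δ) * suc δ                ≤⟨ +-monoʳ-≤ δ (m/n*n≤m b (suc δ)) ⟩
  δ + b                                  ≡⟨ +-comm δ b ⟩
  b + δ                                  ∎
  where
  open ≤-Reasoning

∣⊖∣≤ : ∀ a b δ → a ≤ b + δ → b ≤ a + δ → ∣ a ℤ.⊖ b ∣ ≤ δ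
∣⊖∣≤ a b δ h h′ with ≤-total a b
... | inj₁ a≤b = ≤-trans (≤-reflexive (ℤ.∣⊖∣-≤ a≤b)) (≤-trans (∸-monoˡ-≤ a h′) (≤-reflexive (m+n∸m≡n a δ)))
... | inj₂ b≤a = ≤-trans (≤-reflexive (trans (ℤ.∣m⊖n∣≡∣n⊖m∣ a b) (ℤ.∣⊖∣-≤ b≤a))) (≤-trans (∸-monoˡ-≤ b h) (≤-reflexive (m+n∸m≡n b δ)))

-- The factor 2 arises only at bucket 0, which contains all of -δ, ..., δ; halving the difference of
-- two colourings removes it.
same-bucket : ∀ δ x y → pos x / suc δ ≡ pos y / suc δ → pos (ℤ.- x) / suc δ ≡ pos (ℤ.- y) / suc δ → ∣ x ℤ.- y ∣ ≤ 2 * δ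
same-bucket δ (+ a) (+ b) p q = ≤-trans (≤-trans (≤-reflexive (cong ∣_∣ (ℤ.m-n≡m⊖n a b))) (∣⊖∣≤ a b δ (/-close δ a b p) (/-close δ b a (sym p)))) (m≤m+n δ _)
same-bucket δ (+ a) -[1+ b ] p q = ≤-trans (+-mono-≤ (/-close δ a 0 p) (/-close δ (suc b) 0 (trans (sym q) (cong (_/ suc δ) (neg a (suc b) q))))) (≤-reflexive (cong (λ k → δ + k) (sym (+-identityʳ δ))))
  where
  neg : ∀ a b → pos (ℤ.- (+ a)) / suc δ ≡ b / suc δ → pos (ℤ.- (+ a)) ≡ 0
  neg zero    b _ = refl
  neg (suc a) b _ = refl
same-bucket δ -[1+ a ] (+ b) p q = ≤-trans (≤-reflexive (cong ∣_∣ (flip a b))) (≤-trans (+-mono-≤ (/-close δ (suc a) 0 (trans q (cong (_/ suc δ) (neg b)))) (/-close δ b 0 (sym p))) (≤-reflexive (cong (λ k → δ + k) (sym (+-identityʳ δ)))))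
  where
  neg : ∀ b → pos (ℤ.- (+ b)) ≡ 0
  neg zero    = refl
  neg (suc b) = refl
  flip : ∀ a b → -[1+ a ] ℤ.- + b ≡ ℤ.- + (suc a + b)
  flip a b = sym (ℤ.neg-distrib-+ (+ suc a) (+ b))
same-bucket δ -[1+ a ] -[1+ b ] p q = ≤-trans (≤-trans (≤-reflexive (trans (cong ∣_∣ (ℤ.[1+m]⊖[1+n]≡m⊖n b a)) (ℤ.∣m⊖n∣≡∣n⊖m∣ b a))) (∣⊖∣≤ a b δ (≤-pred (/-close δ (suc a) (suc b) q)) (≤-pred (/-close δ (suc b) (suc a) (sym q))))) (m≤m+n δ _)

differOn : ∀ {n} → (Fin n → Bool) → Vec Bool n → Vec Bool n → Fin n → Bool
differOn X χ χ′ y = X y ∧ not (same (lookup χ y) (lookup χ′ y))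

sumℤ-cong : ∀ {A : Set} (S : List A) {f g : A → ℤ} → (∀ y → f y ≡ g y) → sumℤ S f ≡ sumℤ S g
sumℤ-cong []      h = refl
sumℤ-cong (z ∷ S) h = cong₂ ℤ._+_ (h z) (sumℤ-cong S h)

sumℤ-+ : ∀ {A : Set} (S : List A) (f g : A → ℤ) → sumℤ S (λ y → f y ℤ.+ g y) ≡ sumℤ S f ℤ.+ sumℤ S g
sumℤ-+ []      f g = refl
sumℤ-+ (z ∷ S) f g = trans (cong₂ ℤ._+_ (refl {x = f z ℤ.+ g z}) (sumℤ-+ S f g)) (e (f z) (g z) _ _)
  where
  e : ∀ a b c d → (a ℤ.+ b) ℤ.+ (c ℤ.+ d) ≡ (a ℤ.+ c) ℤ.+ (b ℤ.+ d)
  e = ℤR.solve-∀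

-- On agreeing buckets the half-difference of two colourings is a partial colouring.
half-difference : ∀ {n} X δ (S : List (Fin n)) χ χ′ →
  pos (blockSum X S χ) / suc δ ≡ pos (blockSum X S χ′) / suc δ →
  pos (ℤ.- blockSum X S χ) / suc δ ≡ pos (ℤ.- blockSum X S χ′) / suc δ →
  ∣ sumℤ S (val (differOn X χ χ′) (lookup χ)) ∣ ≤ δ
half-difference X δ S χ χ′ p q = *-cancelˡ-≤ 2 (begin
  2 * ∣ z ∣                 ≡⟨ ℤ.abs-* (+ 2) z ⟨
  ∣ + 2 ℤ.* z ∣             ≡⟨ cong ∣_∣ (trans (e z (blockSum X S χ′)) (cong (ℤ._- blockSum X S χ′) double)) ⟩
  ∣ blockSum X S χ ℤ.- blockSum X S χ′ ∣ ≤⟨ same-bucket δ (blockSum X S χ) (blockSum X S χ′) p q ⟩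
  2 * δ                     ∎)
  where
  open ≤-Reasoning
  w = val (differOn X χ χ′) (lookup χ)
  z = sumℤ S w
  e : ∀ z y → + 2 ℤ.* z ≡ (z ℤ.+ (z ℤ.+ y)) ℤ.- y
  e = ℤR.solve-∀
  pt : ∀ b c d → let u = if b ∧ not (same c d) then sign c else + 0 in u ℤ.+ (u ℤ.+ (if b then sign d else + 0)) ≡ (if b then sign c else + 0)
  pt true  true  true  = refl
  pt true  true  false = refl
  pt true  false true  = refl
  pt true  false false = refl
  pt false c     d     = refl
  double : z ℤ.+ (z ℤ.+ blockSum X S χ′) ≡ blockSum X S χ
  double = trans (sym (trans (sumℤ-+ S w _) (cong₂ ℤ._+_ (refl {x = z}) (sumℤ-+ S w _))))
    (sumℤ-cong S (λ y → pt (X y) (lookup χ y) (lookup χ′ y)))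

recolour : ∀ {n} → (Fin n → Bool) → Vec Bool n → Vec Bool n → (Fin n → Bool) → Fin n → Bool
recolour X χ χ′ ψ y = if differOn X χ χ′ y then lookup χ y else ψ y

sumℤ-recolour : ∀ {n} X (S : List (Fin n)) χ χ′ ψ → sumℤ S (val X (recolour X χ χ′ ψ)) ≡
  sumℤ S (val (differOn X χ χ′) (lookup χ)) ℤ.+ sumℤ S (val (agreeOn X χ χ′) ψ)
sumℤ-recolour X S χ χ′ ψ = trans (sumℤ-cong S (λ y → pt (X y) (lookup χ y) (lookup χ′ y) (ψ y))) (sumℤ-+ S _ _)
  where
  pt : ∀ b c d e → (if b then sign (if b ∧ not (same c d) then c else e) else + 0) ≡
    (if b ∧ not (same c d) then sign c else + 0) ℤ.+ (if b ∧ same c d then sign e else + 0)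
  pt true  true  true  e = sym (ℤ.+-identityˡ _)
  pt true  true  false e = refl
  pt true  false true  e = refl
  pt true  false false e = sym (ℤ.+-identityˡ _)
  pt false c     d     e = refl

-- One scale: block counts, code lengths and Kraft sums

halfT : ℕ → ℕ
halfT t = 2 ^ (t ∸ 1)

-- Up to one more bit, a bound for the binary logarithm of (1 + 2 ^ (-t)) ^ M. At t = 0 the
-- truncated subtraction makes the divisor 1.
extraBits : ℕ → ℕ → ℕ
extraBits M t = _/_ M (halfT t) {{m^n≢0 2 (t ∸ 1)}}

2halfT : ∀ t → 2 ^ t ≤ 2 * halfT t
2halfT zero    = s≤s z≤n
2halfT (suc t) = ≤-refl

2halfT≤ : ∀ t → 2 * halfT t ≤ suc (2 ^ t)
2halfT≤ zero    = ≤-refl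
2halfT≤ (suc t) = n≤1+n _

extraBits-bound : ∀ N t → extraBits (2 * N) t * 2 ^ t ≤ 4 * N
extraBits-bound N t = begin
  m * 2 ^ t              ≤⟨ *-monoʳ-≤ m (2halfT t) ⟩
  m * (2 * halfT t)      ≡⟨ e m (halfT t) ⟩
  2 * (m * halfT t)      ≤⟨ *-monoʳ-≤ 2 (m/n*n≤m (2 * N) (halfT t) {{m^n≢0 2 (t ∸ 1)}}) ⟩
  2 * (2 * N)            ≡⟨ *-assoc 2 2 N ⟨
  4 * N                  ∎
  where
  open ≤-Reasoning
  m = extraBits (2 * N) t
  e : ∀ m h → m * (2 * h) ≡ 2 * (m * h)
  e = solve-∀

[2^t+1]^M≤ : ∀ M t → suc (2 ^ t) ^ M ≤ 2 ^ (M * t + suc (extraBits M t))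
[2^t+1]^M≤ M t = begin
  suc T ^ M                           ≡⟨ cong (suc T ^_) dec ⟩
  suc T ^ (ρ + m * h)                 ≤⟨ [1+T]^mh≤ T h m (2halfT≤ t) ρ (<⇒≤ (m%n<n M h)) ⟩
  T ^ (ρ + m * h) * 2 ^ suc m         ≡⟨ cong (λ k → T ^ k * 2 ^ suc m) dec ⟨
  T ^ M * 2 ^ suc m                   ≡⟨ cong (_* 2 ^ suc m) (trans (^-*-assoc 2 t M) (cong (2 ^_) (*-comm t M))) ⟩
  2 ^ (M * t) * 2 ^ suc m             ≡⟨ ^-distribˡ-+-* 2 (M * t) (suc m) ⟨
  2 ^ (M * t + suc m)                 ∎
  where
  open ≤-Reasoning
  instance _ = m^n≢0 2 (t ∸ 1)
  T = 2 ^ t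
  h = halfT t
  m = extraBits M t
  ρ = M % h
  dec : M ≡ ρ + m * h
  dec = m≡m%n+[m/n]*n M h

b≤b^k : ∀ e k → 2 ^ e ≤ (2 ^ e) ^ suc k
b≤b^k e k = m≤m*n (2 ^ e) ((2 ^ e) ^ k) {{m^n≢0 (2 ^ e) k {{m^n≢0 2 e}}}}

-- The scale lies e below the critical one; `N` counts blocks, `D` differences and `r` points. With
-- b = 2 ^ e, `count` says N ≤ r b ^ 21 / 256, and by `cost-one` a block costs 3 b ^ 6 / b ^ 28 on
-- average.
module Low (i e N D r : ℕ) (hN : N * s i ≤ r * D) (hD : D * 256 ≤ s (i + e) * (1 + 16 * e)) where

  private
    b = 2 ^ e
    a = root i
    b8 = b ^ 8
    instance
      b≢0 : NonZero b
      b≢0 = m^n≢0 2 e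

    pow28 : b ^ 7 * b ^ 7 * (b ^ 7 * b ^ 7) ≡ b * (b8 * b8 * (b ^ 5 * b ^ 6))
    pow28 = trans (cong (λ x → x * x) (sym (^-distribˡ-+-* b 7 7))) (trans (sym (^-distribˡ-+-* b 14 14))
      (sym (cong (b *_) (trans (cong₂ _*_ (sym (^-distribˡ-+-* b 8 8)) (sym (^-distribˡ-+-* b 5 6))) (sym (^-distribˡ-+-* b 16 11))))))

  count : N * 256 ≤ r * (b8 * b8 * b ^ 5)
  count = *-cancelʳ-≤ _ _ (a * a) {{m*n≢0 a a {{>-nonZero (1≤root i)}} {{>-nonZero (1≤root i)}}}} (begin
    N * 256 * (a * a)                             ≡⟨ cong (N * 256 *_) (root² i) ⟩
    N * 256 * s i                                 ≡⟨ e₁ N (s i) ⟩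
    N * s i * 256                                 ≤⟨ *-monoˡ-≤ 256 hN ⟩
    r * D * 256                                   ≡⟨ *-assoc r D 256 ⟩
    r * (D * 256)                                 ≤⟨ *-monoʳ-≤ r hD ⟩
    r * (s (i + e) * (1 + 16 * e))                ≤⟨ *-monoʳ-≤ r (*-monoʳ-≤ (s (i + e)) (1+16e≤ e)) ⟩
    r * (s (i + e) * b ^ 5)                       ≡⟨ cong (λ x → r * (x * b ^ 5)) (trans (sym (root² (i + e))) (cong (λ x → x * x) (root-+ i e))) ⟩
    r * (a * b8 * (a * b8) * b ^ 5)               ≡⟨ e₂ r a b8 (b ^ 5) ⟩
    r * (b8 * b8 * b ^ 5) * (a * a)               ∎)
    where
    open ≤-Reasoning
    e₁ : ∀ x y → x * 256 * y ≡ x * y * 256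
    e₁ = solve-∀
    e₂ : ∀ r a b c → r * (a * b * (a * b) * c) ≡ r * (b * b * c) * (a * a)
    e₂ = solve-∀

  cost-one : ∀ {c p} → c * fourth (Δ (i + e) i) ≤ p * ((1 + e * 32) * (3 * (s i * s i))) → c * fourth (b ^ 7) ≤ p * (3 * b ^ 6)
  cost-one {c} {p} h = *-cancelʳ-≤ _ _ (fourth a) {{m*n≢0 (a * a) (a * a) {{aa}} {{aa}}}} (begin
    c * fourth (b ^ 7) * fourth a                           ≡⟨ e₁ c (fourth (b ^ 7)) (fourth a) ⟩
    c * (fourth a * fourth (b ^ 7))                         ≡⟨ cong (c *_) (trans (fourth-* a (b ^ 7)) (cong fourth (sym (Δ-low i e)))) ⟩
    c * fourth (Δ (i + e) i)                                ≤⟨ h ⟩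
    p * ((1 + e * 32) * (3 * (s i * s i)))                  ≤⟨ *-monoʳ-≤ p (*-monoˡ-≤ (3 * (s i * s i)) (≤-trans (≤-reflexive (cong suc (*-comm e 32))) (1+32e≤ e))) ⟩
    p * (b ^ 6 * (3 * (s i * s i)))                         ≡⟨ cong (λ x → p * (b ^ 6 * (3 * (x * x)))) (root² i) ⟨
    p * (b ^ 6 * (3 * fourth a))                            ≡⟨ e₂ p (b ^ 6) (fourth a) ⟩
    p * (3 * b ^ 6) * fourth a                              ∎)
    where
    open ≤-Reasoning
    aa = m*n≢0 a a {{>-nonZero (1≤root i)}} {{>-nonZero (1≤root i)}}
    e₁ : ∀ x y z → x * y * z ≡ x * (z * y)
    e₁ = solve-∀
    e₂ : ∀ x y z → x * (y * (3 * z)) ≡ x * (3 * y) * z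
    e₂ = solve-∀

  cost-all : ∀ {C p} → C * fourth (b ^ 7) ≤ N * (p * (3 * b ^ 6)) → C * 256 * b ≤ p * (3 * r)
  cost-all {C} {p} h = *-cancelʳ-≤ _ _ w {{w≢0}} (begin
    C * 256 * b * w                              ≡⟨ e₁ C b w ⟩
    C * (b * w) * 256                            ≡⟨ cong (λ x → C * x * 256) pow28 ⟨
    C * fourth (b ^ 7) * 256                     ≤⟨ *-monoˡ-≤ 256 h ⟩
    N * (p * (3 * b ^ 6)) * 256                  ≡⟨ e₂ N (p * (3 * b ^ 6)) ⟩
    N * 256 * (p * (3 * b ^ 6))                  ≤⟨ *-monoˡ-≤ (p * (3 * b ^ 6)) count ⟩
    r * (b8 * b8 * b ^ 5) * (p * (3 * b ^ 6))    ≡⟨ e₃ r (b8 * b8) (b ^ 5) p (b ^ 6) ⟩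
    p * (3 * r) * w                              ∎)
    where
    open ≤-Reasoning
    w = b8 * b8 * (b ^ 5 * b ^ 6)
    w≢0 : NonZero w
    w≢0 = m*n≢0 (b8 * b8) (b ^ 5 * b ^ 6) {{m*n≢0 b8 b8 {{m^n≢0 b 8}} {{m^n≢0 b 8}}}} {{m*n≢0 (b ^ 5) (b ^ 6) {{m^n≢0 b 5}} {{m^n≢0 b 6}}}}
    e₁ : ∀ x y z → x * 256 * y * z ≡ x * (y * z) * 256
    e₁ = solve-∀
    e₂ : ∀ x y → x * y * 256 ≡ x * 256 * y
    e₂ = solve-∀
    e₃ : ∀ r x y p z → r * (x * y) * (p * (3 * z)) ≡ p * (3 * r) * (x * (y * z))
    e₃ = solve-∀

  -- The number of blocks brings b ^ 21 and the decay asks for one more b; 2 ^ t = b ^ 32 outweighs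
  -- both.
  bits : extraBits (2 * N) (e * 32) * 256 * b ≤ 4 * r
  bits = *-cancelʳ-≤ _ _ w {{w≢0}} (begin
    m * 256 * b * w                         ≡⟨ e₁ m b w ⟩
    m * (b * w) * 256                       ≤⟨ *-monoˡ-≤ 256 (*-monoʳ-≤ m bw≤) ⟩
    m * 2 ^ (e * 32) * 256                  ≤⟨ *-monoˡ-≤ 256 (extraBits-bound N (e * 32)) ⟩
    4 * N * 256                             ≡⟨ *-assoc 4 N 256 ⟩
    4 * (N * 256)                           ≤⟨ *-monoʳ-≤ 4 count ⟩
    4 * (r * w)                             ≡⟨ *-assoc 4 r w ⟨
    4 * r * w                               ∎)
    where
    open ≤-Reasoning
    m = extraBits (2 * N) (e * 32)
    w = b8 * b8 * b ^ 5
    w≢0 : NonZero w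
    w≢0 = m*n≢0 (b8 * b8) (b ^ 5) {{m*n≢0 b8 b8 {{m^n≢0 b 8}} {{m^n≢0 b 8}}}} {{m^n≢0 b 5}}
    e₁ : ∀ x y z → x * 256 * y * z ≡ x * (y * z) * 256
    e₁ = solve-∀
    bw≤ : b * w ≤ 2 ^ (e * 32)
    bw≤ = begin
      b * w             ≡⟨ cong (b *_) (trans (cong (_* b ^ 5) (sym (^-distribˡ-+-* b 8 8))) (sym (^-distribˡ-+-* b 16 5))) ⟩
      b ^ 22            ≤⟨ ^-monoʳ-≤ b {22} {32} (m≤m+n 22 10) ⟩
      b ^ 32            ≡⟨ ^-*-assoc 2 e 32 ⟩
      2 ^ (e * 32)      ∎

-- The scale lies e above the critical one. The standard deviation exceeds the allowance by b ^ 9,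
-- so a block costs up to 2 b ^ 9 on average, but there are at most r / (256 b ^ 16) blocks.
module High (j e N D r : ℕ) (hN : N * s (j + e) ≤ r * D) (hD : D * 256 ≤ s j * 1) where

  private
    b = 2 ^ e
    c = root j
    b8 = b ^ 8
    instance
      b≢0 : NonZero b
      b≢0 = m^n≢0 2 e
      c≢0 : NonZero c
      c≢0 = >-nonZero (1≤root j)
      b8≢0 : NonZero b8
      b8≢0 = m^n≢0 b 8

  count : N * 256 * (b8 * b8) ≤ r
  count = *-cancelʳ-≤ _ _ (c * c) {{m*n≢0 c c}} (begin
    N * 256 * (b8 * b8) * (c * c)     ≡⟨ e₁ N b8 c ⟩
    N * (c * b8 * (c * b8)) * 256     ≡⟨ cong (λ x → N * x * 256) (trans (cong (λ x → x * x) (sym (root-+ j e))) (root² (j + e))) ⟩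
    N * s (j + e) * 256               ≤⟨ *-monoˡ-≤ 256 hN ⟩
    r * D * 256                       ≡⟨ *-assoc r D 256 ⟩
    r * (D * 256)                     ≤⟨ *-monoʳ-≤ r hD ⟩
    r * (s j * 1)                     ≡⟨ cong (r *_) (trans (*-identityʳ (s j)) (sym (root² j))) ⟩
    r * (c * c)                       ∎)
    where
    open ≤-Reasoning
    e₁ : ∀ n b c → n * 256 * (b * b) * (c * c) ≡ n * (c * b * (c * b)) * 256
    e₁ = solve-∀

  cost-one : ∀ {x p} → x * Δ j (j + e) ≤ p * (2 * root (j + e)) → x ≤ p * (2 * (b8 * b))
  cost-one {x} {p} h = *-cancelʳ-≤ _ _ c (begin
    x * c                          ≤⟨ *-monoʳ-≤ x (Δ-high j e) ⟩
    x * (Δ j (j + e) * b)          ≡⟨ *-assoc x _ b ⟨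
    x * Δ j (j + e) * b            ≤⟨ *-monoˡ-≤ b h ⟩
    p * (2 * root (j + e)) * b     ≡⟨ cong (λ y → p * (2 * y) * b) (root-+ j e) ⟩
    p * (2 * (c * b8)) * b         ≡⟨ e₁ p c b8 b ⟩
    p * (2 * (b8 * b)) * c         ∎)
    where
    open ≤-Reasoning
    e₁ : ∀ p c x b → p * (2 * (c * x)) * b ≡ p * (2 * (x * b)) * c
    e₁ = solve-∀

  cost-all : ∀ {C p} → C ≤ N * (p * (2 * (b8 * b))) → C * 256 * b ≤ p * (3 * r)
  cost-all {C} {p} h = ≤-trans (*-cancelʳ-≤ _ _ b8 (begin
    C * 256 * b * b8                           ≤⟨ *-monoˡ-≤ b8 (*-monoʳ-≤ (C * 256) (b≤b^k e 6)) ⟩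
    C * 256 * b ^ 7 * b8                       ≤⟨ *-monoˡ-≤ b8 inner ⟩
    p * (2 * r) * b8                           ∎)) (*-monoʳ-≤ p (*-monoˡ-≤ r {2} {3} (m≤m+n 2 1)))
    where
    open ≤-Reasoning
    e₁ : ∀ C x b y → C * 256 * x * (b * y) ≡ C * 256 * (y * (b * x))
    e₁ = solve-∀
    inner : C * 256 * b ^ 7 ≤ p * (2 * r)
    inner = *-cancelʳ-≤ _ _ (b * b8) {{m*n≢0 b b8}} (begin
      C * 256 * b ^ 7 * (b * b8)                 ≡⟨ e₁ C (b ^ 7) b b8 ⟩
      C * 256 * (b8 * b8)                        ≤⟨ *-monoˡ-≤ (b8 * b8) (*-monoˡ-≤ 256 h) ⟩
      N * (p * (2 * (b8 * b))) * 256 * (b8 * b8) ≡⟨ e₅ N p b8 b ⟩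
      p * 2 * (N * 256 * (b8 * b8)) * (b * b8)   ≤⟨ *-monoˡ-≤ (b * b8) (*-monoʳ-≤ (p * 2) count) ⟩
      p * 2 * r * (b * b8)                       ≡⟨ cong (_* (b * b8)) (*-assoc p 2 r) ⟩
      p * (2 * r) * (b * b8)                     ∎)
      where
      e₅ : ∀ n p y b → n * (p * (2 * (y * b))) * 256 * (y * y) ≡ p * 2 * (n * 256 * (y * y)) * (b * y)
      e₅ = solve-∀

  bits : extraBits (2 * N) 0 * 256 * b ≤ 4 * r
  bits = begin
    m * 256 * b                 ≤⟨ *-monoʳ-≤ (m * 256) (≤-trans (b≤b^k e 7) (m≤m*n b8 b8)) ⟩
    m * 256 * (b8 * b8)         ≤⟨ *-monoˡ-≤ (b8 * b8) (*-monoˡ-≤ 256 (≤-trans (≤-reflexive (sym (*-identityʳ m))) (extraBits-bound N 0))) ⟩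
    4 * N * 256 * (b8 * b8)     ≡⟨ e₁ N (b8 * b8) ⟩
    4 * (N * 256 * (b8 * b8))   ≤⟨ *-monoʳ-≤ 4 count ⟩
    4 * r                       ∎
    where
    open ≤-Reasoning
    m = extraBits (2 * N) 0
    e₁ : ∀ n x → 4 * n * 256 * x ≡ 4 * (n * 256 * x)
    e₁ = solve-∀

-- Enumerations and concatenated lists of features

fins : ∀ n → List (Fin n)
fins zero    = []
fins (suc n) = zero ∷ map suc (fins n)

∈-fins : ∀ {n} (y : Fin n) → y ∈ fins n
∈-fins zero    = here refl
∈-fins (suc y) = there (∈-map⁺ suc (∈-fins y))

∈-concatMap : ∀ {A B : Set} (f : A → List B) {xs x y} → x ∈ xs → y ∈ f x → y ∈ concatMap f xs
∈-concatMap f (here refl)           y∈ = ∈-++⁺ˡ y∈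
∈-concatMap f {xs = x ∷ _} (there x∈) y∈ = ∈-++⁺ʳ (f x) (∈-concatMap f x∈ y∈)

concatMap-∈ : ∀ {A B : Set} (f : A → List B) xs {y} → y ∈ concatMap f xs → ∃[ x ] y ∈ f x
concatMap-∈ f (x ∷ xs) y∈ with ∈-++⁻ (f x) y∈
... | inj₁ y∈f = x , y∈f
... | inj₂ y∈r = concatMap-∈ f xs y∈r

length-concatMap : ∀ {A B : Set} (f : A → List B) xs → length (concatMap f xs) ≡ Σ xs (length ∘ f)
length-concatMap f []       = refl
length-concatMap f (x ∷ xs) = trans (length-++ (f x)) (cong (λ k → length (f x) + k) (length-concatMap f xs))

∈-rng : ∀ {n x} → x < n → x ∈ rng n
∈-rng {suc n} {x} x<n with x ≟ n
... | yes refl = here refl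
... | no  x≢n  = there (∈-rng (≤∧≢⇒< (≤-pred x<n) x≢n))

rng-∈ : ∀ {n x} → x ∈ rng n → x < n
rng-∈ {suc n} (here refl) = ≤-refl
rng-∈ {suc n} (there x∈)  = m<n⇒m<1+n (rng-∈ x∈)

kraftProd-++ : ∀ {C : Set} (fs gs : List (Feature C)) → kraftProd (fs ++ gs) ≡ kraftProd fs * kraftProd gs
kraftProd-++ []             gs = sym (+-identityʳ _)
kraftProd-++ ((f , t) ∷ fs) gs = trans (cong ((2 ^ t + 1) *_) (kraftProd-++ fs gs)) (sym (*-assoc (2 ^ t + 1) _ _))

kraftProd-concatMap : ∀ {A C : Set} (h : A → List (Feature C)) (m : A → ℕ) xs →
  (∀ x → kraftProd (h x) ≤ 2 ^ (Σ (h x) proj₂ + m x)) →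
  kraftProd (concatMap h xs) ≤ 2 ^ (Σ (concatMap h xs) proj₂ + Σ xs m)
kraftProd-concatMap h m []       bound = ≤-refl
kraftProd-concatMap h m (x ∷ xs) bound = begin
  kraftProd (h x ++ rest)                              ≡⟨ kraftProd-++ (h x) rest ⟩
  kraftProd (h x) * kraftProd rest                     ≤⟨ *-mono-≤ (bound x) (kraftProd-concatMap h m xs bound) ⟩
  2 ^ (Σ (h x) proj₂ + m x) * 2 ^ (Σ rest proj₂ + Σ xs m) ≡⟨ ^-distribˡ-+-* 2 (Σ (h x) proj₂ + m x) _ ⟨
  2 ^ (Σ (h x) proj₂ + m x + (Σ rest proj₂ + Σ xs m))  ≡⟨ cong (2 ^_) (interchange (Σ (h x) proj₂) (m x) (Σ rest proj₂) (Σ xs m)) ⟩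
  2 ^ (Σ (h x) proj₂ + Σ rest proj₂ + (m x + Σ xs m))  ≡⟨ cong (λ k → 2 ^ (k + (m x + Σ xs m))) (sym (Σ-++ (h x) rest proj₂)) ⟩
  2 ^ (Σ (h x ++ rest) proj₂ + (m x + Σ xs m))         ∎
  where
  open ≤-Reasoning
  rest = concatMap h xs

module _ {n} (X : Fin n → Bool) (δ t : ℕ) where

  scaleFeatures : List (List (Fin n)) → List (Feature (Vec Bool n))
  scaleFeatures = concatMap (bucketFeatures X δ t)

  kraftProd-scale : ∀ bs → kraftProd (scaleFeatures bs) ≡ suc (2 ^ t) ^ (2 * length bs)
  kraftProd-scale []       = refl
  kraftProd-scale (S ∷ bs) = begin
    (2 ^ t + 1) * ((2 ^ t + 1) * kraftProd (scaleFeatures bs))       ≡⟨ cong₂ (λ a b → a * (a * b)) (+-comm (2 ^ t) 1) (kraftProd-scale bs) ⟩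
    suc (2 ^ t) ^ (2 + 2 * length bs)                                ≡⟨ cong (suc (2 ^ t) ^_) (*-suc 2 (length bs)) ⟨
    suc (2 ^ t) ^ (2 * suc (length bs))                              ∎
    where open ≡-Reasoning

  Σt-scale : ∀ bs → Σ (scaleFeatures bs) proj₂ ≡ 2 * length bs * t
  Σt-scale []       = refl
  Σt-scale (S ∷ bs) = trans (cong (λ k → t + (t + k)) (Σt-scale bs)) (e t (length bs))
    where
    e : ∀ t l → t + (t + 2 * l * t) ≡ 2 * (1 + l) * t
    e = solve-∀

  kraft-scale : ∀ bs → kraftProd (scaleFeatures bs) ≤ 2 ^ (Σ (scaleFeatures bs) proj₂ + suc (extraBits (2 * length bs) t))
  kraft-scale bs = begin
    kraftProd (scaleFeatures bs)                                         ≡⟨ kraftProd-scale bs ⟩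
    suc (2 ^ t) ^ (2 * length bs)                                        ≤⟨ [2^t+1]^M≤ (2 * length bs) t ⟩
    2 ^ (2 * length bs * t + suc (extraBits (2 * length bs) t))          ≡⟨ cong (λ k → 2 ^ (k + suc (extraBits (2 * length bs) t))) (sym (Σt-scale bs)) ⟩
    2 ^ (Σ (scaleFeatures bs) proj₂ + suc (extraBits (2 * length bs) t)) ∎
    where open ≤-Reasoning

  Σcost-scale : ∀ bs → Σ (scaleFeatures bs) (λ ft → Σ (allVec n) (λ χ → cost (proj₂ ft) (proj₁ ft χ))) ≡ Σ bs (blockCost X δ t)
  Σcost-scale bs = trans (Σ-concatMap (bucketFeatures X δ t) bs _) (Σ-cong bs pair)
    where
    pair : ∀ S → Σ (bucketFeatures X δ t S) (λ ft → Σ (allVec n) (λ χ → cost (proj₂ ft) (proj₁ ft χ))) ≡ blockCost X δ t S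
    pair S = trans (cong (λ k → Σ (allVec n) (λ χ → cost t (pos (blockSum X S χ) / suc δ)) + k) (+-identityʳ _))
      (trans (sym (Σ-+ (allVec n) _ _)) (Σ-cong (allVec n) (λ χ →
        trans (cong (λ k → cost t (pos (blockSum X S χ) / suc δ) + k) (sym (+-identityʳ _))) (cost-± δ t (blockSum X S χ)))))

-- One partial colouring, with all scales at once

chunks : ∀ {A : Set} (σ : ℕ) .{{_ : NonZero σ}} → List A → List (List A)
-- The quotient keeps complete blocks only; what is left at the end is covered by blocks of smaller
-- scales.
chunks σ L = map (λ q → take σ (drop (q * σ) L)) (rng (length L / σ))

module Step {n : ℕ} (ord : Fin n → List (Fin n)) (simple : ∀ d → Simple (ord d)) (g : Fin n → ℕ) (N j : ℕ)
  (few : ∀ i → Σ (fins n) (λ d → ⟦ s i * g d ≤? N ⟧) * 256 ≤ s j * (1 + 16 * (j ∸ i))) where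

  δ : ℕ → ℕ
  δ i = pred (Δ j i)

  suc-δ : ∀ i → suc (δ i) ≡ Δ j i
  suc-δ i = suc-pred (Δ j i) {{>-nonZero (1≤Δ j i)}}

  -- Below j the blocks are numerous and their Kraft sums must be very close to 1; from j upwards
  -- truncation gives 0.
  t : ℕ → ℕ
  t i = (j ∸ i) * 32

  when : ∀ {P : Set} → Dec P → List (List (Fin n)) → List (List (Fin n))
  when (yes _) L = L
  when (no _)  L = []

  chunksAt : ℕ → List (Fin n) → List (List (Fin n))
  chunksAt i = chunks (s i) {{>-nonZero (1≤s i)}}

  -- Only intervals with at most `N / g d` positions will be needed for the difference d, so no
  -- longer blocks are formed.
  blocksOf : (Fin n → Bool) → ℕ → Fin n → List (List (Fin n))
  blocksOf X i d = when (s i * g d ≤? N) (chunksAt i (filterᵇ X (ord d)))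

  blocks : (Fin n → Bool) → ℕ → List (List (Fin n))
  blocks X i = concatMap (blocksOf X i) (fins n)

  block-good : ∀ X i {S} → S ∈ blocks X i → Simple S × length S ≡ s i
  block-good X i {S} S∈ with concatMap-∈ (blocksOf X i) (fins n) S∈
  ... | d , S∈d with s i * g d ≤? N
  ...   | yes _ with ∈-map⁻ (λ q → take (s i) (drop (q * s i) (filterᵇ X (ord d)))) S∈d
  ...     | q , q∈ , refl = (λ y → ≤-trans (occ-take (s i) (drop (q * s i) M) y) (≤-trans (occ-drop (q * s i) M y) (≤-trans (occ-filter X (ord d) y) (simple d y)))) ,
    trans (length-take (s i) (drop (q * s i) M)) (m≤n⇒m⊓n≡m (≤-trans fits (≤-reflexive (sym (length-drop (q * s i) M)))))
    where
    instance _ = >-nonZero (1≤s i)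
    M = filterᵇ X (ord d)
    fits : s i ≤ length M ∸ q * s i
    fits = ≤-trans (≤-reflexive (sym (m+n∸n≡m (s i) (q * s i)))) (∸-monoˡ-≤ (q * s i) (≤-trans (*-monoˡ-≤ (s i) (rng-∈ q∈)) (m/n*n≤m (length M) (s i))))

  -- The blocks of one difference are disjoint pieces of `X`; a difference without blocks is not
  -- charged.
  blocks-count : ∀ X i → length (blocks X i) * s i ≤ card X * Σ (fins n) (λ d → ⟦ s i * g d ≤? N ⟧)
  blocks-count X i = begin
    length (blocks X i) * s i                                     ≡⟨ cong (_* s i) (length-concatMap (blocksOf X i) (fins n)) ⟩
    Σ (fins n) (length ∘ blocksOf X i) * s i                      ≡⟨ Σ-*ʳ (fins n) (s i) (length ∘ blocksOf X i) ⟨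
    Σ (fins n) (λ d → length (blocksOf X i d) * s i)              ≤⟨ Σ-mono (fins n) pt ⟩
    Σ (fins n) (λ d → card X * ⟦ s i * g d ≤? N ⟧)                ≡⟨ Σ-*ˡ (fins n) (card X) (λ d → ⟦ s i * g d ≤? N ⟧) ⟩
    card X * Σ (fins n) (λ d → ⟦ s i * g d ≤? N ⟧)                ∎
    where
    open ≤-Reasoning
    instance _ = >-nonZero (1≤s i)
    pt : ∀ d → length (blocksOf X i d) * s i ≤ card X * ⟦ s i * g d ≤? N ⟧
    pt d with s i * g d ≤? N
    ... | no  _ = z≤n
    ... | yes _ = begin
      length (chunksAt i M) * s i     ≡⟨ cong (_* s i) (trans (length-map _ (rng (length M / s i))) (length-rng (length M / s i))) ⟩
      length M / s i * s i            ≤⟨ m/n*n≤m (length M) (s i) ⟩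
      length M                        ≤⟨ length-filter≤card X (ord d) (simple d) ⟩
      card X                          ≡⟨ *-identityʳ (card X) ⟨
      card X * 1                      ∎
      where M = filterᵇ X (ord d)

  extra : (Fin n → Bool) → ℕ → ℕ
  extra X i = extraBits (2 * length (blocks X i)) (t i)

  scale-cost×bits : ∀ X i → Σ (blocks X i) (blockCost X (δ i) (t i)) * 256 * 2 ^ ∣ i - j ∣ ≤ 2 ^ n * (3 * card X)
                          × extra X i * 256 * 2 ^ ∣ i - j ∣ ≤ 4 * card X
  scale-cost×bits X i with ≤-total i j
  ... | inj₁ i≤j = subst (λ e → C * 256 * 2 ^ e ≤ 2 ^ n * (3 * card X)) (sym (m≤n⇒∣m-n∣≡n∸m i≤j)) (L.cost-all {C} {2 ^ n} all) ,
                   subst (λ e → extra X i * 256 * 2 ^ e ≤ 4 * card X) (sym (m≤n⇒∣m-n∣≡n∸m i≤j)) L.bits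
    where
    e = j ∸ i
    eq : i + e ≡ j
    eq = m+[n∸m]≡n i≤j
    D = Σ (fins n) (λ d → ⟦ s i * g d ≤? N ⟧)
    C = Σ (blocks X i) (blockCost X (δ i) (t i))
    module L = Low i e (length (blocks X i)) D (card X) (blocks-count X i) (subst (λ k → D * 256 ≤ s k * (1 + 16 * e)) (sym eq) (few i))
    one : ∀ S → S ∈ blocks X i → blockCost X (δ i) (t i) S * fourth ((2 ^ e) ^ 7) ≤ 2 ^ n * (3 * (2 ^ e) ^ 6)
    one S S∈ with block-good X i S∈
    ... | simp , len = L.cost-one {blockCost X (δ i) (t i) S} {2 ^ n} (subst₂ (λ a b → blockCost X (δ i) (t i) S * fourth a ≤ 2 ^ n * ((1 + t i) * (3 * (b * b))))
      (trans (suc-δ i) (cong (λ k → Δ k i) (sym eq))) len (blockCost-fourth X S simp (δ i) (t i)))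
    all : C * fourth ((2 ^ e) ^ 7) ≤ length (blocks X i) * (2 ^ n * (3 * (2 ^ e) ^ 6))
    all = ≤-trans (≤-reflexive (sym (Σ-*ʳ (blocks X i) (fourth ((2 ^ e) ^ 7)) (blockCost X (δ i) (t i)))))
      (≤-trans (Σ-mono-∈ (blocks X i) one) (≤-reflexive (Σ-const (blocks X i) _)))
  ... | inj₂ j≤i = subst (λ e → C * 256 * 2 ^ e ≤ 2 ^ n * (3 * card X)) (sym dist) (H.cost-all {C} {2 ^ n} all) ,
                   subst₂ (λ e k → extraBits (2 * length (blocks X i)) (k * 32) * 256 * 2 ^ e ≤ 4 * card X) (sym dist) (sym z) H.bits
    where
    e = i ∸ j
    eq : j + e ≡ i
    eq = m+[n∸m]≡n j≤i
    z : j ∸ i ≡ 0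
    z = m≤n⇒m∸n≡0 j≤i
    dist : ∣ i - j ∣ ≡ e
    dist = m≤n⇒∣n-m∣≡n∸m j≤i
    D = Σ (fins n) (λ d → ⟦ s i * g d ≤? N ⟧)
    C = Σ (blocks X i) (blockCost X (δ i) (t i))
    module H = High j e (length (blocks X i)) D (card X) (subst (λ k → length (blocks X i) * s k ≤ card X * D) (sym eq) (blocks-count X i))
      (subst (λ k → D * 256 ≤ s j * (1 + 16 * k)) z (few i))
    one : ∀ S → S ∈ blocks X i → blockCost X (δ i) (t i) S ≤ 2 ^ n * (2 * ((2 ^ e) ^ 8 * 2 ^ e))
    one S S∈ with block-good X i S∈
    ... | simp , len = subst (λ k → blockCost X (δ i) (k * 32) S ≤ 2 ^ n * (2 * ((2 ^ e) ^ 8 * 2 ^ e))) (sym z)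
      (H.cost-one {blockCost X (δ i) 0 S} {2 ^ n} (subst₂ (λ a k → blockCost X (δ i) 0 S * a ≤ 2 ^ n * (2 * root k)) (trans (suc-δ i) (cong (Δ j) (sym eq))) (sym eq)
        (blockCost-first X S simp (δ i) (root i) {{>-nonZero (1≤root i)}} (trans len (sym (root² i))))))
    all : C ≤ length (blocks X i) * (2 ^ n * (2 * ((2 ^ e) ^ 8 * 2 ^ e)))
    all = ≤-trans (Σ-mono-∈ (blocks X i) one) (≤-reflexive (Σ-const (blocks X i) _))

  features : (Fin n → Bool) → ℕ → List (Feature (Vec Bool n))
  features X I = concatMap (λ i → scaleFeatures X (δ i) (t i) (blocks X i)) (rng (suc I))

  module _ (X : Fin n → Bool) (I : ℕ) where

    private r = card X

    B₁ B₂ : ℕ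
    -- The two-sided geometric sum bounds the average cost by 9 r / 256, well below r / 16; the
    -- successor compensates for the rounded quotient.
    B₁ = suc (r / 16)
    B₂ = Σ (rng (suc I)) (λ i → suc (extra X i))

    r≤16B₁ : r ≤ 16 * B₁
    r≤16B₁ = begin
      r                          ≡⟨ m≡m%n+[m/n]*n r 16 ⟩
      r % 16 + r / 16 * 16       ≤⟨ +-monoˡ-≤ (r / 16 * 16) (<⇒≤ (m%n<n r 16)) ⟩
      16 + r / 16 * 16           ≡⟨ *-comm (suc (r / 16)) 16 ⟩
      16 * B₁                     ∎
      where open ≤-Reasoning

    total-cost : Σ (allVec n) (costs (features X I)) ≤ 2 ^ n * B₁
    total-cost = *-cancelʳ-≤ _ _ 256 (begin
      Σ (allVec n) (costs (features X I)) * 256              ≡⟨ cong (_* 256) (trans (Σ-swap (allVec n) (features X I) _) (trans (Σ-concatMap (λ i → scaleFeatures X (δ i) (t i) (blocks X i)) (rng (suc I)) _) (Σ-cong (rng (suc I)) (λ i → Σcost-scale X (δ i) (t i) (blocks X i))))) ⟩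
      Σ (rng (suc I)) C * 256                                ≡⟨ Σ-*ʳ (rng (suc I)) 256 C ⟨
      Σ (rng (suc I)) (λ i → C i * 256)                      ≤⟨ Σ-two-sided j (λ i → C i * 256) (λ i → proj₁ (scale-cost×bits X i)) (suc I) ⟩
      3 * (2 ^ n * (3 * r))                                  ≡⟨ e₁ (2 ^ n) r ⟩
      2 ^ n * (9 * r)                                        ≤⟨ *-monoʳ-≤ (2 ^ n) (*-mono-≤ {9} {16} (m≤m+n 9 7) r≤16B₁) ⟩
      2 ^ n * (16 * (16 * B₁))                                ≡⟨ e₂ (2 ^ n) B₁ ⟩
      2 ^ n * B₁ * 256                                        ∎)
      where
      open ≤-Reasoning
      C : ℕ → ℕ
      C i = Σ (blocks X i) (blockCost X (δ i) (t i))
      e₁ : ∀ p r → 3 * (p * (3 * r)) ≡ p * (9 * r)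
      e₁ = solve-∀
      e₂ : ∀ p b → p * (16 * (16 * b)) ≡ p * b * 256
      e₂ = solve-∀

    total-kraft : kraftProd (features X I) ≤ 2 ^ (Σ (features X I) proj₂ + B₂)
    total-kraft = kraftProd-concatMap (λ i → scaleFeatures X (δ i) (t i) (blocks X i)) (λ i → suc (extra X i)) (rng (suc I))
      (λ i → kraft-scale X (δ i) (t i) (blocks X i))

    -- After multiplication by 512, the successor in `B₁` and the `suc I` successors in `B₂` amount
    -- to 512 (2 + I) = 16 (64 + 32 I), whence the form of the hypothesis.
    total-bits : 64 + 32 * I ≤ r → 2 * (B₁ + B₂) ≤ r
    total-bits big = *-cancelˡ-≤ 256 (begin
      256 * (2 * (B₁ + B₂))                                    ≡⟨ e₁ (r / 16) B₂ ⟩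
      512 + 32 * (r / 16 * 16) + 512 * B₂                     ≤⟨ +-mono-≤ (+-monoʳ-≤ 512 (*-monoʳ-≤ 32 (m/n*n≤m r 16))) (≤-reflexive (cong (512 *_) B₂≡)) ⟩
      512 + 32 * r + 512 * (suc I + M)                        ≡⟨ e₂ r I M ⟩
      32 * r + 16 * (64 + 32 * I) + 2 * (M * 256)             ≤⟨ +-mono-≤ (+-monoʳ-≤ (32 * r) (*-monoʳ-≤ 16 big)) (*-monoʳ-≤ 2 M≤) ⟩
      32 * r + 16 * r + 2 * (3 * (4 * r))                     ≡⟨ e₃ r ⟩
      72 * r                                                  ≤⟨ *-monoˡ-≤ r {72} {256} (m≤m+n 72 184) ⟩
      256 * r                                                 ∎)
      where
      open ≤-Reasoning
      M = Σ (rng (suc I)) (extra X)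
      B₂≡ : B₂ ≡ suc I + M
      B₂≡ = trans (Σ-+ (rng (suc I)) (λ _ → 1) (extra X)) (cong (_+ M) (trans (Σ-const (rng (suc I)) 1) (trans (*-identityʳ _) (length-rng (suc I)))))
      M≤ : M * 256 ≤ 3 * (4 * r)
      M≤ = ≤-trans (≤-reflexive (sym (Σ-*ʳ (rng (suc I)) 256 (extra X))))
        (Σ-two-sided j (λ i → extra X i * 256) (λ i → proj₂ (scale-cost×bits X i)) (suc I))
      e₁ : ∀ q b → 256 * (2 * (1 + q + b)) ≡ 512 + 32 * (q * 16) + 512 * b
      e₁ = solve-∀
      e₂ : ∀ r i m → 512 + 32 * r + 512 * (1 + i + m) ≡ 32 * r + 16 * (64 + 32 * i) + 2 * (m * 256)
      e₂ = solve-∀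
      e₃ : ∀ r → 32 * r + 16 * r + 2 * (3 * (4 * r)) ≡ 72 * r
      e₃ = solve-∀

    halving : ∀ u → 64 + 32 * I ≤ r → 16 * u ≤ r → ∃[ χ ] ∃[ χ′ ] sim X χ χ′ < r ∸ u ×
      (∀ i → i ≤ I → ∀ S → S ∈ blocks X i → ∣ sumℤ S (val (differOn X χ χ′) (lookup χ)) ∣ ≤ δ i)
    halving u big 16u≤r = conclude (partial-colouring X (features X I) B₁ B₂ u 1≤r 16u≤r (total-bits big) total-cost total-kraft)
      where
      1≤r : 1 ≤ r
      1≤r = ≤-trans (m≤m+n 1 (63 + 32 * I)) big
      member : ∀ i → i ≤ I → ∀ {S ft} → S ∈ blocks X i → ft ∈ bucketFeatures X (δ i) (t i) S → ft ∈ features X I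
      member i i≤I S∈ ft∈ = ∈-concatMap (λ i → scaleFeatures X (δ i) (t i) (blocks X i)) (∈-rng (s≤s i≤I)) (∈-concatMap (bucketFeatures X (δ i) (t i)) S∈ ft∈)
      conclude : (∃[ χ ] ∃[ χ′ ] Agree (features X I) χ χ′ × sim X χ χ′ < r ∸ u) → ∃[ χ ] ∃[ χ′ ] sim X χ χ′ < r ∸ u ×
        (∀ i → i ≤ I → ∀ S → S ∈ blocks X i → ∣ sumℤ S (val (differOn X χ χ′) (lookup χ)) ∣ ≤ δ i)
      conclude (χ , χ′ , agree , small) = χ , χ′ , small , λ i i≤I S S∈ → half-difference X (δ i) S χ χ′
        (All.lookup agree (member i i≤I S∈ (here refl))) (All.lookup agree (member i i≤I S∈ (there (here refl))))

-- Intervals decomposed into aligned blocks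

∣x-x∣≡0 : ∀ x → ∣ x ℤ.- x ∣ ≡ 0
∣x-x∣≡0 x = cong ∣_∣ (ℤ.+-inverseʳ x)

triangle : ∀ x y z {a b} → ∣ x ℤ.- y ∣ ≤ a → ∣ y ℤ.- z ∣ ≤ b → ∣ x ℤ.- z ∣ ≤ a + b
triangle x y z {a} {b} p r = begin
  ∣ x ℤ.- z ∣                        ≡⟨ cong ∣_∣ (e x y z) ⟩
  ∣ (x ℤ.- y) ℤ.+ (y ℤ.- z) ∣        ≤⟨ ℤ.∣i+j∣≤∣i∣+∣j∣ (x ℤ.- y) (y ℤ.- z) ⟩
  ∣ x ℤ.- y ∣ + ∣ y ℤ.- z ∣          ≤⟨ +-mono-≤ p r ⟩
  a + b                              ∎
  where
  open ≤-Reasoning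
  e : ∀ x y z → x ℤ.- z ≡ (x ℤ.- y) ℤ.+ (y ℤ.- z)
  e = ℤR.solve-∀

stepSum : (ℕ → ℕ) → ℕ → ℕ → ℕ
stepSum δ i zero    = 0
stepSum δ i (suc f) = 2 * Q * δ i + stepSum δ (suc i) f

module Interval (pre : ℕ → ℤ) (len γ N I : ℕ) (δ : ℕ → ℕ)
  (blk : ∀ i → i ≤ I → s i * γ ≤ N → ∀ k → suc k * s i ≤ len → ∣ pre (suc k * s i) ℤ.- pre (k * s i) ∣ ≤ δ i) where

  chain : ∀ i α m → i ≤ I → s i * γ ≤ N → (α + m) * s i ≤ len → ∣ pre ((α + m) * s i) ℤ.- pre (α * s i) ∣ ≤ m * δ i
  chain i α zero    i≤I h fits rewrite +-identityʳ α = ≤-reflexive (∣x-x∣≡0 (pre (α * s i)))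
  chain i α (suc m) i≤I h fits rewrite +-suc α m = triangle (pre (suc (α + m) * s i)) (pre ((α + m) * s i)) (pre (α * s i))
    (blk i i≤I h (α + m) fits) (chain i α m i≤I h (≤-trans (m≤n+m _ (s i)) fits))

  interval : ∀ f i α y → f + i ≤ suc I → (α + y) * s i ≤ len → y * s i * γ ≤ N → y < s f →
    ∣ pre ((α + y) * s i) ℤ.- pre (α * s i) ∣ ≤ stepSum δ i f
  interval zero    i α y f+i≤ fits short y< = ≤-reflexive (trans (cong (λ k → ∣ pre ((α + k) * s i) ℤ.- pre (α * s i) ∣) y≡0)
      (trans (cong (λ k → ∣ pre (k * s i) ℤ.- pre (α * s i) ∣) (+-identityʳ α)) (∣x-x∣≡0 (pre (α * s i)))))
    where
    y≡0 : y ≡ 0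
    y≡0 = n<1⇒n≡0 (subst (y <_) s-zero y<)
  interval (suc f) i α zero  f+i≤ fits short y< = ≤-trans (≤-reflexive (trans (cong (λ k → ∣ pre (k * s i) ℤ.- pre (α * s i) ∣) (+-identityʳ α)) (∣x-x∣≡0 (pre (α * s i))))) z≤n
  interval (suc f) i α y@(suc _) f+i≤ fits short y< with y <? Q
  ... | yes y<Q = ≤-trans (chain i α y i≤I h fits)
                    (≤-trans (*-monoˡ-≤ (δ i) (≤-trans (<⇒≤ y<Q) (m≤m+n Q (Q + 0)))) (m≤m+n (2 * Q * δ i) _))
    where
    i≤I : i ≤ I
    i≤I = ≤-trans (m≤n+m i f) (≤-pred f+i≤)
    h : s i * γ ≤ N
    h = ≤-trans (*-monoˡ-≤ γ (m≤m+n (s i) _)) short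
  ... | no y≮Q = begin
    ∣ pre ((α + y) * s i) ℤ.- pre (α * s i) ∣        ≤⟨ triangle (pre ((α + y) * s i)) (pre ((α′ + y′) * s (suc i))) (pre (α * s i)) last (triangle (pre ((α′ + y′) * s (suc i))) (pre (α′ * s (suc i))) (pre (α * s i)) mid first) ⟩
    ρ * δ i + (stepSum δ (suc i) f + x * δ i)        ≡⟨ e₃ ρ (δ i) (stepSum δ (suc i) f) x ⟩
    (ρ + x) * δ i + stepSum δ (suc i) f              ≤⟨ +-monoˡ-≤ _ (*-monoˡ-≤ (δ i) (≤-trans (+-mono-≤ (<⇒≤ (m%n<n z Q)) (m∸n≤m Q (α % Q))) (≤-reflexive (cong (λ k → Q + k) (sym (+-identityʳ Q)))))) ⟩
    2 * Q * δ i + stepSum δ (suc i) f                ∎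
    where
    open ≤-Reasoning
    instance _ = >-nonZero 1≤Q
    i≤I : i ≤ I
    i≤I = ≤-trans (m≤n+m i f) (≤-pred f+i≤)
    h : s i * γ ≤ N
    h = ≤-trans (*-monoˡ-≤ γ (m≤m+n (s i) _)) short
    α′ = suc (α / Q)
    -- An aligned left end moves by a full `Q`, which is possible because y ≥ Q.
    x = Q ∸ α % Q
    z = y ∸ x
    y′ = z / Q
    ρ = z % Q
    e₃ : ∀ r d S x → r * d + (S + x * d) ≡ (r + x) * d + S
    e₃ = solve-∀
    α+x : α + x ≡ α′ * Q
    α+x = trans (cong (_+ x) (m≡m%n+[m/n]*n α Q)) (trans (e (α % Q) (α / Q * Q) x) (cong (_+ α / Q * Q) (m+[n∸m]≡n (<⇒≤ (m%n<n α Q)))))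
      where
      e : ∀ a b c → a + b + c ≡ a + c + b
      e = solve-∀
    x≤y : x ≤ y
    x≤y = ≤-trans (m∸n≤m Q (α % Q)) (≮⇒≥ y≮Q)
    α+y : α + y ≡ (α′ + y′) * Q + ρ
    α+y = trans (cong (λ k → α + k) (sym (m+[n∸m]≡n x≤y))) (trans (sym (+-assoc α x z)) (trans (cong₂ _+_ α+x (m≡m%n+[m/n]*n z Q)) (e (α′) Q ρ y′)))
      where
      e : ∀ a Q r y → a * Q + (r + y * Q) ≡ (a + y) * Q + r
      e = solve-∀
    up : ∀ a → a * s (suc i) ≡ a * Q * s i
    up a = trans (cong (a *_) (s-suc i)) (sym (*-assoc a Q (s i)))
    y′Q≤y : y′ * Q ≤ y
    y′Q≤y = ≤-trans (m/n*n≤m z Q) (m∸n≤m y x)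
    first : ∣ pre (α′ * s (suc i)) ℤ.- pre (α * s i) ∣ ≤ x * δ i
    first = subst (λ k → ∣ pre k ℤ.- pre (α * s i) ∣ ≤ x * δ i) (trans (cong (_* s i) α+x) (sym (up α′)))
      (chain i α x i≤I h (≤-trans (*-monoˡ-≤ (s i) (+-monoʳ-≤ α x≤y)) fits))
    last : ∣ pre ((α + y) * s i) ℤ.- pre ((α′ + y′) * s (suc i)) ∣ ≤ ρ * δ i
    last = subst₂ (λ k l → ∣ pre (k * s i) ℤ.- pre l ∣ ≤ ρ * δ i) (sym α+y) (sym (up (α′ + y′)))
      (chain i ((α′ + y′) * Q) ρ i≤I h (subst (λ k → k * s i ≤ len) α+y fits))
    mid : ∣ pre ((α′ + y′) * s (suc i)) ℤ.- pre (α′ * s (suc i)) ∣ ≤ stepSum δ (suc i) f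
    mid = interval f (suc i) α′ y′ (≤-trans (≤-reflexive (+-suc f i)) f+i≤)
      (≤-trans (≤-reflexive (up (α′ + y′))) (≤-trans (*-monoˡ-≤ (s i) (≤-trans (m≤m+n _ ρ) (≤-reflexive (sym α+y)))) fits))
      (≤-trans (*-monoˡ-≤ γ (≤-trans (≤-reflexive (up y′)) (*-monoˡ-≤ (s i) y′Q≤y))) short)
      (*-cancelʳ-< Q y′ (s f) (≤-<-trans y′Q≤y (<-≤-trans y< (≤-reflexive (trans (s-suc f) (*-comm Q (s f)))))))

-- Prefix sums, filtered lists and the iteration of partial colourings

take-+ : ∀ {A : Set} p y (L : List A) → take (p + y) L ≡ take p L ++ take y (drop p L)
take-+ zero    y L       = refl
take-+ (suc p) zero    []      = refl
take-+ (suc p) (suc y) []      = refl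
take-+ (suc p) y (z ∷ L) = cong (z ∷_) (take-+ p y L)

sumℤ-++ : ∀ {A : Set} (S S′ : List A) f → sumℤ (S ++ S′) f ≡ sumℤ S f ℤ.+ sumℤ S′ f
sumℤ-++ []      S′ f = sym (ℤ.+-identityˡ _)
sumℤ-++ (z ∷ S) S′ f = trans (cong (λ k → f z ℤ.+ k) (sumℤ-++ S S′ f)) (sym (ℤ.+-assoc (f z) _ _))

filterᵇ-++ : ∀ {A : Set} (X : A → Bool) S S′ → filterᵇ X (S ++ S′) ≡ filterᵇ X S ++ filterᵇ X S′
filterᵇ-++ X []      S′ = refl
filterᵇ-++ X (z ∷ S) S′ with X z
... | true  = cong (z ∷_) (filterᵇ-++ X S S′)
... | false = filterᵇ-++ X S S′

filterᵇ-take : ∀ {A : Set} (X : A → Bool) p L → filterᵇ X (take p L) ≡ take (length (filterᵇ X (take p L))) (filterᵇ X L)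
filterᵇ-take X zero    L       = refl
filterᵇ-take X (suc p) []      = refl
filterᵇ-take X (suc p) (z ∷ L) with X z
... | true  = cong (z ∷_) (filterᵇ-take X p L)
... | false = filterᵇ-take X p L

length-filterᵇ≤ : ∀ {A : Set} (X : A → Bool) L → length (filterᵇ X L) ≤ length L
length-filterᵇ≤ X []      = z≤n
length-filterᵇ≤ X (z ∷ L) with X z
... | true  = s≤s (length-filterᵇ≤ X L)
... | false = m≤n⇒m≤1+n (length-filterᵇ≤ X L)

length-take≤ : ∀ {A : Set} y (L : List A) → length (take y L) ≤ y
length-take≤ y L = ≤-trans (≤-reflexive (length-take y L)) (m⊓n≤m y (length L))

sumℤ-filterᵇ : ∀ {A : Set} (X : A → Bool) (w : A → ℤ) → (∀ y → X y ≡ false → w y ≡ + 0) → ∀ L → sumℤ L w ≡ sumℤ (filterᵇ X L) w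
sumℤ-filterᵇ X w h []      = refl
sumℤ-filterᵇ X w h (z ∷ L) with X z in eq
... | true  = cong (λ k → w z ℤ.+ k) (sumℤ-filterᵇ X w h L)
... | false = trans (cong (λ k → k ℤ.+ sumℤ L w) (h z eq)) (trans (ℤ.+-identityˡ _) (sumℤ-filterᵇ X w h L))

module Colouring {n : ℕ} (ord : Fin n → List (Fin n)) (simple : ∀ d → Simple (ord d)) (g : Fin n → ℕ) (N j : ℕ)
  (few : ∀ i → Σ (fins n) (λ d → ⟦ s i * g d ≤? N ⟧) * 256 ≤ s j * (1 + 16 * (j ∸ i))) where

  open Step ord simple g N j few

  osc : (Fin n → ℤ) → Fin n → ℕ → ℕ → ℤ
  osc w d p y = sumℤ (take (p + y) (ord d)) w ℤ.- sumℤ (take p (ord d)) w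

  Bounded : (Fin n → ℤ) → ℕ → Set
  Bounded w b = ∀ d p y → y * g d ≤ N → ∣ osc w d p y ∣ ≤ b

  step : ℕ → ℕ
  step I = stepSum δ 0 (suc I)

  module _ (X : Fin n → Bool) (I : ℕ) (w : Fin n → ℤ) (supp : ∀ y → X y ≡ false → w y ≡ + 0)
    (blk : ∀ i → i ≤ I → ∀ S → S ∈ blocks X i → ∣ sumℤ S w ∣ ≤ δ i) (r< : card X < s (suc I)) where

    module _ (d : Fin n) where

      private
        M = filterᵇ X (ord d)
        pre : ℕ → ℤ
        pre k = sumℤ (take k M) w

      aligned : ∀ i → i ≤ I → s i * g d ≤ N → ∀ k → suc k * s i ≤ length M → ∣ pre (suc k * s i) ℤ.- pre (k * s i) ∣ ≤ δ i
      aligned i i≤I h k fits = ≤-trans (≤-reflexive (cong ∣_∣ diff)) (blk i i≤I _ (∈-concatMap (blocksOf X i) (∈-fins d) member))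
        where
        instance _ = >-nonZero (1≤s i)
        S = take (s i) (drop (k * s i) M)
        e : ∀ a b → (a ℤ.+ b) ℤ.- a ≡ b
        e = ℤR.solve-∀
        diff : pre (suc k * s i) ℤ.- pre (k * s i) ≡ sumℤ S w
        diff = trans (cong (λ l → sumℤ l w ℤ.- pre (k * s i)) (trans (cong (λ a → take a M) (+-comm (s i) (k * s i))) (take-+ (k * s i) (s i) M)))
          (trans (cong (λ a → a ℤ.- pre (k * s i)) (sumℤ-++ (take (k * s i) M) S w)) (e (pre (k * s i)) (sumℤ S w)))
        k< : k < length M / s i
        k< = *-cancelʳ-< (s i) k (length M / s i) (+-cancelˡ-< (s i) _ _ (≤-<-trans fits (<-≤-trans (≤-reflexive (cong suc (m≡m%n+[m/n]*n (length M) (s i)))) (+-monoˡ-≤ (length M / s i * s i) (m%n<n (length M) (s i))))))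
        member : S ∈ blocksOf X i d
        member with s i * g d ≤? N
        ... | yes _ = ∈-map⁺ (λ k → take (s i) (drop (k * s i) M)) (∈-rng k<)
        ... | no ¬h = contradiction h ¬h

      -- Deleting the points outside `X` turns an interval of positions in `ord d` into an interval
      -- of ranks in `M` that is no longer. It has fewer than `s (suc I)` entries, so the scales 0,
      -- ..., I suffice.
      bounded-d : ∀ p y → y * g d ≤ N → ∣ osc w d p y ∣ ≤ step I
      bounded-d p y short = ≤-trans (≤-reflexive (cong ∣_∣ (cong₂ ℤ._-_ (trans (toM (p + y)) (cong pre (trans rank-+ (sym (*1 (rank + ρ)))))) (trans (toM p) (cong pre (sym (*1 rank)))))))
        (interval (suc I) 0 rank ρ (≤-reflexive (+-identityʳ (suc I)))
          (≤-trans (≤-reflexive (trans (*1 (rank + ρ)) (sym rank-+))) rank≤)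
          (≤-trans (*-monoˡ-≤ (g d) (≤-trans (≤-reflexive (*1 ρ)) (≤-trans (length-filterᵇ≤ X (take y (drop p L))) (length-take≤ y (drop p L))))) short)
          (≤-<-trans (≤-trans (m≤n+m ρ rank) (≤-trans (≤-reflexive (sym rank-+)) (≤-trans rank≤ (length-filter≤card X L (simple d))))) r<))
        where
        open Interval pre (length M) (g d) N I δ aligned
        L = ord d
        *1 : ∀ k → k * s 0 ≡ k
        *1 k = trans (cong (k *_) s-zero) (*-identityʳ k)
        rank ρ : ℕ
        rank = length (filterᵇ X (take p L))
        ρ = length (filterᵇ X (take y (drop p L)))
        toM : ∀ a → sumℤ (take a L) w ≡ pre (length (filterᵇ X (take a L)))
        toM a = trans (sumℤ-filterᵇ X w supp (take a L)) (cong (λ l → sumℤ l w) (filterᵇ-take X a L))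
        rank-+ : length (filterᵇ X (take (p + y) L)) ≡ rank + ρ
        rank-+ = trans (cong (length ∘ filterᵇ X) (take-+ p y L)) (trans (cong length (filterᵇ-++ X (take p L) _)) (length-++ (filterᵇ X (take p L))))
        rank≤ : length (filterᵇ X (take (p + y) L)) ≤ length M
        rank≤ = ≤-trans (≤-reflexive (trans (cong length (filterᵇ-take X (p + y) L)) (length-take ra M))) (m⊓n≤n ra (length M))
          where ra = length (filterᵇ X (take (p + y) L))

  partial : ∀ X I u → card X < s (suc I) → 64 + 32 * I ≤ card X → 16 * u ≤ card X →
    ∃[ χ ] ∃[ χ′ ] sim X χ χ′ < card X ∸ u × Bounded (val (differOn X χ χ′) (lookup χ)) (step I)
  partial X I u r< big 16u≤r = conclude (halving X I u big 16u≤r)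
    where
    supp : ∀ χ χ′ y → X y ≡ false → val (differOn X χ χ′) (lookup χ) y ≡ + 0
    supp χ χ′ y eq rewrite eq = refl
    conclude : (∃[ χ ] ∃[ χ′ ] sim X χ χ′ < card X ∸ u ×
        (∀ i → i ≤ I → ∀ S → S ∈ blocks X i → ∣ sumℤ S (val (differOn X χ χ′) (lookup χ)) ∣ ≤ δ i)) →
      ∃[ χ ] ∃[ χ′ ] sim X χ χ′ < card X ∸ u × Bounded (val (differOn X χ χ′) (lookup χ)) (step I)
    conclude (χ , χ′ , small , blk) = χ , χ′ , small , λ d → bounded-d X I (val (differOn X χ χ′) (lookup χ)) (supp χ χ′) blk r< d

  osc-+ : ∀ {w w₁ w₂} → (∀ L → sumℤ L w ≡ sumℤ L w₁ ℤ.+ sumℤ L w₂) → ∀ d p y → osc w d p y ≡ osc w₁ d p y ℤ.+ osc w₂ d p y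
  osc-+ {w} {w₁} {w₂} h d p y = trans (cong₂ ℤ._-_ (h L₁) (h L₀)) (e (sumℤ L₁ w₁) (sumℤ L₁ w₂) (sumℤ L₀ w₁) (sumℤ L₀ w₂))
    where
    L₁ = take (p + y) (ord d)
    L₀ = take p (ord d)
    e : ∀ a b c d → (a ℤ.+ b) ℤ.- (c ℤ.+ d) ≡ (a ℤ.- c) ℤ.+ (b ℤ.- d)
    e = ℤR.solve-∀

  Colourable : (Fin n → Bool) → ℕ → Set
  Colourable X b = ∃[ ψ ] Bounded (val X ψ) b

  trivial : ∀ X → Colourable X (card X)
  trivial X = (λ _ → true) , λ d p y _ → let S = take y (drop p (ord d)) in begin
    ∣ osc (val X (λ _ → true)) d p y ∣        ≡⟨ cong ∣_∣ (trans (cong (λ l → sumℤ l w ℤ.- sumℤ (take p (ord d)) w) (take-+ p y (ord d)))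
                                                   (trans (cong (λ a → a ℤ.- sumℤ (take p (ord d)) w) (sumℤ-++ (take p (ord d)) S w)) (e (sumℤ (take p (ord d)) w) (sumℤ S w)))) ⟩
    ∣ sumℤ S w ∣                              ≤⟨ abs≤ S ⟩
    Σ S (𝟙 ∘ X)                               ≡⟨ length-filter X S ⟨
    length (filterᵇ X S)                      ≤⟨ length-filter≤card X S (λ z → ≤-trans (occ-take y (drop p (ord d)) z) (≤-trans (occ-drop p (ord d) z) (simple d z))) ⟩
    card X                                    ∎
    where
    open ≤-Reasoning
    w = val X (λ _ → true)
    e : ∀ a b → (a ℤ.+ b) ℤ.- a ≡ b
    e = ℤR.solve-∀
    abs≤ : ∀ S → ∣ sumℤ S w ∣ ≤ Σ S (𝟙 ∘ X)
    abs≤ []      = z≤n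
    abs≤ (z ∷ S) = ≤-trans (ℤ.∣i+j∣≤∣i∣+∣j∣ (w z) (sumℤ S w)) (+-mono-≤ pt (abs≤ S))
      where
      pt : ∣ w z ∣ ≤ 𝟙 (X z)
      pt with X z
      ... | true  = ≤-refl
      ... | false = z≤n

  weaken : ∀ {X b b′} → Colourable X b → b ≤ b′ → Colourable X b′
  weaken (ψ , h) b≤b′ = ψ , λ d p y l → ≤-trans (h d p y l) b≤b′

  -- The two colourings live on complementary parts of `X`, so their interval sums add.
  combine : ∀ X χ χ′ {b₁ b₂ b} → Bounded (val (differOn X χ χ′) (lookup χ)) b₁ → Colourable (agreeOn X χ χ′) b₂ →
    b₁ + b₂ ≤ b → Colourable X b
  combine X χ χ′ {b₁} {b₂} {b} h₁ (ψ , h₂) le = recolour X χ χ′ ψ , λ d p y l → begin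
    ∣ osc (val X (recolour X χ χ′ ψ)) d p y ∣       ≡⟨ cong ∣_∣ (osc-+ {val X (recolour X χ χ′ ψ)} {w₁} {val (agreeOn X χ χ′) ψ} (λ L → sumℤ-recolour X L χ χ′ ψ) d p y) ⟩
    ∣ osc w₁ d p y ℤ.+ osc (val (agreeOn X χ χ′) ψ) d p y ∣ ≤⟨ ℤ.∣i+j∣≤∣i∣+∣j∣ (osc w₁ d p y) _ ⟩
    ∣ osc w₁ d p y ∣ + ∣ osc (val (agreeOn X χ χ′) ψ) d p y ∣ ≤⟨ +-mono-≤ (h₁ d p y l) (h₂ d p y l) ⟩
    b₁ + b₂                                         ≤⟨ le ⟩
    b                                               ∎
    where
    open ≤-Reasoning
    w₁ = val (differOn X χ χ′) (lookup χ)

  -- While the point count stays between `s (suc I)` and `Q` times as much, every partial colouring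
  -- is charged only for the fixed progress `u`. This bounds the number of rounds and lets all of
  -- them share one error bound.
  module Phase (I u b : ℕ) (u-def : s (suc I) ≡ 16 * u) (ih : ∀ X → card X < s (suc I) → Colourable X b) where

    phase : ∀ k X → card X < s (2 + I) → card X < s (suc I) + k * u → Colourable X (b + k * step (suc I))
    phase zero    X r< r<′ = weaken (ih X (<-≤-trans r<′ (≤-reflexive (+-identityʳ _)))) (m≤m+n b 0)
    phase (suc k) X r< r<′ = go (card X <? s (suc I))
      where
      continue : (∃[ χ ] ∃[ χ′ ] sim X χ χ′ < card X ∸ u × Bounded (val (differOn X χ χ′) (lookup χ)) (step (suc I))) →
        Colourable X (b + suc k * step (suc I))
      continue (χ , χ′ , small , h₁) = combine X χ χ′ h₁
        (phase k (agreeOn X χ χ′) (<-≤-trans small (≤-trans (m∸n≤m (card X) u) (<⇒≤ r<)))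
          (<-≤-trans small (≤-trans (∸-monoˡ-≤ u (<⇒≤ r<′)) (≤-reflexive (trans (cong (_∸ u) (e (s (suc I)) u (k * u))) (m+n∸n≡m _ u))))))
        (≤-reflexive (e′ (step (suc I)) b (k * step (suc I))))
        where
        e : ∀ a u k → a + (u + k) ≡ a + k + u
        e = solve-∀
        e′ : ∀ a b c → a + (b + c) ≡ b + (a + c)
        e′ = solve-∀
      go : Dec (card X < s (suc I)) → Colourable X (b + suc k * step (suc I))
      go (yes l) = weaken (ih X l) (m≤m+n b _)
      go (no ≮s) = continue (partial X (suc I) u r< (≤-trans (s-large I) (≮⇒≥ ≮s)) (≤-trans (≤-reflexive (sym u-def)) (≮⇒≥ ≮s)))

  16Q : ℕ
  16Q = 16 * Q

  phases : ∀ K X → card X < s (suc K) → Colourable X (Q + 16Q * Σ (rng K) (λ I → step (suc I)))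
  phases zero    X r< = weaken (trivial X) (≤-trans (<⇒≤ r<) (≤-trans (≤-reflexive (trans (s-suc 0) (trans (cong (Q *_) s-zero) (*-identityʳ Q)))) (m≤m+n Q _)))
  phases (suc K) X r< = subst (Colourable X) (e Q 16Q (step (suc K)) (Σ (rng K) (λ I → step (suc I))))
    -- `16Q` rounds suffice because `16Q * u` equals `s (2 + K)`, the size at which the phase
    -- starts.
    (P.phase 16Q X r< (<-≤-trans r< (≤-trans (≤-reflexive big) (m≤n+m _ (s (suc K))))))
    where
    u = Q₁₆ * s K
    u-def : s (suc K) ≡ 16 * u
    u-def = trans (s-suc K) (trans (cong (_* s K) Q≡16Q₁₆) (*-assoc 16 Q₁₆ (s K)))
    big : s (2 + K) ≡ 16Q * u
    big = trans (s-suc (suc K)) (trans (cong (Q *_) u-def) (f Q u))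
      where
      f : ∀ a b → a * (16 * b) ≡ 16 * a * b
      f = solve-∀
    module P = Phase K u _ u-def (phases K)
    e : ∀ a w x y → a + w * y + w * x ≡ a + w * (x + y)
    e = solve-∀

  δ-scaled : ∀ i → δ i * 2 ^ (∣ i - j ∣) ≤ root j
  δ-scaled i = predΔ≤ j i

  stepSum≡ : ∀ i f → stepSum δ i f ≡ 2 * Q * Σ (rng f) (λ x → δ (x + i))
  stepSum≡ i zero    = sym (*-zeroʳ (2 * Q))
  stepSum≡ i (suc f) = begin
    2 * Q * δ i + stepSum δ (suc i) f                                ≡⟨ cong (λ k → 2 * Q * δ i + k) (stepSum≡ (suc i) f) ⟩
    2 * Q * δ i + 2 * Q * Σ (rng f) (λ x → δ (x + suc i))            ≡⟨ *-distribˡ-+ (2 * Q) (δ i) _ ⟨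
    2 * Q * (δ i + Σ (rng f) (λ x → δ (x + suc i)))                  ≡⟨ cong (λ k → 2 * Q * (δ i + k)) (Σ-cong (rng f) (λ x → cong δ (+-suc x i))) ⟩
    2 * Q * (δ i + Σ (rng f) (λ x → δ (suc x + i)))                  ≡⟨ cong (2 * Q *_) (+-comm (δ i) _) ⟩
    2 * Q * (Σ (rng f) (λ x → δ (suc x + i)) + δ (0 + i))            ≡⟨ cong (2 * Q *_) (Σ-rng-shift f (λ x → δ (x + i))) ⟨
    2 * Q * Σ (rng (suc f)) (λ x → δ (x + i))                        ∎
    where open ≡-Reasoning

  step≡ : ∀ I → step I ≡ 2 * Q * Σ (rng (suc I)) δ
  step≡ I = trans (stepSum≡ 0 (suc I)) (cong (2 * Q *_) (Σ-cong (rng (suc I)) (λ x → cong δ (+-identityʳ x))))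

  step-high : ∀ I → step I ≤ 6 * Q * root j
  step-high I = ≤-trans (≤-reflexive (step≡ I)) (≤-trans (*-monoʳ-≤ (2 * Q) (Σ-two-sided j δ δ-scaled (suc I))) (≤-reflexive (e Q (root j))))
    where
    e : ∀ a b → 2 * a * (3 * b) ≡ 6 * a * b
    e = solve-∀

  -- Below j the allowances grow geometrically up to scale I, so their sum inherits the decay in j -
  -- I.
  step-low : ∀ I → I < j → step I * 2 ^ (j ∸ I) ≤ 4 * Q * root j
  step-low I I<j = begin
    step I * 2 ^ (j ∸ I)                                  ≡⟨ cong₂ _*_ (step≡ I) (cong (2 ^_) (+-∸-assoc 1 I<j)) ⟩
    2 * Q * S * (2 * 2 ^ (j ∸ suc I))                     ≡⟨ e Q S (2 ^ (j ∸ suc I)) ⟩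
    4 * Q * (S * 2 ^ (j ∸ suc I))                         ≤⟨ *-monoʳ-≤ (4 * Q) (Σ-ascending δ (λ i i<j → subst (λ d → δ i * 2 ^ d ≤ root j) (m≤n⇒∣m-n∣≡n∸m (<⇒≤ i<j)) (δ-scaled i)) (suc I) I<j) ⟩
    4 * Q * root j                                        ∎
    where
    open ≤-Reasoning
    S = Σ (rng (suc I)) δ
    e : ∀ a b c → 2 * a * b * (2 * c) ≡ 4 * a * (b * c)
    e = solve-∀

  Σ-step : ∀ k → Σ (rng (suc k + j)) step ≤ (1 + k) * (10 * Q * root j)
  Σ-step k = begin
    Σ (rng (suc k + j)) step                                          ≡⟨ Σ-rng-split (suc k) j step ⟩
    Σ (rng (suc k)) (λ x → step (x + j)) + Σ (rng j) step             ≤⟨ +-mono-≤ (Σ-rng-≤ (suc k) (6 * Q * root j) (λ x _ → step-high (x + j))) low ⟩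
    suc k * (6 * Q * root j) + 4 * Q * root j                         ≤⟨ +-monoʳ-≤ (suc k * (6 * Q * root j)) (m≤m+n (4 * Q * root j) (k * (4 * Q * root j))) ⟩
    suc k * (6 * Q * root j) + suc k * (4 * Q * root j)               ≡⟨ e (suc k) Q (root j) ⟩
    suc k * (10 * Q * root j)                                         ∎
    where
    open ≤-Reasoning
    low : Σ (rng j) step ≤ 4 * Q * root j
    low = ≤-trans (≤-reflexive (sym (*-identityʳ _))) (subst (λ d → Σ (rng j) step * 2 ^ d ≤ 4 * Q * root j) (n∸n≡0 j) (Σ-ascending step step-low j ≤-refl))
    e : ∀ k a b → k * (6 * a * b) + k * (4 * a * b) ≡ k * (10 * a * b)
    e = solve-∀

  -- In the constant, `Q` is the trivial colouring of the last points, and `160 * Q * Q` is `16 * Q`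
  -- rounds in each phase times the `10 * Q` of `Σ-step`.
  colouring : ∀ k X → card X < s (suc (k + j)) → Colourable X ((Q + 160 * Q * Q) * ((1 + k) * root j))
  colouring k X r< = weaken (phases (k + j) X r<) (begin
    Q + 16Q * Σ (rng (k + j)) (λ I → step (suc I))             ≤⟨ +-monoʳ-≤ Q (*-monoʳ-≤ 16Q (≤-trans (m≤m+n _ (step 0)) (≤-reflexive (sym (Σ-rng-shift (k + j) step))))) ⟩
    Q + 16Q * Σ (rng (suc k + j)) step                         ≤⟨ +-mono-≤ (m≤m*n Q (P) {{>-nonZero (*-mono-≤ (s≤s (z≤n {k})) (1≤root j))}}) (*-monoʳ-≤ 16Q (Σ-step k)) ⟩
    Q * P + 16 * Q * ((1 + k) * (10 * Q * root j))             ≡⟨ e Q (1 + k) (root j) ⟩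
    (Q + 160 * Q * Q) * P                                      ∎)
    where
    open ≤-Reasoning
    P = (1 + k) * root j
    e : ∀ q k r → q * (k * r) + 16 * q * (k * (10 * q * r)) ≡ (q + 160 * q * q) * (k * r)
    e = solve-∀

-- Progressions in ℤ_n

psum : (ℕ → ℤ) → ℕ → ℤ
psum h zero    = + 0
psum h (suc p) = h p ℤ.+ psum h p

psum-+ : ∀ h a b → psum h (a + b) ≡ psum h a ℤ.+ psum (λ k → h (a + k)) b
psum-+ h a zero    = trans (cong (psum h) (+-identityʳ a)) (sym (ℤ.+-identityʳ _))
psum-+ h a (suc b) = trans (cong (psum h) (+-suc a b)) (trans (cong (λ k → h (a + b) ℤ.+ k) (psum-+ h a b)) (e (h (a + b)) (psum h a) (psum (λ k → h (a + k)) b)))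
  where
  e : ∀ x y z → x ℤ.+ (y ℤ.+ z) ≡ y ℤ.+ (x ℤ.+ z)
  e = ℤR.solve-∀

psum-cong : ∀ {h h′} p → (∀ k → k < p → h k ≡ h′ k) → psum h p ≡ psum h′ p
psum-cong zero    e = refl
psum-cong (suc p) e = cong₂ ℤ._+_ (e p ≤-refl) (psum-cong p (λ k l → e k (m<n⇒m<1+n l)))

take-applyUpTo : ∀ {A : Set} (f : ℕ → A) p n → p ≤ n → take p (applyUpTo f n) ≡ applyUpTo f p
take-applyUpTo f zero    n       _         = refl
take-applyUpTo f (suc p) (suc n) (s≤s p≤n) = cong (f 0 ∷_) (take-applyUpTo (f ∘ suc) p n p≤n)

sumℤ-applyUpTo : ∀ {A : Set} (f : ℕ → A) (w : A → ℤ) p → sumℤ (applyUpTo f p) w ≡ psum (w ∘ f) p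
sumℤ-applyUpTo f w zero    = refl
sumℤ-applyUpTo f w (suc p) = trans (cong (λ l → sumℤ l w) (sym (applyUpTo-∷ʳ f p))) (trans (sumℤ-++ (applyUpTo f p) _ w)
  (trans (ℤ.+-comm (sumℤ (applyUpTo f p) w) _) (cong₂ ℤ._+_ (ℤ.+-identityʳ (w (f p))) (sumℤ-applyUpTo f w p))))

Σ-applyUpTo : ∀ {A : Set} (f : ℕ → A) (h : A → ℕ) p → Σ (applyUpTo f p) h ≡ Σ (rng p) (h ∘ f)
Σ-applyUpTo f h zero    = refl
Σ-applyUpTo f h (suc p) = trans (cong (λ l → Σ l h) (sym (applyUpTo-∷ʳ f p))) (trans (Σ-++ (applyUpTo f p) _ h)
  (trans (+-comm (Σ (applyUpTo f p) h) _) (cong₂ _+_ (+-identityʳ (h (f p))) (Σ-applyUpTo f h p))))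

eqF≤1 : ∀ {n} (x y : Fin n) → eqF x y ≤ 1
eqF≤1 zero    zero    = ≤-refl
eqF≤1 zero    (suc y) = z≤n
eqF≤1 (suc x) zero    = z≤n
eqF≤1 (suc x) (suc y) = eqF≤1 x y

eqF⇒≡ : ∀ {n} (x y : Fin n) → eqF x y ≢ 0 → x ≡ y
eqF⇒≡ zero    zero    h = refl
eqF⇒≡ zero    (suc y) h = contradiction refl h
eqF⇒≡ (suc x) zero    h = contradiction refl h
eqF⇒≡ (suc x) (suc y) h = cong suc (eqF⇒≡ x y h)

Σ-rng-0 : ∀ n (a : ℕ → ℕ) → (∀ i → i < n → a i ≡ 0) → Σ (rng n) a ≡ 0
Σ-rng-0 zero    a h = refl
Σ-rng-0 (suc n) a h = cong₂ _+_ (h n ≤-refl) (Σ-rng-0 n a (λ i l → h i (m<n⇒m<1+n l)))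

Σ-rng-unique : ∀ n (a : ℕ → ℕ) → (∀ i → a i ≤ 1) → (∀ i k → i < n → k < n → a i ≢ 0 → a k ≢ 0 → i ≡ k) → Σ (rng n) a ≤ 1
Σ-rng-unique zero    a a≤1 u = z≤n
Σ-rng-unique (suc n) a a≤1 u with a n ≟ 0
... | yes z rewrite z = Σ-rng-unique n a a≤1 (λ i k i< k< → u i k (m<n⇒m<1+n i<) (m<n⇒m<1+n k<))
... | no ¬z = ≤-trans (≤-reflexive (trans (cong (λ k → a n + k) (Σ-rng-0 n a others)) (+-identityʳ (a n)))) (a≤1 n)
  where
  others : ∀ i → i < n → a i ≡ 0
  others i i<n with a i ≟ 0
  ... | yes z = z
  ... | no ¬zi = contradiction (u i n (m<n⇒m<1+n i<n) ≤-refl ¬zi ¬z) (<⇒≢ i<n)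

Σ-rng-witness : ∀ n (a : ℕ → ℕ) → Σ (rng n) a ≢ 0 → ∃[ i ] i < n × a i ≢ 0
Σ-rng-witness zero    a h = contradiction refl h
Σ-rng-witness (suc n) a h with a n ≟ 0
... | no ¬z = n , ≤-refl , ¬z
... | yes z with Σ-rng-witness n a (λ e → h (cong₂ _+_ z e))
...   | i , i<n , w = i , m<n⇒m<1+n i<n , w

fsum-const1 : ∀ n → fsum {n} (λ _ → 1) ≡ n
fsum-const1 zero    = refl
fsum-const1 (suc n) = cong suc (fsum-const1 n)

-- Pigeonhole: together with a missed point the entries would be n + 1 distinct elements.
occ-surjective : ∀ {n} (L : List (Fin n)) → Simple L → length L ≡ n → ∀ a → occ L a ≢ 0
occ-surjective {n} L simple len a occ≡0 = contradiction (begin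
  suc n                                        ≡⟨ +-comm 1 n ⟩
  n + 1                                        ≡⟨ cong₂ _+_ (trans (sym len) (sym total)) (sym one) ⟩
  fsum (occ L) + fsum (eqF a)                  ≡⟨ fsum-+ (occ L) (eqF a) ⟨
  fsum (λ y → occ L y + eqF a y)               ≤⟨ fsum-mono pt ⟩
  fsum {n} (λ _ → 1)                           ≡⟨ fsum-const1 n ⟩
  n                                            ∎) (<⇒≱ (n<1+n n))
  where
  open ≤-Reasoning
  total : fsum (occ L) ≡ length L
  total = trans (fsum-cong (λ y → sym (*-identityʳ (occ L y)))) (trans (fsum-occ L (λ _ → 1)) (trans (Σ-const L 1) (*-identityʳ _)))
  one : fsum (eqF a) ≡ 1
  one = trans (fsum-cong (λ y → sym (*-identityʳ (eqF a y)))) (fsum-eqF a (λ _ → 1))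
  pt : ∀ y → occ L y + eqF a y ≤ 1
  pt y with eqF a y ≟ 0
  ... | yes z = ≤-trans (≤-reflexive (trans (cong (λ k → occ L y + k) z) (+-identityʳ _))) (simple y)
  ... | no ¬z with eqF⇒≡ a y ¬z
  ...   | refl = ≤-trans (≤-reflexive (cong (_+ eqF a a) occ≡0)) (eqF≤1 a a)

%-≡⇒∣∸ : ∀ x y n .{{_ : NonZero n}} → x % n ≡ y % n → x ≤ y → n ∣ y ∸ x
%-≡⇒∣∸ x y n e x≤y = divides (y / n ∸ x / n) (begin
  y ∸ x                                                ≡⟨ cong₂ _∸_ (m≡m%n+[m/n]*n y n) (m≡m%n+[m/n]*n x n) ⟩
  (y % n + y / n * n) ∸ (x % n + x / n * n)            ≡⟨ cong (λ k → (y % n + y / n * n) ∸ (k + x / n * n)) e ⟩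
  (y % n + y / n * n) ∸ (y % n + x / n * n)            ≡⟨ [m+n]∸[m+o]≡n∸o (y % n) (y / n * n) (x / n * n) ⟩
  y / n * n ∸ x / n * n                                ≡⟨ *-distribʳ-∸ n (y / n) (x / n) ⟨
  (y / n ∸ x / n) * n                                  ∎)
  where open ≡-Reasoning

module Residues (m : ℕ) where

  residue : ℕ → Fin (suc m)
  residue x = fromℕ< (m%n<n x (suc m))

  residue-cong : ∀ x y → x % suc m ≡ y % suc m → residue x ≡ residue y
  residue-cong x y e = fromℕ<-cong (x % suc m) (y % suc m) e (m%n<n x (suc m)) (m%n<n y (suc m))

  toℕ-residue : ∀ x → toℕ (residue x) ≡ x % suc m
  toℕ-residue x = toℕ-fromℕ< (m%n<n x (suc m))

-- ℤ_n is listed coset by coset of the subgroup generated by d, each coset in steps of d.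
module Cosets (m : ℕ) (d : Fin (suc m)) (γ ℓ c : ℕ) {{_ : NonZero γ}} {{_ : NonZero ℓ}}
  (ℓγ≡n : ℓ * γ ≡ suc m) (cγ≡D : c * γ ≡ toℕ d) (coprime-ℓ-c : Coprime ℓ c) where

  open Residues m

  private
    n D : ℕ
    n = suc m
    D = toℕ d

  γ∣n : γ ∣ n
  γ∣n = divides ℓ (sym ℓγ≡n)

  γ∣D : γ ∣ D
  γ∣D = divides c (sym cγ≡D)

  -- The quotient by `ℓ` names the coset through its representative below `γ`; the remainder counts
  -- steps of d.
  point : ℕ → Fin n
  point p = residue (p / ℓ + p % ℓ * D)

  point-at : ∀ ρ k → k < ℓ → point (k + ρ * ℓ) ≡ residue (ρ + k * D)
  point-at ρ k k<ℓ = cong₂ (λ a b → residue (a + b * D))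
    (trans (+-distrib-/-∣ʳ k (n∣m*n ρ)) (cong₂ _+_ (m<n⇒m/n≡0 k<ℓ) (m*n/n≡m ρ ℓ)))
    (trans ([m+kn]%n≡m%n k ρ ℓ) (m<n⇒m%n≡m k<ℓ))

  row<γ : ∀ p → p < n → p / ℓ < γ
  row<γ p p<n = m<n*o⇒m/o<n (<-≤-trans p<n (≤-reflexive (trans (sym ℓγ≡n) (*-comm ℓ γ))))

  -- Dividing n ∣ (k′ - k) D by `γ` leaves ℓ ∣ (k′ - k) c; as `c` is prime to `ℓ`, this would force
  -- k′ - k ≥ ℓ unless it is 0.
  column-unique : ∀ ρ k k′ → k ≤ k′ → k′ < ℓ → (ρ + k * D) % n ≡ (ρ + k′ * D) % n → k ≡ k′
  column-unique ρ k k′ k≤k′ k′<ℓ e with k′ ∸ k in eq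
  ... | zero  = ≤-antisym k≤k′ (m∸n≡0⇒m≤n eq)
  ... | suc t = contradiction (∣⇒≤ ℓ∣) (<⇒≱ (≤-<-trans (≤-trans (≤-reflexive (sym eq)) (m∸n≤m k′ k)) k′<ℓ))
    where
    n∣ : n ∣ (suc t) * D
    n∣ = subst (n ∣_) (trans ([m+n]∸[m+o]≡n∸o ρ (k′ * D) (k * D)) (trans (sym (*-distribʳ-∸ D k′ k)) (cong (_* D) eq)))
      (%-≡⇒∣∸ (ρ + k * D) (ρ + k′ * D) n e (+-monoʳ-≤ ρ (*-monoˡ-≤ D k≤k′)))
    e₁ : ∀ a b c → a * (b * c) ≡ b * a * c
    e₁ = solve-∀
    ℓ∣ : ℓ ∣ suc t
    ℓ∣ = coprime-divisor coprime-ℓ-c (*-cancelʳ-∣ γ (subst₂ _∣_ (sym ℓγ≡n) (trans (cong (suc t *_) (sym cγ≡D)) (e₁ (suc t) c γ)) n∣))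

  point-injective : ∀ p p′ → p < n → p′ < n → point p ≡ point p′ → p ≡ p′
  point-injective p p′ p<n p′<n e = begin
    p                        ≡⟨ m≡m%n+[m/n]*n p ℓ ⟩
    p % ℓ + p / ℓ * ℓ        ≡⟨ cong₂ (λ a b → a + b * ℓ) cols rows ⟩
    p′ % ℓ + p′ / ℓ * ℓ      ≡⟨ m≡m%n+[m/n]*n p′ ℓ ⟨
    p′                       ∎
    where
    open ≡-Reasoning
    x = p / ℓ + p % ℓ * D
    x′ = p′ / ℓ + p′ % ℓ * D
    mod-n : x % n ≡ x′ % n
    mod-n = trans (sym (toℕ-residue x)) (trans (cong toℕ e) (toℕ-residue x′))
    -- `γ` divides both n and D, so reduction modulo `γ` forgets the column and leaves the row.
    row-mod : ∀ p → p < n → (p / ℓ + p % ℓ * D) % n % γ ≡ p / ℓ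
    row-mod p p<n = trans (m∣n⇒o%n%m≡o%m γ n (p / ℓ + p % ℓ * D) γ∣n) (trans (%-remove-+ʳ (p / ℓ) (∣n⇒∣m*n (p % ℓ) γ∣D)) (m<n⇒m%n≡m (row<γ p p<n)))
    rows : p / ℓ ≡ p′ / ℓ
    rows = trans (sym (row-mod p p<n)) (trans (cong (_% γ) mod-n) (row-mod p′ p′<n))
    cols : p % ℓ ≡ p′ % ℓ
    cols with ≤-total (p % ℓ) (p′ % ℓ)
    ... | inj₁ l = column-unique (p / ℓ) (p % ℓ) (p′ % ℓ) l (m%n<n p′ ℓ) (trans mod-n (cong (λ r → (r + p′ % ℓ * D) % n) (sym rows)))
    ... | inj₂ l = sym (column-unique (p / ℓ) (p′ % ℓ) (p % ℓ) l (m%n<n p ℓ) (trans (cong (λ r → (r + p′ % ℓ * D) % n) rows) (sym mod-n)))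

  ord : List (Fin n)
  ord = applyUpTo point n

  ord-simple : Simple ord
  ord-simple y = ≤-trans (≤-reflexive (Σ-applyUpTo point (λ z → eqF z y) n))
    (Σ-rng-unique n (λ i → eqF (point i) y) (λ i → eqF≤1 (point i) y)
      (λ i k i< k< u v → point-injective i k i< k< (trans (eqF⇒≡ (point i) y u) (sym (eqF⇒≡ (point k) y v)))))

  point-surjective : ∀ a → ∃[ p ] p < n × point p ≡ a
  point-surjective a with Σ-rng-witness n (λ i → eqF (point i) a)
    (λ e → occ-surjective ord ord-simple (length-applyUpTo point n) a (trans (Σ-applyUpTo point (λ z → eqF z a) n) e))
  ... | p , p<n , u = p , p<n , eqF⇒≡ (point p) a u

  module _ (w : Fin n → ℤ) (b : ℕ)
    (bounded : ∀ p y → y * γ ≤ n → ∣ sumℤ (take (p + y) ord) w ℤ.- sumℤ (take p ord) w ∣ ≤ b) where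

    interval-bound : ∀ ρ k y → ρ < γ → k + y ≤ ℓ → ∣ psum (λ i → w (residue (ρ + (k + i) * D))) y ∣ ≤ b
    interval-bound ρ k y ρ<γ k+y≤ℓ = subst (_≤ b) (cong ∣_∣ diff) (bounded (k + ρ * ℓ) y (≤-trans (*-monoˡ-≤ γ (≤-trans (m≤n+m y k) k+y≤ℓ)) (≤-reflexive ℓγ≡n)))
      where
      base = k + ρ * ℓ
      e₁ : ∀ k r y → k + r + y ≡ k + y + r
      e₁ = solve-∀
      e₂ : ∀ a b → (a ℤ.+ b) ℤ.- a ≡ b
      e₂ = ℤR.solve-∀
      fits : base + y ≤ n
      fits = begin
        k + ρ * ℓ + y      ≡⟨ e₁ k (ρ * ℓ) y ⟩
        k + y + ρ * ℓ      ≤⟨ +-monoˡ-≤ (ρ * ℓ) k+y≤ℓ ⟩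
        suc ρ * ℓ          ≤⟨ *-monoˡ-≤ ℓ ρ<γ ⟩
        γ * ℓ              ≡⟨ trans (*-comm γ ℓ) ℓγ≡n ⟩
        n                  ∎
        where open ≤-Reasoning
      prefix : ∀ p → p ≤ n → sumℤ (take p ord) w ≡ psum (w ∘ point) p
      prefix p p≤n = trans (cong (λ l → sumℤ l w) (take-applyUpTo point p n p≤n)) (sumℤ-applyUpTo point w p)
      diff : sumℤ (take (base + y) ord) w ℤ.- sumℤ (take base ord) w ≡ psum (λ i → w (residue (ρ + (k + i) * D))) y
      diff = trans (cong₂ ℤ._-_ (trans (prefix (base + y) fits) (psum-+ (w ∘ point) base y)) (prefix base (≤-trans (m≤m+n base y) fits)))
        (trans (e₂ (psum (w ∘ point) base) _) (psum-cong y (λ i i<y → cong w (trans (cong point (e₁ k (ρ * ℓ) i)) (point-at ρ (k + i) (<-≤-trans (+-monoʳ-< k i<y) k+y≤ℓ))))))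

    module _ (p : ℕ) (p<n : p < n) (l : ℕ) (lγ≤n : l * γ ≤ n) where

      private
        ρ k₀ : ℕ
        ρ = p / ℓ
        k₀ = p % ℓ

        h : ℕ → ℤ
        h i = w (residue (ρ + (k₀ + i) * D))

        l≤ℓ : l ≤ ℓ
        l≤ℓ = *-cancelʳ-≤ l ℓ γ (≤-trans lγ≤n (≤-reflexive (sym ℓγ≡n)))

      shift : ∀ i → apElem m (point p) d i ≡ residue (ρ + (k₀ + i) * D)
      shift i = residue-cong (toℕ (point p) + i * D) (ρ + (k₀ + i) * D) (begin
        (toℕ (point p) + i * D) % n                      ≡⟨ cong (λ z → (z + i * D) % n) (toℕ-residue (ρ + k₀ * D)) ⟩
        ((ρ + k₀ * D) % n + i * D) % n                   ≡⟨ %-distribˡ-+ ((ρ + k₀ * D) % n) (i * D) n ⟩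
        ((ρ + k₀ * D) % n % n + i * D % n) % n           ≡⟨ cong (λ z → (z + i * D % n) % n) (m%n%n≡m%n (ρ + k₀ * D) n) ⟩
        ((ρ + k₀ * D) % n + i * D % n) % n               ≡⟨ %-distribˡ-+ (ρ + k₀ * D) (i * D) n ⟨
        (ρ + k₀ * D + i * D) % n                         ≡⟨ cong (_% n) (e ρ k₀ i D) ⟩
        (ρ + (k₀ + i) * D) % n                           ∎)
        where
        open ≡-Reasoning
        e : ∀ r k i D → r + k * D + i * D ≡ r + (k + i) * D
        e = solve-∀

      -- After ℓ - k₀ steps the progression is back in column 0 of its coset, since n divides ℓ D;
      -- as l ≤ ℓ, this happens only once.
      wrapped : ℓ ≤ k₀ + l → ∣ psum h l ∣ ≤ 2 * b
      wrapped over = begin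
        ∣ psum h l ∣                                          ≡⟨ cong (λ k → ∣ psum h k ∣) l≡ ⟨
        ∣ psum h (y₁ + y₂) ∣                                  ≡⟨ cong ∣_∣ (psum-+ h y₁ y₂) ⟩
        ∣ psum h y₁ ℤ.+ psum (λ i → h (y₁ + i)) y₂ ∣          ≤⟨ ℤ.∣i+j∣≤∣i∣+∣j∣ (psum h y₁) _ ⟩
        ∣ psum h y₁ ∣ + ∣ psum (λ i → h (y₁ + i)) y₂ ∣        ≤⟨ +-mono-≤ (interval-bound ρ k₀ y₁ (row<γ p p<n) (≤-reflexive k₀+y₁)) second ⟩
        b + b                                                 ≡⟨ cong (λ k → b + k) (sym (+-identityʳ b)) ⟩
        2 * b                                                 ∎
        where
        open ≤-Reasoning
        k₀≤ℓ = <⇒≤ (m%n<n p ℓ)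
        y₁ = ℓ ∸ k₀
        y₂ = l ∸ y₁
        k₀+y₁ : k₀ + y₁ ≡ ℓ
        k₀+y₁ = m+[n∸m]≡n k₀≤ℓ
        l≡ : y₁ + y₂ ≡ l
        l≡ = m+[n∸m]≡n (+-cancelˡ-≤ k₀ _ _ (≤-trans (≤-reflexive k₀+y₁) over))
        e₂ : ∀ r a i D → r + (a + i) * D ≡ r + i * D + a * D
        e₂ = solve-∀
        e₃ : ∀ a b c → a * (b * c) ≡ b * (a * c)
        e₃ = solve-∀
        n∣ℓD : n ∣ ℓ * D
        n∣ℓD = divides c (trans (cong (ℓ *_) (sym cγ≡D)) (trans (e₃ ℓ c γ) (cong (c *_) ℓγ≡n)))
        wrap : ∀ i → h (y₁ + i) ≡ w (residue (ρ + (0 + i) * D))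
        wrap i = cong w (residue-cong (ρ + (k₀ + (y₁ + i)) * D) (ρ + i * D)
          (trans (cong (λ z → (ρ + z * D) % n) (trans (sym (+-assoc k₀ y₁ i)) (cong (_+ i) k₀+y₁)))
            (trans (cong (_% n) (e₂ ρ ℓ i D)) (%-remove-+ʳ (ρ + i * D) n∣ℓD))))
        second : ∣ psum (λ i → h (y₁ + i)) y₂ ∣ ≤ b
        second = ≤-trans (≤-reflexive (cong ∣_∣ (psum-cong y₂ (λ i _ → wrap i))))
          (interval-bound ρ 0 y₂ (row<γ p p<n) (≤-trans (m∸n≤m l y₁) l≤ℓ))

      from-point : ∣ psum (λ k → w (apElem m (point p) d k)) l ∣ ≤ 2 * b
      from-point = ≤-trans (≤-reflexive (cong ∣_∣ (psum-cong l (λ i _ → cong w (shift i))))) (split (≤-total (k₀ + l) ℓ))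
        where
        split : k₀ + l ≤ ℓ ⊎ ℓ ≤ k₀ + l → ∣ psum h l ∣ ≤ 2 * b
        split (inj₁ fits) = ≤-trans (interval-bound ρ k₀ l (row<γ p p<n) fits) (m≤m+n b _)
        split (inj₂ over) = wrapped over

    progression-bound : ∀ a l → l * γ ≤ n → ∣ psum (λ k → w (apElem m a d k)) l ∣ ≤ 2 * b
    progression-bound a l lγ≤n = conclude (point-surjective a)
      where
      conclude : (∃[ p ] p < n × point p ≡ a) → ∣ psum (λ k → w (apElem m a d k)) l ∣ ≤ 2 * b
      conclude (p , p<n , e) = subst (λ a → ∣ psum (λ k → w (apElem m a d k)) l ∣ ≤ 2 * b) e (from-point p p<n l lγ≤n)

apSum≡psum : ∀ m X χ a d l → apSum m X χ a d l ≡ psum (λ k → val X χ (apElem m a d k)) l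
apSum≡psum m X χ a d zero    = refl
apSum≡psum m X χ a d (suc l) = cong (λ z → val X χ (apElem m a d l) ℤ.+ z) (apSum≡psum m X χ a d l)

-- Choice of the critical scale and the final bound

module Difference (m : ℕ) (d : Fin (suc m)) where

  γ : ℕ
  γ = gcd (suc m) (toℕ d)

  abstract
    γ≢0 : NonZero γ
    γ≢0 = ≢-nonZero (gcd[m,n]≢0 (suc m) (toℕ d) (inj₁ λ ()))

    ℓ c : ℕ
    ℓ = _/_ (suc m) γ {{γ≢0}}
    c = _/_ (toℕ d) γ {{γ≢0}}

    ℓγ≡n : ℓ * γ ≡ suc m
    ℓγ≡n = m/n*n≡m {{γ≢0}} (gcd[m,n]∣m (suc m) (toℕ d))

    cγ≡D : c * γ ≡ toℕ d
    cγ≡D = m/n*n≡m {{γ≢0}} (gcd[m,n]∣n (suc m) (toℕ d))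

    ℓ≢0 : NonZero ℓ
    ℓ≢0 = ≢-nonZero (λ e → contradiction (trans (sym ℓγ≡n) (cong (_* γ) e)) λ ())

    coprime-ℓ-c : Coprime ℓ c
    coprime-ℓ-c = gcd≡1⇒coprime (*-cancelˡ-≡ (gcd ℓ c) 1 γ {{γ≢0}} (trans (c*gcd[m,n]≡gcd[cm,cn] γ ℓ c)
      (trans (cong₂ gcd (trans (*-comm γ ℓ) ℓγ≡n) (trans (*-comm γ c) cγ≡D)) (sym (*-identityʳ γ)))))

  open Cosets m d γ ℓ c {{γ≢0}} {{ℓ≢0}} ℓγ≡n cγ≡D coprime-ℓ-c public
    using (ord; ord-simple; progression-bound)

Σ-fins-toℕ : ∀ n (h : ℕ → ℕ) → Σ (fins n) (h ∘ toℕ) ≡ Σ (rng n) h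
Σ-fins-toℕ zero    h = refl
Σ-fins-toℕ (suc n) h = trans (cong (λ k → h 0 + k) (trans (Σ-map suc (fins n) (h ∘ toℕ)) (Σ-fins-toℕ n (h ∘ suc))))
  (trans (+-comm (h 0) _) (sym (Σ-rng-shift n h)))

card≤n : ∀ {n} (X : Fin n → Bool) → card X ≤ n
card≤n {zero}  X = z≤n
card≤n {suc n} X with X zero
... | true  = s≤s (card≤n (X ∘ suc))
... | false = m≤n⇒m≤1+n (card≤n (X ∘ suc))

abstract
  -- Granting a whole scale to each factor 2 is wasteful, but it leaves only k + 1 phases from scale
  -- j upwards.
  n<s : ∀ k j → 2 ^ k * s j < s (suc (k + j))
  n<s k j = subst₂ _<_ (trans (^-distribˡ-+-* 2 k (j * 16)) (cong (2 ^ k *_) (sym (s≡ j)))) (sym (s≡ (suc (k + j))))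
    (^-monoʳ-< 2 (s≤s (s≤s z≤n)) {k + j * 16} {suc (k + j) * 16} (s≤s (≤-trans (+-monoˡ-≤ (j * 16) (m≤m*n k 16))
      (≤-trans (≤-reflexive (sym (*-distribʳ-+ 16 k j))) (m≤n+m _ 15)))))

  s-ratio : ∀ i j → s j ≤ s i * 2 ^ ((j ∸ i) * 16)
  s-ratio i j = subst₂ _≤_ (sym (s≡ j)) (trans (cong (2 ^_) (*-distribʳ-+ 16 i (j ∸ i))) (trans (^-distribˡ-+-* 2 (i * 16) _) (cong (_* 2 ^ ((j ∸ i) * 16)) (sym (s≡ i)))))
    (^-monoʳ-≤ 2 {j * 16} {(i + (j ∸ i)) * 16} (*-monoˡ-≤ 16 (m≤n+m∸n j i)))

  T≤sT : ∀ T → T ≤ s T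
  T≤sT T = subst (T ≤_) (sym (s≡ T)) (≤-trans (≤-trans (n≤1+n T) (1+n≤2^n T)) (^-monoʳ-≤ 2 (m≤m*n T 16)))

-- `K` merely starts the downward search; rounding `T` up to a block size costs at most a factor
-- `Q`.
scale-for : ∀ T K → 1 ≤ T → T ≤ s K → ∃[ j ] T ≤ s j × s j ≤ Q * T
scale-for T zero    1≤T h = 0 , h , ≤-trans (≤-reflexive s-zero) (*-mono-≤ 1≤Q 1≤T)
scale-for T (suc K) 1≤T h with T ≤? s K
... | yes p = scale-for T K 1≤T p
... | no  p = suc K , h , ≤-trans (≤-reflexive (s-suc K)) (*-monoʳ-≤ Q (<⇒≤ (≰⇒> p)))

C : ℕ
C = Q + 160 * Q * Q

module Bound (m k f : ℕ) (dense : suc m ≤ 2 ^ k * f)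
  (count-gcd< : ∀ a → Σ (rng (suc m)) (λ y → ⟦ gcd (suc m) y <? 2 ^ a ⟧) ≤ 32 * f * a) where

  open Difference m using (ord; ord-simple; progression-bound) renaming (γ to g)

  private
    n T : ℕ
    n = suc m
    -- 8192 is 32 from `count-gcd<` times the 256 demanded of `few`.
    T = 8192 * f * (1 + k)

    1≤f : 1 ≤ f
    1≤f = n≢0⇒n>0 λ { refl → contradiction (≤-trans dense (≤-reflexive (*-zeroʳ (2 ^ k)))) λ () }

    f≤T : f ≤ T
    f≤T = ≤-trans (m≤n*m f 8192) (m≤m*n (8192 * f) (1 + k))

  scale : ∃[ j ] T ≤ s j × s j ≤ Q * T
  scale = scale-for T T (≤-trans 1≤f f≤T) (T≤sT T)

  -- From s i g ≤ n ≤ s i 2 ^ a, with a = k + 16 e, the gcd is at most 2 ^ a. Then 1 + a ≤ (1 + k)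
  -- (1 + 16 e) splits off the factor 1 + k that is part of `T`.
  few : ∀ i → Σ (fins n) (λ d → ⟦ s i * g d ≤? n ⟧) * 256 ≤ s (proj₁ scale) * (1 + 16 * (proj₁ scale ∸ i))
  few i = begin
    Σ (fins n) (λ d → ⟦ s i * g d ≤? n ⟧) * 256          ≤⟨ *-monoˡ-≤ 256 (Σ-mono (fins n) (λ d → ⟦⟧-mono (s i * g d ≤? n) (gcd n (toℕ d) <? 2 ^ suc a) (γ-small d))) ⟩
    Σ (fins n) (λ d → ⟦ gcd n (toℕ d) <? 2 ^ suc a ⟧) * 256 ≡⟨ cong (_* 256) (Σ-fins-toℕ n (λ y → ⟦ gcd n y <? 2 ^ suc a ⟧)) ⟩
    Σ (rng n) (λ y → ⟦ gcd n y <? 2 ^ suc a ⟧) * 256     ≤⟨ *-monoˡ-≤ 256 (count-gcd< (suc a)) ⟩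
    32 * f * suc a * 256                                 ≤⟨ *-monoˡ-≤ 256 (*-monoʳ-≤ (32 * f) (≤-trans (m≤m+n (suc a) (k * (16 * e))) (≤-reflexive (e₁ k e)))) ⟩
    32 * f * ((1 + k) * (1 + 16 * e)) * 256              ≡⟨ e₂ f (1 + k) (1 + 16 * e) ⟩
    T * (1 + 16 * e)                                     ≤⟨ *-monoˡ-≤ (1 + 16 * e) (proj₁ (proj₂ scale)) ⟩
    s j * (1 + 16 * e)                                   ∎
    where
    open ≤-Reasoning
    j = proj₁ scale
    e = j ∸ i
    a = k + e * 16
    e₁ : ∀ k e → 1 + (k + e * 16) + k * (16 * e) ≡ (1 + k) * (1 + 16 * e)
    e₁ = solve-∀
    e₂ : ∀ f x y → 32 * f * (x * y) * 256 ≡ 8192 * f * x * y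
    e₂ = solve-∀
    e₃ : ∀ a b c → a * (b * c) ≡ b * (a * c)
    e₃ = solve-∀
    n≤ : n ≤ s i * 2 ^ a
    n≤ = begin
      n                               ≤⟨ dense ⟩
      2 ^ k * f                       ≤⟨ *-monoʳ-≤ (2 ^ k) (≤-trans f≤T (proj₁ (proj₂ scale))) ⟩
      2 ^ k * s j                     ≤⟨ *-monoʳ-≤ (2 ^ k) (s-ratio i j) ⟩
      2 ^ k * (s i * 2 ^ (e * 16))    ≡⟨ e₃ (2 ^ k) (s i) (2 ^ (e * 16)) ⟩
      s i * (2 ^ k * 2 ^ (e * 16))    ≡⟨ cong (s i *_) (sym (^-distribˡ-+-* 2 k (e * 16))) ⟩
      s i * 2 ^ a                     ∎
    γ-small : ∀ d → s i * g d ≤ n → gcd n (toℕ d) < 2 ^ suc a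
    γ-small d h = ≤-<-trans (*-cancelˡ-≤ (s i) {{>-nonZero (1≤s i)}} (≤-trans h n≤)) (^-monoʳ-< 2 (s≤s (s≤s z≤n)) (n<1+n a))

  open Colouring ord ord-simple g n (proj₁ scale) few using (colouring)

  progressions : ∀ X → ∃[ χ ] ∀ a d l → l * gcd n (toℕ d) ≤ n →
    ∣ apSum m X χ a d l ∣ * ∣ apSum m X χ a d l ∣ ≤ 4 * C * C * Q * 8192 * f * (1 + k) ^ 3
  progressions X = conclude (colouring k X (≤-<-trans (card≤n X) (≤-<-trans dense (≤-<-trans (*-monoʳ-≤ (2 ^ k) (≤-trans f≤T (proj₁ (proj₂ scale)))) (n<s k (proj₁ scale))))))
    where
    open ≤-Reasoning
    j = proj₁ scale
    b = C * ((1 + k) * root j)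
    e₁ : ∀ c k r → 2 * (c * (k * r)) * (2 * (c * (k * r))) ≡ 4 * c * c * (k * k) * (r * r)
    e₁ = solve-∀
    e₂ : ∀ c k q f → c * (k * k) * (q * (8192 * f * k)) ≡ c * q * 8192 * f * (k * (k * (k * 1)))
    e₂ = solve-∀
    square : 2 * b * (2 * b) ≤ 4 * C * C * Q * 8192 * f * (1 + k) ^ 3
    square = begin
      2 * b * (2 * b)                                           ≡⟨ e₁ C (1 + k) (root j) ⟩
      4 * C * C * ((1 + k) * (1 + k)) * (root j * root j)       ≡⟨ cong (4 * C * C * ((1 + k) * (1 + k)) *_) (root² j) ⟩
      4 * C * C * ((1 + k) * (1 + k)) * s j                     ≤⟨ *-monoʳ-≤ (4 * C * C * ((1 + k) * (1 + k))) (proj₂ (proj₂ scale)) ⟩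
      4 * C * C * ((1 + k) * (1 + k)) * (Q * (8192 * f * (1 + k))) ≡⟨ e₂ (4 * C * C) (1 + k) Q f ⟩
      4 * C * C * Q * 8192 * f * (1 + k) ^ 3                    ∎
    conclude : (∃[ χ ] ∀ d p y → y * g d ≤ n → ∣ sumℤ (take (p + y) (ord d)) (val X χ) ℤ.- sumℤ (take p (ord d)) (val X χ) ∣ ≤ b) →
      ∃[ χ ] ∀ a d l → l * gcd n (toℕ d) ≤ n →
        ∣ apSum m X χ a d l ∣ * ∣ apSum m X χ a d l ∣ ≤ 4 * C * C * Q * 8192 * f * (1 + k) ^ 3
    conclude (χ , bounded) = χ , λ a d l h → ≤-trans (*-mono-≤ (bound a d l h) (bound a d l h)) square
      where
      bound : ∀ a d l → l * gcd n (toℕ d) ≤ n → ∣ apSum m X χ a d l ∣ ≤ 2 * b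
      bound a d l h = ≤-trans (≤-reflexive (cong ∣_∣ (apSum≡psum m X χ a d l))) (progression-bound d (val X χ) b (bounded d) a l h)

-- The least admissible `k` is the binary logarithm of n / φ(n) rounded up, so 1 + k is at most 2
-- log (e n / φ(n)). Squaring both sides of the bound avoids roots, and the quantifier over `X`
-- makes it hereditary.
theorem5p3 : ∃[ c ] ∀ (m : ℕ) (k : ℕ) → suc m ≤ 2 ^ k * φ (suc m) →
    ∀ (X : Fin (suc m) → Bool) → ∃[ χ ] ∀ (a d : Fin (suc m)) (l : ℕ) →
    l * gcd (suc m) (toℕ d) ≤ suc m →
    ∣ apSum m X χ a d l ∣ * ∣ apSum m X χ a d l ∣ ≤ c * φ (suc m) * (1 + k) ^ 3
theorem5p3 = 4 * C * C * Q * 8192 , λ m k dense → Bound.progressions m k (φ (suc m)) dense (GcdCounts.count-gcd< m)
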